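{- $\mathrm{LUA}_{\mathrm{slow}}$ is not of deep degree; that is, there is no deep nonempty $\Pi^0_1$ set $P\subseteq\{0,1\}^{\mathbb{N}}$ with $P \equiv_{\mathrm{w}} \mathrm{LUA}_{\mathrm{slow}}$.
   Context: An order function is a computable (i.e. its values are uniformly computable reals), nondecreasing, unbounded function $\mathbb{N}\to\mathbb{R}$. An order function $q\colon\mathbb{N}\to(1,\infty)$ is slow-growing if $\sum_{n=0}^\infty q(n)^{ -1}=\infty$. A partial recursive $\psi\colon\subseteq\mathbb{N}\to\mathbb{N}$ is linearly universal if for every partial recursive $\theta\colon\subseteq\mathbb{N}\to\mathbb{N}$ there are $a,b\in\mathbb{N}$ with $\psi(ax+b)\simeq\theta(x)$ for all $x$. For $p\colon\mathbb{N}\to(1,\infty)$, $\mathrm{LUA}(p)$ is the set of $X\in\mathbb{N}^{\mathbb{N}}$ such that $X(n)<p(n)$ for all $n$ and, for some linearly universal partial recursive $\psi$, there is no $n\in\operatorname{dom}\psi$ with $X(n)=\psi(n)$. $\mathrm{LUA}_{\mathrm{slow}}=\bigcup\{\mathrm{LUA}(q) : q\colon\mathbb{N}\to(1,\infty)\text{ a slow-growing order function}\}$. For $P,Q\subseteq\mathbb{N}^{\mathbb{N}}$, $P\leq_{\mathrm{w}}Q$ means every $Y\in Q$ Turing-computes some $X\in P$; $P\equiv_{\mathrm{w}}Q$ means $P\leq_{\mathrm{w}}Q$ and $Q\leq_{\mathrm{w}}P$. Depth: a continuous semimeasure on $\{0,1\}^*$ is $\nu\colon\{0,1\}^*\to[0,1]$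 with $\nu(\langle\rangle)=1$ and $\nu(\sigma)\geq\nu(\sigma^\frown 0)+\nu(\sigma^\frown 1)$. Fix a universal left r.e. continuous semimeasure $\mathbf{M}$, i.e. $\mathbf{M}$ is left r.e. (uniformly approximable from below) and for each left r.e. continuous semimeasure $\nu$ there is $c\in\mathbb{N}$ with $\nu(\sigma)\leq c\,\mathbf{M}(\sigma)$ for all $\sigma$. A $\Pi^0_1$ set $P\subseteq\{0,1\}^{\mathbb{N}}$ is deep if there is an order function $r\colon\mathbb{N}\to\mathbb{N}$ with $\sum_{\sigma\in P\upharpoonright r(n)}\mathbf{M}(\sigma)\leq 2^{ -n}$ for all $n$, where $P\upharpoonright m=\{X\upharpoonright m : X\in P\}$. -}

module Defs where

open import Data.Bool.Base using (Bool; true; false)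
open import Data.Fin.Base using (Fin)
import Data.Integer.Base as ℤ
open import Data.List.Base using (List; []; _∷_; _∷ʳ_; applyUpTo; foldr; map)
open import Data.List.Membership.Propositional using (_∈_)
open import Data.List.Relation.Unary.Unique.Propositional using (Unique)
open import Data.Nat.Base as ℕ using (ℕ; zero; suc)
open import Data.Product.Base using (Σ-syntax; ∃; ∃-syntax; _×_; _,_)
open import Data.Rational.Base as ℚ using (ℚ; 0ℚ; 1ℚ; ½; _/_)
import Data.Rational.Properties as ℚP
import Data.Rational.Solver as ℚSolver
open import Data.Sum.Base using (inj₁; inj₂)
open import Data.Vec.Base using (Vec; []; _∷_; lookup)
open import Function.Bundles using (_⇔_)
open import Level using (0ℓ)
open import Relation.Binary.PropositionalEquality
  using (_≡_; refl; sym; trans; cong; cong₂; subst; subst₂)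
open import Relation.Nullary.Negation using (¬_)
open import Relation.Unary using (Pred)

2^-_ : ℕ → ℚ
2^- zero  = 1ℚ
2^- suc n = ½ ℚ.* (2^- n)

-- Rapidly converging Cauchy sequences of rationals.  Such a sequence need
-- not be computable; different sequences may represent the same real.
record ℝ : Set where
  constructor mkℝ
  field
    seq     : ℕ → ℚ
    regular : ∀ m n → ℚ.∣ seq m ℚ.- seq n ∣ ℚ.≤ 2^- m ℚ.+ 2^- n

open ℝ public

infix 4 _≤_ _<_ _≈_
infixl 6 _+_
infixr 7 _·_

-- seq x n is within 2^-n of x; hence the slack 2 · 2^-n below.
_≤_ : ℝ → ℝ → Set
x ≤ y = ∀ n → seq x n ℚ.≤ seq y n ℚ.+ (2^- n ℚ.+ 2^- n)

_<_ : ℝ → ℝ → Set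
x < y = ∃[ n ] seq x n ℚ.+ (2^- n ℚ.+ 2^- n) ℚ.< seq y n

_≈_ : ℝ → ℝ → Set
x ≈ y = x ≤ y × y ≤ x

0≤2^- : ∀ n → 0ℚ ℚ.≤ 2^- n
0≤2^- zero    = ℚP.nonNegative⁻¹ 1ℚ
0≤2^- (suc n) = subst (ℚ._≤ ½ ℚ.* (2^- n)) (ℚP.*-zeroʳ ½)
                  (ℚP.*-monoˡ-≤-nonNeg ½ (0≤2^- n))

halves : ∀ n → 2^- suc n ℚ.+ 2^- suc n ≡ 2^- n
halves n = trans (sym (ℚP.*-distribʳ-+ (2^- n) ½ ½)) (ℚP.*-identityˡ (2^- n))

interchange : ∀ a b c d → (a ℚ.+ b) ℚ.+ (c ℚ.+ d) ≡ (a ℚ.+ c) ℚ.+ (b ℚ.+ d)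
interchange = solve 4 (λ a b c d → (a :+ b) :+ (c :+ d) := (a :+ c) :+ (b :+ d)) refl
  where open ℚSolver.+-*-Solver

sub-interchange : ∀ a b c d → (a ℚ.+ b) ℚ.- (c ℚ.+ d) ≡ (a ℚ.- c) ℚ.+ (b ℚ.- d)
sub-interchange = solve 4 (λ a b c d → (a :+ b) :- (c :+ d) := (a :- c) :+ (b :- d)) refl
  where open ℚSolver.+-*-Solver

fromℚ : ℚ → ℝ
fromℚ q = mkℝ (λ _ → q) λ m n →
  subst (ℚ._≤ 2^- m ℚ.+ 2^- n) (sym (cong ℚ.∣_∣ (ℚP.+-inverseʳ q)))
    (ℚP.+-mono-≤ (0≤2^- m) (0≤2^- n))

fromℕ : ℕ → ℝ
fromℕ n = fromℚ (ℤ.+ n / 1)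

0ℝ 1ℝ : ℝ
0ℝ = fromℚ 0ℚ
1ℝ = fromℚ 1ℚ

_+_ : ℝ → ℝ → ℝ
x + y = mkℝ (λ n → seq x (suc n) ℚ.+ seq y (suc n)) λ m n →
  begin
    ℚ.∣ (seq x (suc m) ℚ.+ seq y (suc m)) ℚ.- (seq x (suc n) ℚ.+ seq y (suc n)) ∣
  ≡⟨ cong ℚ.∣_∣ (sub-interchange (seq x (suc m)) _ (seq x (suc n)) _) ⟩
    ℚ.∣ (seq x (suc m) ℚ.- seq x (suc n)) ℚ.+ (seq y (suc m) ℚ.- seq y (suc n)) ∣
  ≤⟨ ℚP.∣p+q∣≤∣p∣+∣q∣ (seq x (suc m) ℚ.- seq x (suc n)) _ ⟩
    ℚ.∣ seq x (suc m) ℚ.- seq x (suc n) ∣ ℚ.+ ℚ.∣ seq y (suc m) ℚ.- seq y (suc n) ∣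
  ≤⟨ ℚP.+-mono-≤ (regular x (suc m) (suc n)) (regular y (suc m) (suc n)) ⟩
    (2^- suc m ℚ.+ 2^- suc n) ℚ.+ (2^- suc m ℚ.+ 2^- suc n)
  ≡⟨ interchange (2^- suc m) _ _ _ ⟩
    (2^- suc m ℚ.+ 2^- suc m) ℚ.+ (2^- suc n ℚ.+ 2^- suc n)
  ≡⟨ cong₂ ℚ._+_ (halves m) (halves n) ⟩
    2^- m ℚ.+ 2^- n
  ∎
  where open ℚP.≤-Reasoning

_·_ : ℕ → ℝ → ℝ
zero  · x = 0ℝ
suc c · x = x + c · x

sum : List ℝ → ℝ
sum = foldr _+_ 0ℝ

private
  1⊔-positive : ∀ q → ℚ.Positive (1ℚ ℚ.⊔ q)
  1⊔-positive q = ℚ.positive (ℚP.<-≤-trans (ℚP.positive⁻¹ 1ℚ) (ℚP.p≤p⊔q 1ℚ q))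

1/⟨1⊔_⟩ : ℚ → ℚ
1/⟨1⊔ q ⟩ = (ℚ.1/ (1ℚ ℚ.⊔ q)) {{ℚP.pos⇒nonZero (1ℚ ℚ.⊔ q) {{1⊔-positive q}}}}

private
  module _ (q : ℚ) where
    a i : ℚ
    a = 1ℚ ℚ.⊔ q
    i = 1/⟨1⊔ q ⟩

    a-pos : ℚ.Positive a
    a-pos = 1⊔-positive q

    i-pos : ℚ.Positive i
    i-pos = ℚP.1/pos⇒pos a {{a-pos}}

    i*a : i ℚ.* a ≡ 1ℚ
    i*a = ℚP.*-inverseˡ a {{ℚP.pos⇒nonZero a {{a-pos}}}}

    i≤1 : i ℚ.≤ 1ℚ
    i≤1 = subst₂ ℚ._≤_ (ℚP.*-identityʳ i) i*a
            (ℚP.*-monoˡ-≤-nonNeg i {{ℚP.pos⇒nonNeg i {{i-pos}}}} (ℚP.p≤p⊔q 1ℚ q))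

  -- For p ≤ q:  0 ≤ 1/a - 1/b = (b - a)/(ab) ≤ b - a ≤ q - p.
  recip-diff : ∀ p q → i p ℚ.- i q ≡ i p ℚ.* i q ℚ.* (a q ℚ.- a p)
  recip-diff p q =
    begin-equality
      i p ℚ.- i q
    ≡⟨ cong₂ ℚ._-_ (sym (ℚP.*-identityʳ (i p))) (sym (ℚP.*-identityʳ (i q))) ⟩
      i p ℚ.* 1ℚ ℚ.- i q ℚ.* 1ℚ
    ≡⟨ cong₂ (λ u v → i p ℚ.* u ℚ.- i q ℚ.* v) (sym (i*a q)) (sym (i*a p)) ⟩
      i p ℚ.* (i q ℚ.* a q) ℚ.- i q ℚ.* (i p ℚ.* a p)
    ≡⟨ solve 4 (λ x y u v → x :* (y :* v) :- y :* (x :* u) := x :* y :* (v :- u)) refl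
         (i p) (i q) (a p) (a q) ⟩
      i p ℚ.* i q ℚ.* (a q ℚ.- a p)
    ∎
    where
    open ℚP.≤-Reasoning
    open ℚSolver.+-*-Solver

  neg-diff : ∀ x y → ℚ.- (x ℚ.- y) ≡ y ℚ.- x
  neg-diff = solve 2 (λ x y → :- (x :- y) := y :- x) refl
    where open ℚSolver.+-*-Solver

  ∣-∣-comm : ∀ x y → ℚ.∣ x ℚ.- y ∣ ≡ ℚ.∣ y ℚ.- x ∣
  ∣-∣-comm x y = trans (sym (ℚP.∣-p∣≡∣p∣ (x ℚ.- y))) (cong ℚ.∣_∣ (neg-diff x y))

  0≤diff : ∀ {x y} → x ℚ.≤ y → 0ℚ ℚ.≤ y ℚ.- x
  0≤diff {x} {y} x≤y =
    subst (ℚ._≤ y ℚ.- x) (ℚP.+-inverseʳ x) (ℚP.+-monoˡ-≤ (ℚ.- x) x≤y)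

  ⊔-lipschitz : ∀ p q → p ℚ.≤ q → a q ℚ.- a p ℚ.≤ q ℚ.- p
  ⊔-lipschitz p q p≤q =
    subst (a q ℚ.- a p ℚ.≤_) (cancel (q ℚ.- p) (a p))
      (ℚP.+-monoˡ-≤ (ℚ.- a p) (ℚP.⊔-lub 1≤ q≤))
    where
    open ℚSolver.+-*-Solver
    d = q ℚ.- p
    cancel : ∀ x y → (x ℚ.+ y) ℚ.- y ≡ x
    cancel = solve 2 (λ x y → (x :+ y) :- y := x) refl
    1≤ : 1ℚ ℚ.≤ d ℚ.+ a p
    1≤ = subst (ℚ._≤ d ℚ.+ a p) (ℚP.+-identityˡ 1ℚ)
           (ℚP.+-mono-≤ (0≤diff p≤q) (ℚP.p≤p⊔q 1ℚ p))
    q≤ : q ℚ.≤ d ℚ.+ a p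
    q≤ = subst (ℚ._≤ d ℚ.+ a p)
           (solve 2 (λ x y → (x :- y) :+ y := x) refl q p)
           (ℚP.+-monoʳ-≤ d (ℚP.p≤q⊔p 1ℚ p))

  recip-lipschitz-≤ : ∀ p q → p ℚ.≤ q → ℚ.∣ i p ℚ.- i q ∣ ℚ.≤ ℚ.∣ p ℚ.- q ∣
  recip-lipschitz-≤ p q p≤q =
    begin
      ℚ.∣ i p ℚ.- i q ∣
    ≡⟨ cong ℚ.∣_∣ (recip-diff p q) ⟩
      ℚ.∣ i p ℚ.* i q ℚ.* e ∣
    ≡⟨ ℚP.∣p*q∣≡∣p∣*∣q∣ (i p ℚ.* i q) e ⟩
      ℚ.∣ i p ℚ.* i q ∣ ℚ.* ℚ.∣ e ∣
    ≤⟨ ℚP.*-monoʳ-≤-nonNeg ℚ.∣ e ∣ {{ℚP.∣-∣-nonNeg e}} ∣ii∣≤1 ⟩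
      1ℚ ℚ.* ℚ.∣ e ∣
    ≡⟨ ℚP.*-identityˡ ℚ.∣ e ∣ ⟩
      ℚ.∣ e ∣
    ≡⟨ ℚP.0≤p⇒∣p∣≡p (0≤diff (ℚP.⊔-monoʳ-≤ 1ℚ p≤q)) ⟩
      e
    ≤⟨ ⊔-lipschitz p q p≤q ⟩
      q ℚ.- p
    ≡⟨ sym (ℚP.0≤p⇒∣p∣≡p (0≤diff p≤q)) ⟩
      ℚ.∣ q ℚ.- p ∣
    ≡⟨ ∣-∣-comm q p ⟩
      ℚ.∣ p ℚ.- q ∣
    ∎
    where
    open ℚP.≤-Reasoning
    e = a q ℚ.- a p
    instance
      ip-pos = i-pos p
      iq-pos = i-pos q
      ip-nonNeg = ℚP.pos⇒nonNeg (i p)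
    ii≤1 : i p ℚ.* i q ℚ.≤ 1ℚ
    ii≤1 = ℚP.≤-trans
      (subst (i p ℚ.* i q ℚ.≤_) (ℚP.*-identityʳ (i p)) (ℚP.*-monoˡ-≤-nonNeg (i p) (i≤1 q)))
      (i≤1 p)
    ∣ii∣≤1 : ℚ.∣ i p ℚ.* i q ∣ ℚ.≤ 1ℚ
    ∣ii∣≤1 = subst (ℚ._≤ 1ℚ)
      (sym (ℚP.0≤p⇒∣p∣≡p (ℚP.<⇒≤ (ℚP.positive⁻¹ (i p ℚ.* i q) {{ℚP.pos*pos⇒pos (i p) (i q)}})))) ii≤1

  recip-lipschitz : ∀ p q → ℚ.∣ i p ℚ.- i q ∣ ℚ.≤ ℚ.∣ p ℚ.- q ∣
  recip-lipschitz p q with ℚP.≤-total p q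
  ... | inj₁ p≤q = recip-lipschitz-≤ p q p≤q
  ... | inj₂ q≤p = subst₂ ℚ._≤_ (∣-∣-comm (i q) (i p)) (∣-∣-comm q p) (recip-lipschitz-≤ q p q≤p)

-- The reciprocal on (1,∞).  The approximations are truncated below at 1,
-- which leaves the limit unchanged when 1 < x.
recip : (x : ℝ) → 1ℝ < x → ℝ
recip x _ = mkℝ (λ n → 1/⟨1⊔ seq x n ⟩) λ m n →
  ℚP.≤-trans (recip-lipschitz (seq x m) (seq x n)) (regular x m n)

-- Kleene's schemes for n-ary functions partial recursive in k oracles.
data Code (k : ℕ) : ℕ → Set where
  zero   : Code k 0
  succ   : Code k 1
  proj   : ∀ {n} → Fin n → Code k n
  oracle : Fin k → Code k 1
  comp   : ∀ {m n} → Code k m → Vec (Code k n) m → Code k n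
  prec   : ∀ {n} → Code k n → Code k (suc (suc n)) → Code k (suc n)
  μ      : ∀ {n} → Code k (suc n) → Code k n

-- O ⊢ e [ xs ]↓ y : the function with code e, relative to the oracles O,
-- converges at xs with value y.
data _⊢_[_]↓_ {k} (O : Fin k → ℕ → ℕ) : ∀ {n} → Code k n → Vec ℕ n → ℕ → Set where
  ↓zero   : O ⊢ zero [ [] ]↓ 0
  ↓succ   : ∀ {x} → O ⊢ succ [ x ∷ [] ]↓ suc x
  ↓proj   : ∀ {n} {i : Fin n} {xs} → O ⊢ proj i [ xs ]↓ lookup xs i
  ↓oracle : ∀ {j x} → O ⊢ oracle j [ x ∷ [] ]↓ O j x
  ↓comp   : ∀ {m n} {f : Code k m} {gs : Vec (Code k n) m} {xs ys z} →
            (∀ j → O ⊢ lookup gs j [ xs ]↓ lookup ys j) →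
            O ⊢ f [ ys ]↓ z →
            O ⊢ comp f gs [ xs ]↓ z
  ↓prec-z : ∀ {n} {f : Code k n} {g xs y} →
            O ⊢ f [ xs ]↓ y →
            O ⊢ prec f g [ 0 ∷ xs ]↓ y
  ↓prec-s : ∀ {n} {f : Code k n} {g t xs y z} →
            O ⊢ prec f g [ t ∷ xs ]↓ y →
            O ⊢ g [ t ∷ y ∷ xs ]↓ z →
            O ⊢ prec f g [ suc t ∷ xs ]↓ z
  ↓μ      : ∀ {n} {f : Code k (suc n)} {xs y} →
            (∀ t → t ℕ.< y → ∃[ v ] O ⊢ f [ t ∷ xs ]↓ suc v) →
            O ⊢ f [ y ∷ xs ]↓ 0 →
            O ⊢ μ f [ xs ]↓ y

noOracle : Fin 0 → ℕ → ℕ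
noOracle ()

PartialRecursive : Set
PartialRecursive = Code 0 1

_⟨_⟩↓_ : PartialRecursive → ℕ → ℕ → Set
ψ ⟨ x ⟩↓ y = noOracle ⊢ ψ [ x ∷ [] ]↓ y

Computable₁ : (ℕ → ℕ) → Set
Computable₁ f = Σ[ e ∈ Code 0 1 ] ∀ x → noOracle ⊢ e [ x ∷ [] ]↓ f x

Computable₂ : (ℕ → ℕ → ℕ) → Set
Computable₂ f = Σ[ e ∈ Code 0 2 ] ∀ x y → noOracle ⊢ e [ x ∷ y ∷ [] ]↓ f x y

Computableℚ : (ℕ → ℕ → ℚ) → Set
Computableℚ f =
  ∃[ a ] ∃[ b ] ∃[ d ] Computable₂ a × Computable₂ b × Computable₂ d ×
    (∀ x y → f x y ≡ (a x y ℤ.⊖ b x y) / suc (d x y))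

Baire Cantor : Set
Baire  = ℕ → ℕ
Cantor = ℕ → Bool

infix 4 _≤T_ _≤w_ _≡w_

_≤T_ : Baire → Baire → Set
X ≤T Y = Σ[ e ∈ Code 1 1 ] ∀ n → (λ _ → Y) ⊢ e [ n ∷ [] ]↓ X n

_≤w_ : Pred Baire 0ℓ → Pred Baire 0ℓ → Set
P ≤w Q = ∀ Y → Q Y → ∃[ X ] P X × X ≤T Y

_≡w_ : Pred Baire 0ℓ → Pred Baire 0ℓ → Set
P ≡w Q = P ≤w Q × Q ≤w P

UniformlyComputable : (ℕ → ℝ) → Set
UniformlyComputable x = ∃[ f ] Computableℚ f ×
  (∀ i k → fromℚ (f i k ℚ.- 2^- k) ≤ x i × x i ≤ fromℚ (f i k ℚ.+ 2^- k))

record OrderFunction (q : ℕ → ℝ) : Set where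
  field
    computable    : UniformlyComputable q
    nondecreasing : ∀ {m n} → m ℕ.≤ n → q m ≤ q n
    unbounded     : ∀ B → ∃[ n ] B < q n

-- Σ q(n)⁻¹ = ∞: the partial sums of this series of positive terms are unbounded.
SlowGrowing : (q : ℕ → ℝ) → (∀ n → 1ℝ < q n) → Set
SlowGrowing q q>1 = ∀ B → ∃[ N ] B < sum (applyUpTo (λ n → recip (q n) (q>1 n)) N)

LinearlyUniversal : PartialRecursive → Set
LinearlyUniversal ψ = ∀ (θ : PartialRecursive) →
  ∃[ a ] ∃[ b ] ∀ x y → (ψ ⟨ a ℕ.* x ℕ.+ b ⟩↓ y) ⇔ (θ ⟨ x ⟩↓ y)

LUA : (ℕ → ℝ) → Pred Baire 0ℓ
LUA p X = (∀ n → fromℕ (X n) < p n) ×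
  ∃[ ψ ] LinearlyUniversal ψ × ¬ (∃[ n ] ψ ⟨ n ⟩↓ X n)

LUAslow : Pred Baire 0ℓ
LUAslow X = ∃[ q ] Σ[ q>1 ∈ (∀ n → 1ℝ < q n) ]
  OrderFunction q × SlowGrowing q q>1 × LUA q X

Str : Set
Str = List Bool

-- A bijection between strings and natural numbers.
⌜_⌝ : Str → ℕ
⌜ [] ⌝        = 0
⌜ false ∷ σ ⌝ = 1 ℕ.+ 2 ℕ.* ⌜ σ ⌝
⌜ true ∷ σ ⌝  = 2 ℕ.+ 2 ℕ.* ⌜ σ ⌝

_↾_ : Cantor → ℕ → Str
X ↾ m = applyUpTo X m

Recursive : Pred Str 0ℓ → Set
Recursive R = ∃[ χ ] Computable₁ χ × (∀ σ → R σ ⇔ χ ⌜ σ ⌝ ≡ 1)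

Π⁰₁ : Pred Cantor 0ℓ → Set₁
Π⁰₁ P = Σ[ R ∈ Pred Str 0ℓ ] Recursive R × (∀ X → P X ⇔ (∀ n → R (X ↾ n)))

bit : Bool → ℕ
bit false = 0
bit true  = 1

asBaire : Pred Cantor 0ℓ → Pred Baire 0ℓ
asBaire P X = Σ[ Y ∈ Cantor ] P Y × (∀ n → X n ≡ bit (Y n))

record Semimeasure (ν : Str → ℝ) : Set where
  field
    nonneg  : ∀ σ → 0ℝ ≤ ν σ
    ≤one    : ∀ σ → ν σ ≤ 1ℝ
    root    : ν [] ≈ 1ℝ
    superadditive : ∀ σ → ν (σ ∷ʳ false) + ν (σ ∷ʳ true) ≤ ν σ

record LeftRE (ν : Str → ℝ) : Set where
  field
    approx      : ℕ → ℕ → ℚ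
    computable  : Computableℚ approx
    increasing  : ∀ i s → approx i s ℚ.≤ approx i (suc s)
    below       : ∀ σ s → fromℚ (approx ⌜ σ ⌝ s) ≤ ν σ
    convergence : ∀ σ k → ∃[ s ] ν σ ≤ fromℚ (approx ⌜ σ ⌝ s ℚ.+ 2^- k)

record UniversalLeftRESemimeasure (M : Str → ℝ) : Set where
  field
    semimeasure : Semimeasure M
    leftRE      : LeftRE M
    universal   : ∀ ν → Semimeasure ν → LeftRE ν → ∃[ c ] ∀ σ → ν σ ≤ c · M σ

_↾ˢ_ : Pred Cantor 0ℓ → ℕ → Pred Str 0ℓ
(P ↾ˢ m) σ = ∃[ X ] P X × σ ≡ X ↾ m

Enumerates : List Str → Pred Str 0ℓ → Set
Enumerates L S = Unique L × (∀ σ → σ ∈ L ⇔ S σ)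

-- The sum over the finite set P ↾ r(n) is taken along a repetition-free list
-- of its elements.
Deep : (Str → ℝ) → Pred Cantor 0ℓ → Set
Deep M P = Σ[ r ∈ (ℕ → ℕ) ] OrderFunction (λ n → fromℕ (r n)) ×
  (∀ n → ∃[ L ] Enumerates L (P ↾ˢ r n) × sum (map M L) ≤ fromℚ (2^- n))

module Submission where

-- Bushy tree forcing. Let P be deep, say Σ { M(σ) : σ ∈ P ↾ r(n) } ≤ 2^-n, and let ψ be linearly
-- universal (one exists because P computes members of LUAslow). Let q be constant on very long
-- blocks with enormous jumps between them, so that Σ q(n)⁻¹ = ∞ although q outgrows the codes
-- of all strings that end at a jump. We build X ∈ ∏ q(n) as a limit of strings σ, each with a set
-- B of strings to be avoided that is not b-big above σ; initially B consists of the strings that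
-- agree with ψ somewhere, and b = 2.
--
-- To prevent the functional e from computing a member of P, extend σ to a jump, and let j be the
-- code of σ and R ≥ r(2j). If the strings on which e outputs R bits are not 2^R j-big above σ, add
-- them to B; then e is partial on X. Otherwise, by pigeonhole, some string y of length R is output
-- on a j-big set, and y = y(j) can be found effectively. The left r.e. semimeasure that
-- distributes weight 2^-(j+1) to y(j) is at most c M, so M(y ↾ r(2j)) > 2^-2j for large j and y
-- has no extension in P. As j ≥ b, some extension of σ outputs y and still has B small above it.

-- Two requirements pull against each other. Adding a set to B is harmless only if `q` later exceeds
-- the new bigness b + 2^R j, where j is the code of a string met in a construction guided by
-- excluded middle, whereas `q` has to be computable. But R is computable, j can be taken to be at
-- least b, and the strings that can end at a given jump have bounded codes, so `q` meets the
-- demands 2^R j + j of all of them in advance.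
--
-- Only the guess y(j) has to be effective. It cannot consult B, which depends on the choices made
-- so far. Bigness replaces that knowledge: a j-big set has a member above which B is still small,
-- for any B that is not b-big with b ≤ j. So a guess made from σ alone works against every
-- admissible B.
--
-- The constant c depends on e through the semimeasure, but j can be raised at will by going to a
-- later jump. Depth is invoked at 2j because the guessed weight 2^-(j+1) then exceeds 2^-2j by a
-- factor 2^(j-1), which outgrows c.

-- A calculus of total recursive functions.

module Computability where

  open import Data.Fin.Base using (Fin; zero; suc)
  open import Data.Fin.Patterns using (0F; 1F)
  open import Data.Nat.Base hiding (parity)
  open import Data.Nat.Properties
  open import Data.Vec.Base using (Vec; []; _∷_; lookup; map; tabulate; tail)
  open import Data.Vec.Properties using (lookup∘tabulate)
  open import Data.Vec.Relation.Unary.All using (All; []; _∷_)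
  open import Function.Base using (_∘_)
  open import Relation.Binary.PropositionalEquality
  open import Defs using (Code; zero; succ; proj; comp; prec; noOracle; _⊢_[_]↓_;
    ↓zero; ↓succ; ↓proj; ↓comp; ↓prec-z; ↓prec-s)

  -- The suffix ᶜ marks the recursiveness proof of the operation it is attached to, so that a proof
  -- that a term is recursive repeats the shape of the term.
  record Rec {n} (f : Vec ℕ n → ℕ) : Set where
    constructor rec
    field
      code     : Code 0 n
      computes : ∀ xs → noOracle ⊢ code [ xs ]↓ f xs

  open Rec public

  rec-ext : ∀ {n} {f g : Vec ℕ n → ℕ} → (∀ xs → f xs ≡ g xs) → Rec f → Rec g
  rec-ext f≗g (rec e ok) = rec e λ xs → subst (noOracle ⊢ e [ xs ]↓_) (f≗g xs) (ok xs)

  private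
    codes : ∀ {m n} {gs : Vec (Vec ℕ n → ℕ) m} → All Rec gs → Vec (Code 0 n) m
    codes []       = []
    codes (g ∷ gs) = code g ∷ codes gs

    codes-compute : ∀ {m n} {gs : Vec (Vec ℕ n → ℕ) m} (cs : All Rec gs) xs j →
      noOracle ⊢ lookup (codes cs) j [ xs ]↓ lookup (map (λ g → g xs) gs) j
    codes-compute (g ∷ gs) xs zero    = computes g xs
    codes-compute (g ∷ gs) xs (suc j) = codes-compute gs xs j

  compᶜ : ∀ {m n} {f : Vec ℕ m → ℕ} {gs : Vec (Vec ℕ n → ℕ) m} →
    Rec f → All Rec gs → Rec (λ xs → f (map (λ g → g xs) gs))
  compᶜ f gs = rec (comp (code f) (codes gs)) λ xs → ↓comp (codes-compute gs xs) (computes f _)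

  var : ∀ {n} (i : Fin n) → Rec (λ xs → lookup xs i)
  var i = rec (proj i) λ _ → ↓proj

  sucᶜ : ∀ {n} {f : Vec ℕ n → ℕ} → Rec f → Rec (λ xs → suc (f xs))

  sucᶜ {f = f} (rec e ok) = rec (comp succ (e ∷ [])) λ xs →
    ↓comp {ys = f xs ∷ []} (λ { zero → ok xs }) ↓succ

  const : ∀ {n} (k : ℕ) → Rec {n} (λ _ → k)
  const zero    = rec (comp zero []) λ xs → ↓comp {ys = []} (λ ()) ↓zero
  const (suc k) = sucᶜ (const k)

  natrec : {A : Set} → A → (ℕ → A → A) → ℕ → A
  natrec z s zero    = z
  natrec z s (suc n) = s n (natrec z s n)

  private
    weaken-ok : ∀ {k n} (ys : Vec ℕ k) (f : Fin n → Fin k) (xs : Vec ℕ n) →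
      (∀ j → lookup ys (f j) ≡ lookup xs j) → ∀ j →
      noOracle ⊢ lookup (tabulate (proj ∘ f)) j [ ys ]↓ lookup xs j
    weaken-ok ys f xs eq j =
      subst₂ (noOracle ⊢_[ ys ]↓_) (sym (lookup∘tabulate (proj ∘ f) j)) (eq j) ↓proj

  natrecᶜ : ∀ {n} {z : Vec ℕ n → ℕ} {s : Vec ℕ (suc (suc n)) → ℕ} {b : Vec ℕ n → ℕ} →
    Rec z → Rec s → Rec b → Rec (λ xs → natrec (z xs) (λ t acc → s (t ∷ acc ∷ xs)) (b xs))
  natrecᶜ {z = z} {s} {b} (rec ez okz) (rec es oks) (rec eb okb) =
    rec (comp (prec ez es) (eb ∷ tabulate (λ i → proj i))) λ xs →
      ↓comp {ys = b xs ∷ xs}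
        (λ { zero → okb xs ; (suc j) → weaken-ok xs (λ i → i) xs (λ _ → refl) j })
        (loop xs (b xs))
    where
    loop : ∀ xs t → noOracle ⊢ prec ez es [ t ∷ xs ]↓ natrec (z xs) (λ t acc → s (t ∷ acc ∷ xs)) t
    loop xs zero    = ↓prec-z (okz xs)
    loop xs (suc t) = ↓prec-s (loop xs t) (oks _)

  -- Inserts the unused value of a recursion after the first argument.
  skip : ∀ {n} {f : Vec ℕ (suc n) → ℕ} → Rec f →
    Rec {suc (suc n)} (λ xs → f (lookup xs 0F ∷ tail (tail xs)))
  skip {f = f} (rec e ok) = rec (comp e (proj 0F ∷ tabulate (λ i → proj (suc (suc i))))) λ where
    (t ∷ a ∷ xs) → ↓comp {ys = t ∷ xs}
      (λ { zero → ↓proj ; (suc j) → weaken-ok (t ∷ a ∷ xs) (λ i → suc (suc i)) xs (λ _ → refl) j })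
      (ok (t ∷ xs))

  module _ {n} {f g : Vec ℕ n → ℕ} where

    infixl 6 _+ᶜ_ _∸ᶜ_

    _+ᶜ_ : Rec f → Rec g → Rec (λ xs → f xs + g xs)
    cf +ᶜ cg = rec-ext (λ xs → lem (f xs) (g xs)) (natrecᶜ cg (sucᶜ (var 1F)) cf)
      where
      lem : ∀ m n → natrec n (λ _ a → suc a) m ≡ m + n
      lem zero    n = refl
      lem (suc m) n = cong suc (lem m n)

    _∸ᶜ_ : Rec f → Rec g → Rec (λ xs → f xs ∸ g xs)
    cf ∸ᶜ cg = rec-ext (λ xs → lem (f xs) (g xs)) (natrecᶜ cf predᶜ cg)
      where
      predᶜ : ∀ {n} → Rec {2 + n} (λ xs → pred (lookup xs 1F))
      predᶜ = rec-ext (λ { xs → lem₀ (lookup xs 1F) }) (natrecᶜ (const 0) (var 0F) (var 1F))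
        where
        lem₀ : ∀ m → natrec 0 (λ t _ → t) m ≡ pred m
        lem₀ zero    = refl
        lem₀ (suc m) = refl
      lem : ∀ m n → natrec m (λ _ a → pred a) n ≡ m ∸ n
      lem m zero    = refl
      lem m (suc n) = trans (cong pred (lem m n)) (pred[m∸n]≡m∸[1+n] m n)

  module _ {n} {f g : Vec ℕ n → ℕ} where

    infixl 7 _*ᶜ_

    _*ᶜ_ : Rec f → Rec g → Rec (λ xs → f xs * g xs)
    cf *ᶜ cg = rec-ext (λ xs → lem (f xs) (g xs))
      (natrecᶜ (const 0) (skip {f = λ xs → g (tail xs)} (shift cg) +ᶜ var 1F) cf)
      where
      shift : ∀ {n} {g : Vec ℕ n → ℕ} → Rec g → Rec {suc n} (λ xs → g (tail xs))
      shift (rec e ok) = rec (comp e (tabulate (λ i → proj (suc i)))) λ where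
        (t ∷ xs) → ↓comp (weaken-ok (t ∷ xs) suc xs (λ _ → refl)) (ok xs)
      lem : ∀ m n → natrec 0 (λ _ a → n + a) m ≡ m * n
      lem zero    n = refl
      lem (suc m) n = cong (n +_) (lem m n)

  -- Natural numbers serve as truth values, the positive ones being true.

  sg : ℕ → ℕ
  sg = natrec 0 (λ _ _ → 1)

  isEq : ℕ → ℕ → ℕ
  isEq m n = 1 ∸ ((m ∸ n) + (n ∸ m))

  ∑ : ℕ → (ℕ → ℕ) → ℕ
  ∑ n f = natrec 0 (λ i a → f i + a) n

  all : ℕ → (ℕ → ℕ) → ℕ
  all n f = 1 ∸ ∑ n (λ i → 1 ∸ f i)

  iter : (ℕ → ℕ) → ℕ → ℕ → ℕ
  iter f n x = natrec x (λ _ a → f a) n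

  -- The first positive value of g below n, or 0.
  latch : (ℕ → ℕ) → ℕ → ℕ
  latch g n = natrec 0 (λ i a → a + (1 ∸ a) * g i) n

  2^ : ℕ → ℕ
  2^ n = natrec 1 (λ _ a → a + a) n

  parity : ℕ → ℕ
  parity n = natrec 0 (λ _ a → 1 ∸ a) n

  half : ℕ → ℕ
  half n = natrec 0 (λ t a → a + parity t) n

  bitAt : ℕ → ℕ → ℕ
  bitAt Y i = parity (iter half i Y)

  module _ {n} {f g : Vec ℕ n → ℕ} where

    isEqᶜ : Rec f → Rec g → Rec (λ xs → isEq (f xs) (g xs))
    isEqᶜ cf cg = const 1 ∸ᶜ ((cf ∸ᶜ cg) +ᶜ (cg ∸ᶜ cf))

  module _ {n} {b : Vec ℕ n → ℕ} {f : Vec ℕ (suc n) → ℕ} where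

    ∑ᶜ : Rec b → Rec f → Rec (λ xs → ∑ (b xs) (λ i → f (i ∷ xs)))
    ∑ᶜ cb cf = natrecᶜ (const 0) (skip cf +ᶜ var 1F) cb

    latchᶜ : Rec b → Rec f → Rec (λ xs → latch (λ i → f (i ∷ xs)) (b xs))
    latchᶜ cb cf = natrecᶜ (const 0) (var 1F +ᶜ (const 1 ∸ᶜ var 1F) *ᶜ skip cf) cb

  allᶜ : ∀ {n} {b : Vec ℕ n → ℕ} {f : Vec ℕ (suc n) → ℕ} →
    Rec b → Rec f → Rec (λ xs → all (b xs) (λ i → f (i ∷ xs)))
  allᶜ cb cf = const 1 ∸ᶜ ∑ᶜ cb (const 1 ∸ᶜ cf)

  ap₁ : ∀ {n} (h : ℕ → ℕ) {f : Vec ℕ n → ℕ} →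
    Rec {1} (λ xs → h (lookup xs 0F)) → Rec f → Rec (λ xs → h (f xs))
  ap₁ h ch cf = compᶜ ch (cf ∷ [])

  ap₂ : ∀ {n} (h : ℕ → ℕ → ℕ) {f g : Vec ℕ n → ℕ} →
    Rec {2} (λ xs → h (lookup xs 0F) (lookup xs 1F)) → Rec f → Rec g → Rec (λ xs → h (f xs) (g xs))
  ap₂ h ch cf cg = compᶜ ch (cf ∷ cg ∷ [])

  iterᶜ : ∀ {n} (h : ℕ → ℕ) {f g : Vec ℕ n → ℕ} →
    Rec {1} (λ xs → h (lookup xs 0F)) → Rec f → Rec g → Rec (λ xs → iter h (f xs) (g xs))
  iterᶜ h ch cf cg = natrecᶜ cg (ap₁ h ch (var 1F)) cf

  sgᶜ : ∀ {n} {f : Vec ℕ n → ℕ} → Rec f → Rec (λ xs → sg (f xs))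
  sgᶜ cf = natrecᶜ (const 0) (const 1) cf

  2^ᶜ : ∀ {n} {f : Vec ℕ n → ℕ} → Rec f → Rec (λ xs → 2^ (f xs))
  2^ᶜ cf = natrecᶜ (const 1) (var 1F +ᶜ var 1F) cf

  bitAtᶜ : ∀ {n} {f g : Vec ℕ n → ℕ} → Rec f → Rec g → Rec (λ xs → bitAt (f xs) (g xs))
  bitAtᶜ cf cg = ap₁ parity parityᶜ (iterᶜ half halfᶜ cg cf)
    where
    parityᶜ : Rec {1} (λ xs → parity (lookup xs 0F))
    parityᶜ = natrecᶜ (const 0) (const 1 ∸ᶜ var 1F) (var 0F)
    halfᶜ : Rec {1} (λ xs → half (lookup xs 0F))
    halfᶜ = natrecᶜ (const 0) (var 1F +ᶜ ap₁ parity parityᶜ (var 0F)) (var 0F)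

-- Truth values, bounded sums, binary digits, and codes of finite strings.

module Arithmetic where

  open import Data.Bool.Base using (Bool; true; false)
  open import Data.Fin.Patterns using (0F; 1F; 2F)
  open import Data.List.Base using (List; []; _∷_; length)
  open import Data.Nat.Base hiding (parity)
  open import Data.Nat.Properties
  open import Data.Product.Base using (∃-syntax; _×_; _,_; proj₁; proj₂)
  open import Data.Sum.Base using (inj₁; inj₂)
  open import Data.Vec.Base using (Vec; lookup)
  open import Function.Base using (_∘_)
  open import Relation.Binary.Definitions using (tri<; tri≈; tri>)
  open import Relation.Binary.PropositionalEquality
  open import Relation.Nullary.Negation using (contradiction)
  open import Defs using (bit)
  open Computability

  isEq-refl : ∀ m → isEq m m ≡ 1
  isEq-refl m rewrite n∸n≡0 m = refl

  isEq⇒≡ : ∀ {m n} → 0 < isEq m n → m ≡ n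
  isEq⇒≡ {m} {n} 0<e with <-cmp m n
  ... | tri≈ _ m≡n _ = m≡n
  ... | tri< m<n _ _ = contradiction 0<e
          (<⇒≱ (s≤s (≤-reflexive (m≤n⇒m∸n≡0 (≤-trans (m<n⇒0<n∸m m<n) (m≤n+m (n ∸ m) (m ∸ n)))))))
  ... | tri> _ _ n<m = contradiction 0<e
          (<⇒≱ (s≤s (≤-reflexive (m≤n⇒m∸n≡0 (≤-trans (m<n⇒0<n∸m n<m) (m≤m+n (m ∸ n) (n ∸ m)))))))

  isEq-≢ : ∀ {m n} → m ≢ n → isEq m n ≡ 0
  isEq-≢ {m} {n} m≢n with isEq m n in eq
  ... | zero  = refl
  ... | suc _ = contradiction (isEq⇒≡ (subst (0 <_) (sym eq) z<s)) m≢n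

  *-pos : ∀ {m n} → 0 < m → 0 < n → 0 < m * n
  *-pos {suc m} {suc n} _ _ = z<s

  pos-*ˡ : ∀ {m n} → 0 < m * n → 0 < m
  pos-*ˡ {suc m} _ = z<s

  pos-*ʳ : ∀ {m n} → 0 < m * n → 0 < n
  pos-*ʳ {m} {zero}  p = contradiction (subst (0 <_) (*-zeroʳ m) p) λ ()
  pos-*ʳ {m} {suc n} _ = z<s

  ∑-cong : ∀ n {f g : ℕ → ℕ} → (∀ i → i < n → f i ≡ g i) → ∑ n f ≡ ∑ n g
  ∑-cong zero    f≗g = refl
  ∑-cong (suc n) f≗g = cong₂ _+_ (f≗g n ≤-refl) (∑-cong n λ i i<n → f≗g i (m<n⇒m<1+n i<n))

  ∑-mono : ∀ n {f g : ℕ → ℕ} → (∀ i → i < n → f i ≤ g i) → ∑ n f ≤ ∑ n g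
  ∑-mono zero    f≤g = ≤-refl
  ∑-mono (suc n) f≤g = +-mono-≤ (f≤g n ≤-refl) (∑-mono n λ i i<n → f≤g i (m<n⇒m<1+n i<n))

  ∑-+ : ∀ n (f g : ℕ → ℕ) → ∑ n (λ i → f i + g i) ≡ ∑ n f + ∑ n g
  ∑-+ zero    f g = refl
  ∑-+ (suc n) f g = begin
    f n + g n + ∑ n (λ i → f i + g i) ≡⟨ cong (f n + g n +_) (∑-+ n f g) ⟩
    f n + g n + (∑ n f + ∑ n g)       ≡⟨ +-assoc (f n) (g n) _ ⟩
    f n + (g n + (∑ n f + ∑ n g))     ≡⟨ cong (f n +_) (x+[y+z]≡y+[x+z] (g n) (∑ n f) (∑ n g)) ⟩
    f n + (∑ n f + (g n + ∑ n g))     ≡⟨ +-assoc (f n) (∑ n f) _ ⟨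
    f n + ∑ n f + (g n + ∑ n g)       ∎
    where
    open ≡-Reasoning
    x+[y+z]≡y+[x+z] : ∀ x y z → x + (y + z) ≡ y + (x + z)
    x+[y+z]≡y+[x+z] x y z = trans (sym (+-assoc x y z)) (trans (cong (_+ z) (+-comm x y)) (+-assoc y x z))

  ∑-zero : ∀ n {f : ℕ → ℕ} → (∀ i → i < n → f i ≡ 0) → ∑ n f ≡ 0
  ∑-zero zero    f≡0 = refl
  ∑-zero (suc n) f≡0 = cong₂ _+_ (f≡0 n ≤-refl) (∑-zero n λ i i<n → f≡0 i (m<n⇒m<1+n i<n))

  ∑-ones : ∀ n {f : ℕ → ℕ} → (∀ i → i < n → f i ≡ 1) → ∑ n f ≡ n
  ∑-ones zero    f≡1 = refl
  ∑-ones (suc n) f≡1 = cong₂ _+_ (f≡1 n ≤-refl) (∑-ones n λ i i<n → f≡1 i (m<n⇒m<1+n i<n))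

  term≤∑ : ∀ {n i} (f : ℕ → ℕ) → i < n → f i ≤ ∑ n f
  term≤∑ {suc n} {i} f i<1+n with m≤n⇒m<n∨m≡n (s≤s⁻¹ i<1+n)
  ... | inj₁ i<n  = ≤-trans (term≤∑ f i<n) (m≤n+m (∑ n f) (f n))
  ... | inj₂ refl = m≤m+n (f n) (∑ n f)

  pos-∑ : ∀ n {f : ℕ → ℕ} → 0 < ∑ n f → ∃[ i ] i < n × 0 < f i
  pos-∑ (suc n) {f} p with f n in eq
  ... | suc _ = n , ≤-refl , subst (0 <_) (sym eq) z<s
  ... | zero  with pos-∑ n p
  ...   | i , i<n , 0<fi = i , m<n⇒m<1+n i<n , 0<fi

  ∑-single : ∀ n {f : ℕ → ℕ} {k} → k < n → (∀ i → i ≢ k → f i ≡ 0) → ∑ n f ≡ f k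
  ∑-single (suc n) {f} {k} k<1+n f≡0 with m≤n⇒m<n∨m≡n (s≤s⁻¹ k<1+n)
  ... | inj₂ refl = trans (cong (f n +_) (∑-zero n λ i i<n → f≡0 i (<⇒≢ i<n))) (+-identityʳ (f n))
  ... | inj₁ k<n  = trans (cong (_+ ∑ n f) (f≡0 n (<⇒≢ k<n ∘ sym))) (∑-single n k<n f≡0)

  all-pos : ∀ n {f : ℕ → ℕ} → (∀ i → i < n → 0 < f i) → 0 < all n f
  all-pos n {f} 0<f = ≤-reflexive (sym (cong (1 ∸_) (∑-zero n λ i i<n → m≤n⇒m∸n≡0 (0<f i i<n))))

  pos-all : ∀ n {f : ℕ → ℕ} → 0 < all n f → ∀ i → i < n → 0 < f i
  pos-all n {f} p i i<n with f i in eq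
  ... | suc _ = z<s
  ... | zero  = contradiction p (<⇒≱ (s≤s (≤-reflexive (m≤n⇒m∸n≡0
                  (≤-trans (≤-reflexive (cong (1 ∸_) (sym eq))) (term≤∑ (λ j → 1 ∸ f j) i<n))))))

  private
    keep : ∀ u x → suc u + (1 ∸ suc u) * x ≡ suc u
    keep u x rewrite 0∸n≡0 u = +-identityʳ (suc u)

  latch-zero : ∀ {g : ℕ → ℕ} n → latch g n ≡ 0 → ∀ i → i < n → g i ≡ 0
  latch-zero {g} (suc n) eq i i<1+n with latch g n in eq′
  ... | zero with m≤n⇒m<n∨m≡n (s≤s⁻¹ i<1+n)
  ...   | inj₁ i<n  = latch-zero n eq′ i i<n
  ...   | inj₂ refl = m+n≡0⇒m≡0 (g i) eq

  latch-first : ∀ {g : ℕ → ℕ} n {v} → latch g n ≡ suc v →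
    ∃[ i ] i < n × g i ≡ suc v × (∀ j → j < i → g j ≡ 0)
  latch-first {g} (suc n) {v} eq with latch g n in eq′
  ... | zero  = n , ≤-refl , trans (sym (+-identityʳ (g n))) eq , latch-zero n eq′
  ... | suc u with latch-first n eq′
  ...   | i , i<n , gi≡ , before =
          i , m<n⇒m<1+n i<n , trans gi≡ (trans (sym (keep u (g n))) eq) , before

  latch-step : ∀ {g : ℕ → ℕ} n {v} → latch g n ≡ suc v → latch g (suc n) ≡ suc v
  latch-step {g} n eq rewrite eq = keep _ (g n)

  latch-mono : ∀ {g : ℕ → ℕ} {m n v} → m ≤ n → latch g m ≡ suc v → latch g n ≡ suc v
  latch-mono {g} {m} {n} m≤n eq with ≤⇒≤′ m≤n
  ... | ≤′-refl      = eq
  ... | ≤′-step {k} m≤k = latch-step k (latch-mono (≤′⇒≤ m≤k) eq)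

  latch-none : ∀ {g : ℕ → ℕ} n → (∀ j → j < n → g j ≡ 0) → latch g n ≡ 0
  latch-none zero    g≡0 = refl
  latch-none {g} (suc n) g≡0 rewrite latch-none {g} n (λ j j<n → g≡0 j (m<n⇒m<1+n j<n)) =
    trans (+-identityʳ (g n)) (g≡0 n ≤-refl)

  latch-at : ∀ {g : ℕ → ℕ} {n i v} → i < n → g i ≡ suc v → (∀ j → j < i → g j ≡ 0) → latch g n ≡ suc v
  latch-at {g} {n} {i} i<n gi≡ before = latch-mono i<n eq
    where
    eq : latch g (suc i) ≡ suc _
    eq rewrite latch-none {g} i before = trans (+-identityʳ (g i)) gi≡

  latch-some : ∀ {g : ℕ → ℕ} {n i} → i < n → 0 < g i → ∃[ v ] latch g n ≡ suc v
  latch-some {g} {n} {i} i<n 0<gi with latch g n in eq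
  ... | suc v = v , refl
  ... | zero  = contradiction (latch-zero n eq i i<n) (λ e → <⇒≢ 0<gi (sym e))

  -- Binary digits, least significant first

  bitCons : Bool → ℕ → ℕ
  bitCons b Y = bit b + (Y + Y)

  parity≤1 : ∀ n → parity n ≤ 1
  parity≤1 zero    = z≤n
  parity≤1 (suc n) = m∸n≤m 1 (parity n)

  parity-2+ : ∀ n → parity (2 + n) ≡ parity n
  parity-2+ n = m∸[m∸n]≡n (parity≤1 n)

  half-2+ : ∀ n → half (2 + n) ≡ suc (half n)
  half-2+ n = trans (+-assoc (half n) (parity n) _)
    (trans (cong (half n +_) (m+[n∸m]≡n (parity≤1 n))) (+-comm (half n) 1))

  private
    bitCons-suc : ∀ b Y → bitCons b (suc Y) ≡ 2 + bitCons b Y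
    bitCons-suc b Y = trans (cong (bit b +_) (cong suc (+-suc Y Y)))
      (trans (+-suc (bit b) _) (cong suc (+-suc (bit b) _)))

  parity-bitCons : ∀ b Y → parity (bitCons b Y) ≡ bit b
  parity-bitCons false zero    = refl
  parity-bitCons true  zero    = refl
  parity-bitCons b     (suc Y) =
    trans (cong parity (bitCons-suc b Y)) (trans (parity-2+ (bitCons b Y)) (parity-bitCons b Y))

  half-bitCons : ∀ b Y → half (bitCons b Y) ≡ Y
  half-bitCons false zero    = refl
  half-bitCons true  zero    = refl
  half-bitCons b     (suc Y) =
    trans (cong half (bitCons-suc b Y)) (trans (half-2+ (bitCons b Y)) (cong suc (half-bitCons b Y)))

  iter-suc : ∀ (h : ℕ → ℕ) n x → iter h (suc n) x ≡ iter h n (h x)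
  iter-suc h zero    x = refl
  iter-suc h (suc n) x = cong h (iter-suc h n x)

  bitAt-zero : ∀ b Y → bitAt (bitCons b Y) 0 ≡ bit b
  bitAt-zero = parity-bitCons

  bitAt-suc : ∀ b Y i → bitAt (bitCons b Y) (suc i) ≡ bitAt Y i
  bitAt-suc b Y i = cong parity (trans (iter-suc half i (bitCons b Y)) (cong (iter half i) (half-bitCons b Y)))

  fromBits : (ℕ → Bool) → ℕ → ℕ
  fromBits f zero    = 0
  fromBits f (suc n) = bitCons (f 0) (fromBits (f ∘ suc) n)

  bitAt-fromBits : ∀ f {n i} → i < n → bitAt (fromBits f n) i ≡ bit (f i)
  bitAt-fromBits f {suc n} {zero}  _         = bitAt-zero (f 0) (fromBits (f ∘ suc) n)
  bitAt-fromBits f {suc n} {suc i} (s≤s i<n) = trans (bitAt-suc (f 0) _ i) (bitAt-fromBits (f ∘ suc) i<n)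

  iter-half-0 : ∀ n → iter half n 0 ≡ 0
  iter-half-0 zero    = refl
  iter-half-0 (suc n) = cong half (iter-half-0 n)

  bitAt-fromBits-≥ : ∀ f {n i} → n ≤ i → bitAt (fromBits f n) i ≡ 0
  bitAt-fromBits-≥ f {zero}  {i}     _         = cong parity (iter-half-0 i)
  bitAt-fromBits-≥ f {suc n} {suc i} (s≤s n≤i) = trans (bitAt-suc (f 0) _ i) (bitAt-fromBits-≥ (f ∘ suc) n≤i)

  fromBits-bound : ∀ f n → fromBits f n < 2^ n
  fromBits-bound f zero    = z<s
  fromBits-bound f (suc n) = ≤-trans (s≤s (+-monoˡ-≤ (Y + Y) (bit≤1 (f 0))))
    (≤-trans (≤-reflexive (sym (+-suc (suc Y) Y))) (+-mono-≤ (fromBits-bound (f ∘ suc) n) (fromBits-bound (f ∘ suc) n)))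
    where
    Y = fromBits (f ∘ suc) n
    bit≤1 : ∀ b → bit b ≤ 1
    bit≤1 false = z≤n
    bit≤1 true  = ≤-refl

  half-< : ∀ n → half (suc n) ≤ n
  half-< zero          = ≤-refl
  half-< (suc zero)    = ≤-refl
  half-< (suc (suc n)) = ≤-trans (≤-reflexive (half-2+ (suc n))) (s≤s (≤-trans (half-< n) (n≤1+n n)))

  -- Halving a positive number decreases it. If W codes a finite set by its binary digits,
  -- quantification over the members may therefore be bounded by W itself.
  bitAt-< : ∀ {W i} → 0 < bitAt W i → i < W
  bitAt-< {W} {i} p = ≤-trans (+-monoˡ-≤ i 0<h) (descend i W 0<h)
    where
    0<h : 0 < iter half i W
    0<h with iter half i W
    ... | suc _ = z<s
    descend : ∀ i W → 0 < iter half i W → iter half i W + i ≤ W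
    descend zero    W p = ≤-reflexive (+-identityʳ W)
    descend (suc i) W p with iter half i W in eq
    ... | suc m = ≤-trans (≤-reflexive (+-suc (half (suc m)) i))
            (≤-trans (s≤s (+-monoˡ-≤ i (half-< m)))
              (≤-trans (≤-reflexive (cong (_+ i) (sym eq))) (descend i W (subst (0 <_) (sym eq) z<s))))

  -- Codes of strings of numbers

  -- With s = c + i, the number s² + c lies between s² and s² + s, and these intervals are disjoint
  -- for distinct s; this gives injectivity. The successor reserves 0 for the empty string.
  child : ℕ → ℕ → ℕ
  child c i = suc ((c + i) * (c + i) + c)

  child-> : ∀ c i → c < child c i
  child-> c i = s≤s (m≤n+m c _)

  child->ʳ : ∀ c i → i < child c i
  child->ʳ c i = s≤s (≤-trans (m≤n+m i c) (≤-trans (m≤m*m (c + i)) (m≤m+n _ c)))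
    where
    m≤m*m : ∀ m → m ≤ m * m
    m≤m*m zero    = z≤n
    m≤m*m (suc m) = m≤m+n (suc m) _

  child-mono : ∀ {c d i j} → c ≤ d → i ≤ j → child c i ≤ child d j
  child-mono c≤d i≤j = s≤s (+-mono-≤ (*-mono-≤ (+-mono-≤ c≤d i≤j) (+-mono-≤ c≤d i≤j)) c≤d)

  private
    child-<-sum : ∀ {c i d j} → c + i < d + j → child c i < child d j
    child-<-sum {c} {i} {d} {j} p = s≤s (≤-trans (s≤s (+-monoʳ-≤ (s * s) (m≤m+n c i)))
      (≤-trans le (≤-trans (*-mono-≤ p p) (m≤m+n _ d))))
      where
      s = c + i
      le : suc (s * s + s) ≤ suc s * suc s
      le = s≤s (≤-trans (≤-reflexive (+-comm (s * s) s))
             (+-monoʳ-≤ s (*-monoʳ-≤ s (n≤1+n s))))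

  child-injective : ∀ {c i d j} → child c i ≡ child d j → c ≡ d × i ≡ j
  child-injective {c} {i} {d} {j} eq with <-cmp (c + i) (d + j)
  ... | tri< p _ _ = contradiction eq (<⇒≢ (child-<-sum {c} {i} {d} {j} p))
  ... | tri> _ _ p = contradiction (sym eq) (<⇒≢ (child-<-sum {d} {j} {c} {i} p))
  ... | tri≈ _ p _ = c≡d , +-cancelˡ-≡ c i j (trans p (cong (_+ j) (sym c≡d)))
    where
    c≡d : c ≡ d
    c≡d = +-cancelˡ-≡ ((c + i) * (c + i)) c d
      (trans (suc-injective eq) (cong (λ s → s * s + d) (sym p)))

  module _ {n} {f g : Vec ℕ n → ℕ} where

    childᶜ : Rec f → Rec g → Rec (λ xs → child (f xs) (g xs))
    childᶜ cf cg = sucᶜ ((cf +ᶜ cg) *ᶜ (cf +ᶜ cg) +ᶜ cf)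

  abstract

    -- Inverses of `child` by bounded search: both arguments are below the value, and injectivity
    -- leaves one nonzero summand. Outside the range of `child` the result is 0; in particular `pop`
    -- fixes 0.
    pop top : ℕ → ℕ
    pop n = ∑ n (λ c → ∑ n (λ i → c * isEq (child c i) n))
    top n = ∑ n (λ c → ∑ n (λ i → i * isEq (child c i) n))

    private
      decode : ∀ (h : ℕ → ℕ → ℕ) c i →
        ∑ (child c i) (λ d → ∑ (child c i) (λ j → h d j * isEq (child d j) (child c i))) ≡ h c i
      decode h c i = trans
        (∑-single (child c i) (child-> c i) λ d d≢c → ∑-zero (child c i) λ j _ →
          trans (cong (h d j *_) (isEq-≢ (d≢c ∘ proj₁ ∘ child-injective {d} {j} {c} {i}))) (*-zeroʳ (h d j)))
        (trans
          (∑-single (child c i) (child->ʳ c i) λ j j≢i →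
            trans (cong (h c j *_) (isEq-≢ (j≢i ∘ proj₂ ∘ child-injective {c} {j} {c} {i}))) (*-zeroʳ (h c j)))
          (trans (cong (h c i *_) (isEq-refl (child c i))) (*-identityʳ (h c i))))

    pop-child : ∀ c i → pop (child c i) ≡ c
    pop-child = decode (λ c i → c)

    top-child : ∀ c i → top (child c i) ≡ i
    top-child = decode (λ c i → i)

    private
      popᶜ : Rec {1} (λ xs → pop (lookup xs 0F))
      popᶜ = ∑ᶜ (var 0F) (∑ᶜ (var 1F) (var 1F *ᶜ isEqᶜ (childᶜ (var 1F) (var 0F)) (var 2F)))
      topᶜ : Rec {1} (λ xs → top (lookup xs 0F))
      topᶜ = ∑ᶜ (var 0F) (∑ᶜ (var 1F) (var 0F *ᶜ isEqᶜ (childᶜ (var 1F) (var 0F)) (var 2F)))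

  enc : List ℕ → ℕ
  enc []      = 0
  enc (i ∷ τ) = child (enc τ) i

  pop-enc : ∀ τ i k → iter pop (suc k) (enc (i ∷ τ)) ≡ iter pop k (enc τ)
  pop-enc τ i k = trans (iter-suc pop k (enc (i ∷ τ))) (cong (iter pop k) (pop-child (enc τ) i))

  length≤enc : ∀ τ → length τ ≤ enc τ
  length≤enc []      = z≤n
  length≤enc (i ∷ τ) = ≤-trans (s≤s (length≤enc τ)) (child-> (enc τ) i)

  abstract

    -- Counts the pops before 0 is reached; the bound c suffices by `length≤enc`, and further pops
    -- contribute nothing.
    len : ℕ → ℕ
    len c = ∑ c (λ k → sg (iter pop k c))

    -- Strings carry their last entry outermost, so the n-th entry is on top once the
    -- `len c ∸ suc n` later ones are removed.
    entry : ℕ → ℕ → ℕ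
    entry c n = top (iter pop (len c ∸ suc n) c)

    private
      count : ∀ τ n → length τ ≤ n → ∑ n (λ k → sg (iter pop k (enc τ))) ≡ length τ
      count []      n       _ = ∑-zero n λ k _ → cong sg (pops k)
        where
        pops : ∀ k → iter pop k 0 ≡ 0
        pops zero    = refl
        pops (suc k) = cong pop (pops k)
      count (i ∷ τ) (suc n) (s≤s p) = trans (∑-shift n _) (cong suc
        (trans (∑-cong n λ k _ → cong sg (pop-enc τ i k)) (count τ n p)))
        where
        ∑-shift : ∀ n (f : ℕ → ℕ) → ∑ (suc n) f ≡ f 0 + ∑ n (f ∘ suc)
        ∑-shift zero    f = refl
        ∑-shift (suc n) f = trans (cong (f (suc n) +_) (∑-shift n f))
          (trans (sym (+-assoc (f (suc n)) (f 0) _))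
            (trans (cong (_+ ∑ n (f ∘ suc)) (+-comm (f (suc n)) (f 0))) (+-assoc (f 0) (f (suc n)) _)))

    len-enc : ∀ τ → len (enc τ) ≡ length τ
    len-enc τ = count τ (enc τ) (length≤enc τ)

    entry-last : ∀ i τ → entry (enc (i ∷ τ)) (length τ) ≡ i
    entry-last i τ = trans (cong (λ k → top (iter pop k (enc (i ∷ τ)))) eq) (top-child (enc τ) i)
      where
      eq : len (enc (i ∷ τ)) ∸ suc (length τ) ≡ 0
      eq = trans (cong (_∸ suc (length τ)) (len-enc (i ∷ τ))) (n∸n≡0 (length τ))

    entry-init : ∀ i τ {n} → n < length τ → entry (enc (i ∷ τ)) n ≡ entry (enc τ) n
    entry-init i τ {n} n<ℓ = cong top
      (trans (cong (λ k → iter pop k (enc (i ∷ τ))) eq)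
        (trans (pop-enc τ i (length τ ∸ suc n))
          (cong (λ ℓ → iter pop (ℓ ∸ suc n) (enc τ)) (sym (len-enc τ)))))
      where
      eq : len (enc (i ∷ τ)) ∸ suc n ≡ suc (length τ ∸ suc n)
      eq = trans (cong (_∸ suc n) (len-enc (i ∷ τ))) (+-∸-assoc 1 n<ℓ)

    private
      len₁ : Rec {1} (λ xs → len (lookup xs 0F))
      len₁ = ∑ᶜ (var 0F) (sgᶜ (iterᶜ pop popᶜ (var 0F) (var 1F)))
      entry₂ : Rec {2} (λ xs → entry (lookup xs 0F) (lookup xs 1F))
      entry₂ = ap₁ top topᶜ (iterᶜ pop popᶜ (ap₁ len len₁ (var 0F) ∸ᶜ sucᶜ (var 1F)) (var 0F))

  module _ {n} {f : Vec ℕ n → ℕ} where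

    lenᶜ : Rec f → Rec (λ xs → len (f xs))
    lenᶜ = ap₁ len len₁

    entryᶜ : ∀ {g} → Rec f → Rec g → Rec (λ xs → entry (f xs) (g xs))
    entryᶜ = ap₂ entry entry₂

-- Simulation of oracle computations along finite strings.

module Simulation where

  open import Data.Fin.Base using (Fin; zero; suc)
  open import Data.Fin.Patterns using (0F; 1F; 2F)
  open import Data.List.Base using (replicate)
  open import Data.List.Properties using (length-replicate)
  open import Data.Nat.Base hiding (parity)
  open import Data.Nat.Properties
  open import Data.Product.Base using (∃-syntax; _×_; _,_; proj₁; proj₂)
  open import Data.Vec.Base using (Vec; []; _∷_; _++_; lookup; map; tabulate; tail)
  open import Data.Vec.Properties using (tabulate∘lookup; map-++; map-∘)
  open import Data.Vec.Relation.Unary.All using (All; []; _∷_)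
  open import Data.Vec.Relation.Unary.All.Properties using (++⁺)
  open import Function.Base using (_∘_)
  open import Relation.Binary.PropositionalEquality
  open import Defs using (Code; zero; succ; proj; oracle; comp; prec; μ; noOracle; _⊢_[_]↓_;
    ↓zero; ↓succ; ↓proj; ↓oracle; ↓comp; ↓prec-z; ↓prec-s; ↓μ)
  open Computability
  open Arithmetic

  guard : ℕ → ℕ → ℕ
  guard zero    x = 0
  guard (suc _) x = x

  guards : ∀ {m} → Vec ℕ m → ℕ → ℕ
  guards []       x = x
  guards (v ∷ vs) x = guard v (guards vs x)

  -- Drives the search for a zero, which stops at the first positive verdict. An undefined value
  -- stops it with 1, which after `pred` reads "undefined"; the value 0 stops it with 2 + t, which
  -- reads "value t"; a positive value lets it continue.
  verdict : ℕ → ℕ → ℕ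
  verdict 0             t = 1
  verdict 1             t = 2 + t
  verdict (suc (suc _)) t = 0

  -- The value of a code when oracle queries are answered from the string with code c, which
  -- also bounds unbounded searches: 0 stands for "undefined" and suc y for the value y.
  sim  : ∀ {k n} → Code k n → ℕ → Vec ℕ n → ℕ
  sims : ∀ {k m n} → Vec (Code k n) m → ℕ → Vec ℕ n → Vec ℕ m

  sim zero        c _        = 1
  sim succ        c (x ∷ []) = 2 + x
  sim (proj i)    c xs       = suc (lookup xs i)
  sim (oracle j)  c (x ∷ []) = guard (len c ∸ x) (suc (entry c x))
  sim (comp f gs) c xs       = guards (sims gs c xs) (sim f c (map pred (sims gs c xs)))
  sim (prec f g)  c (t ∷ xs) =
    natrec (sim f c xs) (λ i a → guard a (sim g c (i ∷ pred a ∷ xs))) t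
  sim (μ f)       c xs       = pred (latch (λ t → verdict (sim f c (t ∷ xs)) t) (len c))

  sims []       c xs = []
  sims (g ∷ gs) c xs = sim g c xs ∷ sims gs c xs

  guardᶜ : ∀ {n} {f g : Vec ℕ n → ℕ} → Rec f → Rec g → Rec (λ xs → guard (f xs) (g xs))
  guardᶜ {f = f} {g} cf cg = rec-ext (λ xs → lem (f xs) (g xs)) (sgᶜ cf *ᶜ cg)
    where
    lem : ∀ v x → sg v * x ≡ guard v x
    lem zero    x = refl
    lem (suc v) x = +-identityʳ x

  predᶜ : ∀ {n} {f : Vec ℕ n → ℕ} → Rec f → Rec (λ xs → pred (f xs))
  predᶜ {f = f} cf = rec-ext (λ xs → lem (f xs)) (cf ∸ᶜ const 1)
    where
    lem : ∀ m → m ∸ 1 ≡ pred m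
    lem zero    = refl
    lem (suc m) = refl

  private
    guardsᶜ : ∀ {m n} {hs : Vec (Vec ℕ n → ℕ) m} {g : Vec ℕ n → ℕ} → All Rec hs → Rec g →
      Rec (λ xs → guards (map (λ h → h xs) hs) (g xs))
    guardsᶜ []         cg = cg
    guardsᶜ (ch ∷ chs) cg = guardᶜ ch (guardsᶜ chs cg)

    verdictᶜ : ∀ {n} {f g : Vec ℕ n → ℕ} → Rec f → Rec g → Rec (λ xs → verdict (f xs) (g xs))
    verdictᶜ {f = f} {g} cf cg =
      rec-ext (λ xs → lem (f xs) (g xs)) (isEqᶜ cf (const 0) +ᶜ isEqᶜ cf (const 1) *ᶜ sucᶜ (sucᶜ cg))
      where
      lem : ∀ v t → isEq v 0 + isEq v 1 * (2 + t) ≡ verdict v t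
      lem 0             t = refl
      lem 1             t = +-identityʳ (2 + t)
      lem (suc (suc v)) t = cong₂ (λ a b → a + b * (2 + t)) (isEq-≢ {2 + v} {0} λ ()) (isEq-≢ {2 + v} {1} λ ())

    vars : ∀ {m n} (ρ : Fin m → Fin n) → All Rec (tabulate (λ i xs → lookup xs (ρ i)))
    vars {zero}  ρ = []
    vars {suc m} ρ = var (ρ zero) ∷ vars (ρ ∘ suc)

    map-tabulate : ∀ {m} {A B : Set} (f : A → B) (h : Fin m → A) → map f (tabulate h) ≡ tabulate (f ∘ h)
    map-tabulate {zero}  f h = refl
    map-tabulate {suc m} f h = cong (f (h zero) ∷_) (map-tabulate f (h ∘ suc))

    callᶜ : ∀ {a m n} {f : Vec ℕ (a + m) → ℕ} {hs : Vec (Vec ℕ n → ℕ) a} →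
      Rec f → All Rec hs → (ρ : Fin m → Fin n) →
      Rec (λ xs → f (map (λ h → h xs) hs ++ tabulate (λ i → lookup xs (ρ i))))
    callᶜ {f = f} {hs} cf chs ρ = rec-ext
      (λ xs → cong f (trans (map-++ (λ h → h xs) hs _)
        (cong (map (λ h → h xs) hs ++_) (map-tabulate (λ h → h xs) (λ i ys → lookup ys (ρ i))))))
      (compᶜ cf (++⁺ chs (vars ρ)))

    components : ∀ {k m n} → Vec (Code k n) m → Vec (Vec ℕ (suc n) → ℕ) m
    components []       = []
    components (g ∷ gs) = (λ xs → sim g (lookup xs 0F) (tail xs)) ∷ components gs

    map-components : ∀ {k m n} (gs : Vec (Code k n) m) xs →
      map (λ h → h xs) (components gs) ≡ sims gs (lookup xs 0F) (tail xs)
    map-components []       xs = refl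
    map-components (g ∷ gs) xs = cong (_ ∷_) (map-components gs xs)

    predsᶜ : ∀ {m n} {hs : Vec (Vec ℕ n → ℕ) m} → All Rec hs → All Rec (map (pred ∘_) hs)
    predsᶜ []         = []
    predsᶜ (ch ∷ chs) = predᶜ ch ∷ predsᶜ chs

  simᶜ  : ∀ {k n} (e : Code k n) → Rec (λ xs → sim e (lookup xs 0F) (tail xs))
  simsᶜ : ∀ {k m n} (gs : Vec (Code k n) m) → All Rec (components gs)

  simᶜ zero        = const 1
  simᶜ succ        = rec-ext (λ { (c ∷ x ∷ []) → refl }) (sucᶜ (sucᶜ (var 1F)))
  simᶜ (proj i)    = rec-ext (λ { (c ∷ xs) → refl }) (sucᶜ (var (suc i)))
  simᶜ (oracle j)  = rec-ext (λ { (c ∷ x ∷ []) → refl })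
    (guardᶜ (lenᶜ (var 0F) ∸ᶜ var 1F) (sucᶜ (entryᶜ (var 0F) (var 1F))))
  simᶜ (comp f gs) = rec-ext
    (λ { (c ∷ xs) → cong₂ guards (map-components gs (c ∷ xs))
      (cong (sim f c) (trans (sym (map-∘ (λ h → h (c ∷ xs)) (pred ∘_) (components gs)))
        (trans (map-∘ pred (λ h → h (c ∷ xs)) (components gs))
          (cong (map pred) (map-components gs (c ∷ xs)))))) })
    (guardsᶜ (simsᶜ gs) (compᶜ (simᶜ f) (var 0F ∷ predsᶜ (simsᶜ gs))))
  simᶜ (prec f g)  = rec-ext
    (λ { (c ∷ t ∷ xs) → cong (λ ys → natrec (sim f c ys) (λ i a → guard a (sim g c (i ∷ pred a ∷ ys))) t)
      (tabulate∘lookup xs) })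
    (natrecᶜ (callᶜ (simᶜ f) (var 0F ∷ []) (λ i → suc (suc i)))
      (guardᶜ (var 1F) (callᶜ (simᶜ g) (var 2F ∷ var 0F ∷ predᶜ (var 1F) ∷ []) (λ i → suc (suc (suc (suc i))))))
      (var 1F))
  simᶜ (μ f)       = rec-ext
    (λ { (c ∷ xs) → cong (λ ys → pred (latch (λ t → verdict (sim f c (t ∷ ys)) t) (len c)))
      (tabulate∘lookup xs) })
    (predᶜ (latchᶜ (lenᶜ (var 0F)) (verdictᶜ (callᶜ (simᶜ f) (var 1F ∷ var 0F ∷ []) (λ i → suc (suc i))) (var 0F))))

  simsᶜ []       = []
  simsᶜ (g ∷ gs) = simᶜ g ∷ simsᶜ gs

  Agrees : ∀ {k} → (Fin k → ℕ → ℕ) → ℕ → Set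
  Agrees O c = ∀ j n → n < len c → O j n ≡ entry c n

  private
    guard-suc : ∀ v {x y} → guard v x ≡ suc y → v ≡ suc (pred v) × x ≡ suc y
    guard-suc (suc v) eq = refl , eq

    verdict-found : ∀ v {t y} → verdict v t ≡ 2 + y → v ≡ 1 × t ≡ y
    verdict-found 1 eq = refl , suc-injective (suc-injective eq)

    verdict-zero : ∀ v {t} → verdict v t ≡ 0 → v ≡ 2 + pred (pred v)
    verdict-zero (suc (suc v)) eq = refl

    pred-suc : ∀ m {y} → pred m ≡ suc y → m ≡ 2 + y
    pred-suc (suc m) eq = cong suc eq

    guards-suc : ∀ {m} (vs : Vec ℕ m) {x y} → guards vs x ≡ suc y → x ≡ suc y
    guards-suc []       eq = eq
    guards-suc (v ∷ vs) eq = guards-suc vs (proj₂ (guard-suc v eq))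

  module _ {k} {O : Fin k → ℕ → ℕ} {c : ℕ} (agrees : Agrees O c) where

    sim-sound  : ∀ {n} (e : Code k n) {xs y} → sim e c xs ≡ suc y → O ⊢ e [ xs ]↓ y
    sims-sound : ∀ {m n} (gs : Vec (Code k n) m) {xs x y} → guards (sims gs c xs) x ≡ suc y →
      ∀ j → O ⊢ lookup gs j [ xs ]↓ lookup (map pred (sims gs c xs)) j

    sim-sound zero {[]} refl = ↓zero
    sim-sound succ {x ∷ []} refl = ↓succ
    sim-sound (proj i) refl = ↓proj
    sim-sound (oracle j) {x ∷ []} eq with len c ∸ x in eq′
    ... | suc _ = subst (O ⊢ oracle j [ x ∷ [] ]↓_)
            (trans (agrees j x (m∸n≢0⇒n<m λ e → 1+n≢0 (trans (sym eq′) e))) (suc-injective eq)) ↓oracle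
    sim-sound (comp f gs) {xs} eq =
      ↓comp {ys = map pred (sims gs c xs)} (sims-sound gs eq) (sim-sound f (guards-suc (sims gs c xs) eq))
    sim-sound (prec f g) {zero ∷ xs} eq = ↓prec-z (sim-sound f eq)
    sim-sound (prec f g) {suc t ∷ xs} eq =
      let a≡ , geq = guard-suc (sim (prec f g) c (t ∷ xs)) eq
      in ↓prec-s (sim-sound (prec f g) {t ∷ xs} a≡) (sim-sound g geq)
    sim-sound (μ f) {xs} eq with latch-first (len c) (pred-suc (latch _ (len c)) eq)
    ... | t , _ , found , before with verdict-found (sim f c (t ∷ xs)) found
    ...   | v≡1 , refl = ↓μ
              (λ j j<t → _ , sim-sound f (verdict-zero (sim f c (j ∷ xs)) (before j j<t)))
              (sim-sound f v≡1)

    sims-sound (g ∷ gs) {xs} eq zero    = sim-sound g (proj₁ (guard-suc (sim g c xs) eq))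
    sims-sound (g ∷ gs) {xs} eq (suc j) = sims-sound gs (proj₂ (guard-suc (sim g c xs) eq)) j

  private
    uniform-Fin : ∀ {m} {P : Fin m → ℕ → Set} → (∀ j → ∃[ ℓ ] ∀ n → ℓ ≤ n → P j n) →
      ∃[ ℓ ] ∀ j n → ℓ ≤ n → P j n
    uniform-Fin {zero}  f = 0 , λ ()
    uniform-Fin {suc m} f with f zero | uniform-Fin (f ∘ suc)
    ... | ℓ₁ , p₁ | ℓ₂ , p₂ = ℓ₁ ⊔ ℓ₂ , λ where
      zero    n le → p₁ n (≤-trans (m≤m⊔n ℓ₁ ℓ₂) le)
      (suc j) n le → p₂ j n (≤-trans (m≤n⊔m ℓ₁ ℓ₂) le)

  uniform-< : ∀ {P : ℕ → ℕ → Set} m → (∀ j → j < m → ∃[ ℓ ] ∀ n → ℓ ≤ n → P j n) →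
    ∃[ ℓ ] ∀ j → j < m → ∀ n → ℓ ≤ n → P j n
  uniform-< zero    f = 0 , λ j ()
  uniform-< (suc m) f with f m ≤-refl | uniform-< m (λ j j<m → f j (m<n⇒m<1+n j<m))
  ... | ℓ₁ , p₁ | ℓ₂ , p₂ = ℓ₁ ⊔ ℓ₂ , λ j j<1+m n le → go j (m≤n⇒m<n∨m≡n (s≤s⁻¹ j<1+m)) n le
    where
    open import Data.Sum.Base
    go : ∀ j → _ → ∀ n → _ → _
    go j (inj₁ j<m)  n le = p₂ j j<m n (≤-trans (m≤n⊔m ℓ₁ ℓ₂) le)
    go j (inj₂ refl) n le = p₁ n (≤-trans (m≤m⊔n ℓ₁ ℓ₂) le)

  module _ {k} {O : Fin k → ℕ → ℕ} where

    -- The quantifier ranges over all sufficiently long agreeing strings, so that the bounds of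
    -- subcomputations combine by taking maxima.
    Eventually : ∀ {n} → Code k n → Vec ℕ n → ℕ → Set
    Eventually e xs y = ∃[ ℓ ] ∀ n → ℓ ≤ n → ∀ c → Agrees O c → len c ≡ n → sim e c xs ≡ suc y

    private
      guards-sims : ∀ {m n} (gs : Vec (Code k n) m) {c xs ys x} →
        (∀ j → sim (lookup gs j) c xs ≡ suc (lookup ys j)) →
        map pred (sims gs c xs) ≡ ys × guards (sims gs c xs) x ≡ x
      guards-sims []       {ys = []}     h = refl , refl
      guards-sims (g ∷ gs) {c} {xs} {y ∷ ys} {x} h with guards-sims gs {x = x} (h ∘ suc)
      ... | p , q rewrite h zero = cong (y ∷_) p , q

      unguard : ∀ {v x} → 0 < v → guard v x ≡ x
      unguard {suc v} _ = refl

    sim-complete : ∀ {n} {e : Code k n} {xs y} → O ⊢ e [ xs ]↓ y → Eventually e xs y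
    sim-complete ↓zero = 0 , λ _ _ _ _ _ → refl
    sim-complete ↓succ = 0 , λ _ _ _ _ _ → refl
    sim-complete ↓proj = 0 , λ _ _ _ _ _ → refl
    sim-complete (↓oracle {j} {x}) = suc x , λ { n x<n c agrees refl →
      trans (unguard (m<n⇒0<n∸m x<n)) (cong suc (sym (agrees j x x<n))) }
    sim-complete (↓comp {f = f} {gs} {xs} {ys} {z} ds d)
      with uniform-Fin (λ j → sim-complete (ds j)) | sim-complete d
    ... | ℓ₁ , p₁ | ℓ₂ , p₂ = ℓ₁ ⊔ ℓ₂ , λ n le c agrees eq →
      let vs≡ , gd = guards-sims gs {c} {xs} {ys}
                       (λ j → p₁ j n (≤-trans (m≤m⊔n ℓ₁ ℓ₂) le) c agrees eq)
      in trans gd (trans (cong (sim f c) vs≡) (p₂ n (≤-trans (m≤n⊔m ℓ₁ ℓ₂) le) c agrees eq))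
    sim-complete (↓prec-z d) = sim-complete d
    sim-complete (↓prec-s {f = f} {g} {t} {xs} {y} {z} d₁ d₂) with sim-complete d₁ | sim-complete d₂
    ... | ℓ₁ , p₁ | ℓ₂ , p₂ = ℓ₁ ⊔ ℓ₂ , λ n le c agrees eq →
      trans (cong (λ a → guard a (sim g c (t ∷ pred a ∷ xs))) (p₁ n (≤-trans (m≤m⊔n ℓ₁ ℓ₂) le) c agrees eq))
        (p₂ n (≤-trans (m≤n⊔m ℓ₁ ℓ₂) le) c agrees eq)
    sim-complete (↓μ {f = f} {xs} {y} ds d)
      with uniform-< {P = λ j n → ∀ c → Agrees O c → len c ≡ n → verdict (sim f c (j ∷ xs)) j ≡ 0} y
             (λ j j<y → let ℓ , p = sim-complete (proj₂ (ds j j<y))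
                        in ℓ , λ n le c agrees eq → cong (λ v → verdict v j) (p n le c agrees eq))
         | sim-complete d
    ... | ℓ₁ , p₁ | ℓ₂ , p₂ = suc y ⊔ (ℓ₁ ⊔ ℓ₂) , λ n le c agrees eq →
      let y<n = ≤-trans (m≤m⊔n (suc y) (ℓ₁ ⊔ ℓ₂)) le
          le′ = ≤-trans (m≤n⊔m (suc y) (ℓ₁ ⊔ ℓ₂)) le
      in cong pred (latch-at {i = y} (subst (y <_) (sym eq) y<n)
           (cong (λ v → verdict v y) (p₂ n (≤-trans (m≤n⊔m ℓ₁ ℓ₂) le′) c agrees eq))
           (λ j j<y → p₁ j j<y n (≤-trans (m≤m⊔n ℓ₁ ℓ₂) le′) c agrees eq))

  -- One sufficiently long string reproduces both computations, and `sim` is a function.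
  ↓-unique : ∀ {k n} {O : Fin k → ℕ → ℕ} → (∀ ℓ → ∃[ c ] Agrees O c × ℓ ≤ len c) →
    ∀ {e : Code k n} {xs y z} → O ⊢ e [ xs ]↓ y → O ⊢ e [ xs ]↓ z → y ≡ z
  ↓-unique strings d₁ d₂ with sim-complete d₁ | sim-complete d₂
  ... | ℓ₁ , p₁ | ℓ₂ , p₂ with strings (ℓ₁ ⊔ ℓ₂)
  ...   | c , agrees , le = suc-injective (trans
            (sym (p₁ (len c) (≤-trans (m≤m⊔n ℓ₁ ℓ₂) le) c agrees refl))
            (p₂ (len c) (≤-trans (m≤n⊔m ℓ₁ ℓ₂) le) c agrees refl))

  ↓-deterministic : ∀ {n} {e : Code 0 n} {xs y z} →
    noOracle ⊢ e [ xs ]↓ y → noOracle ⊢ e [ xs ]↓ z → y ≡ z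
  ↓-deterministic = ↓-unique λ ℓ → enc (replicate ℓ 0) , (λ ()) ,
    ≤-reflexive (sym (trans (len-enc (replicate ℓ 0)) (length-replicate ℓ)))

-- Bushy trees: splitting, pigeonhole and avoidance.

module Bushy where

  open import Axiom.ExcludedMiddle using (ExcludedMiddle)
  open import Data.Bool.Base using (Bool; true; false)
  open import Data.List.Base using (List; []; _∷_; length)
  open import Data.Nat.Base hiding (parity)
  open import Data.Nat.Properties
  open import Data.Empty using (⊥)
  open import Data.Product.Base using (Σ-syntax; ∃-syntax; _×_; _,_)
  open import Data.Sum.Base using (_⊎_; inj₁; inj₂)
  open import Function.Base using (_∘_)
  open import Level using (0ℓ)
  open import Relation.Binary.PropositionalEquality
  open import Relation.Nullary.Decidable.Core using (yes; no; does; decidable-stable)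
  open import Relation.Nullary.Negation using (¬_; contradiction)
  open import Relation.Unary using (Pred; _⊆_; _∪_)
  open import Defs using (bit)
  open Computability
  open Arithmetic

  -- Strings of numbers are lists with the last entry first, and the n-th entry is below q n.
  -- A is k-big above τ when it contains all leaves of a finite tree with root τ each of whose
  -- inner nodes has at least k children; these are the numbers selected by S.
  data Big (q : ℕ → ℕ) (k : ℕ) (A : Pred (List ℕ) 0ℓ) (τ : List ℕ) : Set where
    leaf : A τ → Big q k A τ
    node : (S : ℕ → Bool) → k ≤ ∑ (q (length τ)) (bit ∘ S) →
           (∀ i → i < q (length τ) → S i ≡ true → Big q k A (i ∷ τ)) → Big q k A τ

  data Extends (q : ℕ → ℕ) (σ : List ℕ) : List ℕ → Set where
    here : Extends q σ σ
    snoc : ∀ {τ i} → i < q (length τ) → Extends q σ τ → Extends q σ (i ∷ τ)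

  Extends-trans : ∀ {q ρ σ τ} → Extends q ρ σ → Extends q σ τ → Extends q ρ τ
  Extends-trans e here       = e
  Extends-trans e (snoc p f) = snoc p (Extends-trans e f)

  Extends-length : ∀ {q σ τ} → Extends q σ τ → length σ ≤ length τ
  Extends-length here       = ≤-refl
  Extends-length (snoc _ f) = m≤n⇒m≤1+n (Extends-length f)

  module _ {q : ℕ → ℕ} where

    Big-mono : ∀ {k l A B} → l ≤ k → A ⊆ B → Big q k A ⊆ Big q l B
    Big-mono l≤k A⊆B (leaf a)     = leaf (A⊆B a)
    Big-mono l≤k A⊆B (node S p f) = node S (≤-trans l≤k p) λ i i<q Si → Big-mono l≤k A⊆B (f i i<q Si)

    module _ (em : ExcludedMiddle 0ℓ) where

      -- By induction every selected child has A k-big or B l-big above it. If fewer than k children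
      -- were of the first kind and fewer than l of the second, fewer than k + l would be selected.
      -- Excluded middle sorts the children.
      Big-∪ : ∀ {k l A B} → Big q (k + l) (A ∪ B) ⊆ (Big q k A ∪ Big q l B)
      Big-∪ (leaf (inj₁ a)) = inj₁ (leaf a)
      Big-∪ (leaf (inj₂ b)) = inj₂ (leaf b)
      Big-∪ {k} {l} {A} {B} {τ} (node S p f) with k ≤? ∑ n (bit ∘ SA) | l ≤? ∑ n (bit ∘ SB)
        where
        n = q (length τ)
        SA SB : ℕ → Bool
        SA i = does (em {Big q k A (i ∷ τ)})
        SB i = does (em {Big q l B (i ∷ τ)})
      ... | yes p′ | _ = inj₁ (node _ p′ λ i _ → holds i)
        where
        holds : ∀ i → does (em {Big q k A (i ∷ τ)}) ≡ true → Big q k A (i ∷ τ)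
        holds i eq with em {Big q k A (i ∷ τ)}
        ... | yes b = b
      ... | no _ | yes p′ = inj₂ (node _ p′ λ i _ → holds i)
        where
        holds : ∀ i → does (em {Big q l B (i ∷ τ)}) ≡ true → Big q l B (i ∷ τ)
        holds i eq with em {Big q l B (i ∷ τ)}
        ... | yes b = b
      ... | no k≰ | no l≰ = contradiction (≤-trans p le) (<⇒≱ (+-mono-<-≤ (≰⇒> k≰) (<⇒≤ (≰⇒> l≰))))
        where
        n = q (length τ)
        cover : ∀ i → i < n →
          bit (S i) ≤ bit (does (em {Big q k A (i ∷ τ)})) + bit (does (em {Big q l B (i ∷ τ)}))
        cover i i<n with S i in Si
        ... | false = z≤n
        ... | true with em {Big q k A (i ∷ τ)} | em {Big q l B (i ∷ τ)}
        ...   | yes _ | _     = s≤s z≤n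
        ...   | no _  | yes _ = s≤s z≤n
        ...   | no ¬a | no ¬b with Big-∪ (f i i<n Si)
        ...     | inj₁ a = contradiction a ¬a
        ...     | inj₂ b = contradiction b ¬b
        le : ∑ n (bit ∘ S) ≤ ∑ n (λ i → bit (does (em {Big q k A (i ∷ τ)}))) + ∑ n (λ i → bit (does (em {Big q l B (i ∷ τ)})))
        le = ≤-trans (∑-mono n cover) (≤-reflexive (∑-+ n _ _))

      -- Each yes-no question splits the set in two, and by `Big-∪` one part keeps half of the
      -- bigness; m questions cost a factor 2^m.
      Big-decide : ∀ m {k C} (P : ℕ → Bool → Pred (List ℕ) 0ℓ) {τ} →
        (∀ {ρ} → C ρ → ∀ i → i < m → ∃[ b ] P i b ρ) → Big q (2^ m * k) C τ →
        Σ[ f ∈ (ℕ → Bool) ] Big q k (λ ρ → C ρ × (∀ i → i < m → P i (f i) ρ)) τ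
      Big-decide zero {k} P h big =
        (λ _ → false) , Big-mono (≤-reflexive (sym (+-identityʳ k))) (λ c → c , λ _ ()) big
      Big-decide (suc m) {k} {C} P {τ} h big with first
        where
        cover : C ⊆ ((λ ρ → C ρ × P 0 false ρ) ∪ (λ ρ → C ρ × P 0 true ρ))
        cover c with h c 0 z<s
        ... | false , p = inj₁ (c , p)
        ... | true  , p = inj₂ (c , p)
        first : ∃[ b ] Big q (2^ m * k) (λ ρ → C ρ × P 0 b ρ) τ
        first with Big-∪ {2^ m * k} {2^ m * k}
                     (Big-mono (≤-reflexive (sym (*-distribʳ-+ k (2^ m) (2^ m)))) cover big)
        ... | inj₁ b = false , b
        ... | inj₂ b = true , b
      ... | b , big′ with Big-decide m (P ∘ suc) (λ (c , _) i i<m → h c (suc i) (s≤s i<m)) big′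
      ...   | f , big″ = (λ { zero → b ; (suc i) → f i }) , Big-mono ≤-refl
                (λ ((c , p) , ps) → c , λ { zero _ → p ; (suc i) (s≤s i<m) → ps i i<m }) big″

      small-child : ∀ {k B τ} (S : ℕ → Bool) → k ≤ ∑ (q (length τ)) (bit ∘ S) → ¬ Big q k B τ →
        ∃[ i ] i < q (length τ) × S i ≡ true × ¬ Big q k B (i ∷ τ)
      small-child S p small = decidable-stable em λ none → small
        (node S p λ i i<q Si → decidable-stable em λ ¬big → none (i , i<q , Si , ¬big))

      -- Walk through the tree for A, always to a child above which B stays small. Such a child
      -- exists, since a node has at least l selected children and otherwise B would be big at the
      -- node.
      Big-avoid : ∀ {k l A B τ} → l ≤ k → Big q k A τ → ¬ Big q l B τ →
        ∃[ ρ ] Extends q τ ρ × A ρ × ¬ Big q l B ρ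
      Big-avoid l≤k (leaf a)     small = _ , here , a , small
      Big-avoid l≤k (node S p f) small with small-child S (≤-trans l≤k p) small
      ... | i , i<q , Si , small′ with Big-avoid l≤k (f i i<q Si) small′
      ...   | ρ , ext , a , small″ = ρ , Extends-trans (snoc i<q here) ext , a , small″

      small-extend : ∀ {k B τ} d → (∀ n → length τ ≤ n → k ≤ q n) → ¬ Big q k B τ →
        ∃[ ρ ] Extends q τ ρ × length ρ ≡ d + length τ × ¬ Big q k B ρ
      small-extend zero    k≤q small = _ , here , refl , small
      small-extend {k} (suc d) k≤q small with small-extend d k≤q small
      ... | ρ , ext , eq , small′ with small-child (λ _ → true)
              (≤-trans (k≤q (length ρ) (Extends-length ext))
                (≤-reflexive (sym (∑-ones (q (length ρ)) λ _ _ → refl)))) small′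
      ...   | i , i<q , _ , small″ = i ∷ ρ , snoc i<q ext , cong suc eq , small″

  Hits : (ℕ → ℕ → Set) → Pred (List ℕ) 0ℓ
  Hits R []      = ⊥
  Hits R (i ∷ τ) = R (length τ) i ⊎ Hits R τ

  module _ {q : ℕ → ℕ} (em : ExcludedMiddle 0ℓ) {R : ℕ → ℕ → Set}
           (functional : ∀ {n i j} → R n i → R n j → i ≡ j) where

    -- Among two children at most one is a hit, by functionality. Following a child that misses
    -- leads to a leaf without any hit, contrary to what leaves must satisfy.
    Hits-small : ∀ {τ} → ¬ Hits R τ → ¬ Big q 2 (Hits R) τ
    Hits-small ¬hit (leaf hit)   = ¬hit hit
    Hits-small {τ} ¬hit (node S p f) with em {∃[ i ] i < q (length τ) × S i ≡ true × ¬ R (length τ) i}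
    ... | yes (i , i<q , Si , ¬r) =
            Hits-small (λ { (inj₁ r) → ¬r r ; (inj₂ h) → ¬hit h }) (f i i<q Si)
    ... | no none = contradiction p (<⇒≱ (s≤s (atMostOne (q (length τ)) onlyHits)))
      where
      onlyHits : ∀ i → i < q (length τ) → S i ≡ true → R (length τ) i
      onlyHits i i<q Si = decidable-stable em λ ¬r → none (i , i<q , Si , ¬r)
      atMostOne : ∀ n → (∀ i → i < n → S i ≡ true → R (length τ) i) → ∑ n (bit ∘ S) ≤ 1
      atMostOne zero    h = z≤n
      atMostOne (suc n) h with S n in Sn
      ... | false = atMostOne n λ i i<n → h i (m<n⇒m<1+n i<n)
      ... | true  = s≤s (≤-reflexive (∑-zero n λ i i<n → off i i<n))
        where
        off : ∀ i → i < n → bit (S i) ≡ 0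
        off i i<n with S i in Si
        ... | false = refl
        ... | true  = contradiction (functional (h i (m<n⇒m<1+n i<n) Si) (h n ≤-refl Sn)) (<⇒≢ i<n)

-- A computable bound with long constant blocks and large jumps.

module Growth where

  open import Data.Fin.Patterns using (0F; 1F; 2F)
  open import Data.List.Base using ([]; length)
  open import Data.Nat.Base hiding (parity)
  open import Data.Nat.Properties
  open import Data.Product.Base using (∃-syntax; _×_; _,_)
  open import Data.Vec.Base using (lookup)
  open import Relation.Binary.PropositionalEquality
  open Computability
  open Arithmetic
  open Bushy

  -- The code of the string consisting of ℓ entries K. It is maximal among the codes of such strings
  -- with entries up to K because `child` is monotone.
  codeBound : ℕ → ℕ → ℕ
  codeBound ℓ K = natrec 0 (λ _ c → child c K) ℓ

  enc-bound : ∀ {q K τ} → Extends q [] τ → (∀ n → n < length τ → q n ≤ K) → enc τ ≤ codeBound (length τ) K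
  enc-bound here            q≤K = z≤n
  enc-bound (snoc i<q ext)  q≤K = child-mono
    (enc-bound ext λ n n<ℓ → q≤K n (m<n⇒m<1+n n<ℓ)) (≤-trans (<⇒≤ i<q) (q≤K _ ≤-refl))

  -- On each block q is constant, with value K say. The block ends at K + K and has length at
  -- least K, so it contributes at least 1 to Σ q(n)⁻¹. After it q jumps above the demands of all
  -- strings of length K + K with entries below K.
  record Staircase (demand : ℕ → ℕ) : Set where
    field
      q         : ℕ → ℕ
      qᶜ        : Rec {1} (λ xs → q (lookup xs 0F))
      q≥2       : ∀ n → 2 ≤ q n
      q-mono    : ∀ {m n} → m ≤ n → q m ≤ q n
      start     : ℕ → ℕ
      start≥    : ∀ i → i ≤ start i
      start≤q   : ∀ i → start i ≤ q (start i)
      block     : ∀ i t → t < q (start i) → q (start i + t) ≡ q (start i)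
      block-end : ∀ i → start i + q (start i) ≤ start (suc i)
      jump      : ∀ i {τ n} → Extends q [] τ → length τ ≡ start (suc i) → length τ ≤ n →
                  demand (enc τ) ≤ q n

  module _ {demand : ℕ → ℕ} (demandᶜ : Rec {1} (λ xs → demand (lookup xs 0F))) where

    private
      rise q start : ℕ → ℕ
      -- The sum dominates each of its terms, hence all demands of codes up to the bound. The
      -- summand K lifts the next value to at least K + K, the place of the jump, which preserves
      -- `start≤q`.
      rise K = K + ∑ (suc (codeBound (K + K) K)) demand
      -- A block with value K ends at position K + K, so the recursion detects the jump from the
      -- current position and value alone.
      q n = natrec 2 (λ m K → K + isEq (suc m) (K + K) * rise K) n
      start i = natrec 0 (λ _ n → q n + q n) i

      riseᶜ : Rec {1} (λ xs → rise (lookup xs 0F))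
      riseᶜ = var 0F +ᶜ ∑ᶜ (sucᶜ (natrecᶜ (const 0) (childᶜ (var 1F) (var 2F)) (var 0F +ᶜ var 0F)))
                         (ap₁ demand demandᶜ (var 0F))

      q-step : ∀ n → q n ≤ q (suc n)
      q-step n = m≤m+n (q n) _

      q-mono : ∀ {m n} → m ≤ n → q m ≤ q n
      q-mono m≤n with ≤⇒≤′ m≤n
      ... | ≤′-refl          = ≤-refl
      ... | ≤′-step {n} m≤′n = ≤-trans (q-mono (≤′⇒≤ m≤′n)) (q-step n)

      q≥2 : ∀ n → 2 ≤ q n
      q≥2 n = q-mono {0} {n} z≤n

      q-stay : ∀ {m} → suc m ≢ q m + q m → q (suc m) ≡ q m
      q-stay {m} ne = trans (cong (λ e → q m + e * rise (q m)) (isEq-≢ ne)) (+-identityʳ (q m))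

      q-jump : ∀ {m} → suc m ≡ q m + q m → q (suc m) ≡ q m + rise (q m)
      q-jump {m} eq = trans
        (cong (λ k → q m + isEq (suc m) k * rise (q m)) (sym eq))
        (trans (cong (λ e → q m + e * rise (q m)) (isEq-refl (suc m))) (cong (q m +_) (*-identityˡ _)))

      constant : ∀ n t → n + t < q n + q n → q (n + t) ≡ q n
      constant n zero    _ = cong q (+-identityʳ n)
      constant n (suc t) p = trans (cong q (+-suc n t)) (trans (q-stay ne) ih)
        where
        p′ : suc (n + t) < q n + q n
        p′ = ≤-trans (≤-reflexive (cong suc (sym (+-suc n t)))) p
        ih : q (n + t) ≡ q n
        ih = constant n t (<⇒≤ p′)
        ne : suc (n + t) ≢ q (n + t) + q (n + t)
        ne eq = <⇒≢ p′ (trans eq (cong₂ _+_ ih ih))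

      lastPlace : ∀ n → n ≤ q n → ∃[ m ] suc m ≡ q n + q n × q m ≡ q n
      lastPlace n n≤q with m≤n⇒∃[o]m+o≡n (≤-trans (s≤s n≤q) (+-monoˡ-≤ (q n) (<⇒≤ (q≥2 n))))
      ... | t , eq = n + t , eq , constant n t (≤-reflexive eq)

      start≤q : ∀ i → start i ≤ q (start i)
      atStart : ∀ i → q (start (suc i)) ≡ q (start i) + rise (q (start i))

      start≤q zero    = z≤n
      start≤q (suc i) = ≤-trans (+-monoʳ-≤ (q (start i)) (m≤m+n (q (start i)) _)) (≤-reflexive (sym (atStart i)))

      atStart i with lastPlace (start i) (start≤q i)
      ... | m , eq , qm = trans (cong q (sym eq))
            (trans (q-jump (trans eq (sym (cong₂ _+_ qm qm)))) (cong₂ (λ a b → a + rise b) qm qm))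

      start≥ : ∀ i → i ≤ start i
      start≥ zero    = z≤n
      start≥ (suc i) = +-mono-≤ (<⇒≤ (q≥2 (start i))) (≤-trans (start≥ i) (start≤q i))

      below : ∀ i n → n < start (suc i) → q n ≤ q (start i)
      below i n n< with lastPlace (start i) (start≤q i)
      ... | m , eq , qm = ≤-trans (q-mono (s≤s⁻¹ (≤-trans n< (≤-reflexive (sym eq))))) (≤-reflexive qm)

      jump : ∀ i {τ n} → Extends q [] τ → length τ ≡ start (suc i) → length τ ≤ n → demand (enc τ) ≤ q n
      jump i {τ} {n} ext eq ℓ≤n = begin
        demand (enc τ)                        ≤⟨ term≤∑ demand (s≤s code≤) ⟩
        ∑ (suc (codeBound (K + K) K)) demand  ≤⟨ m≤n+m _ K ⟩
        rise K                                ≤⟨ m≤n+m _ K ⟩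
        K + rise K                            ≡⟨ atStart i ⟨
        q (start (suc i))                     ≤⟨ q-mono (≤-trans (≤-reflexive (sym eq)) ℓ≤n) ⟩
        q n                                   ∎
        where
        open ≤-Reasoning hiding (start)
        K = q (start i)
        code≤ : enc τ ≤ codeBound (K + K) K
        code≤ = subst (λ ℓ → enc τ ≤ codeBound ℓ K) eq
          (enc-bound ext λ m m<ℓ → below i m (≤-trans m<ℓ (≤-reflexive eq)))

    abstract

      staircase : Staircase demand
      staircase = record
        { q         = q
        ; qᶜ        = natrecᶜ (const 2)
            (var 1F +ᶜ isEqᶜ (sucᶜ (var 0F)) (var 1F +ᶜ var 1F) *ᶜ ap₁ rise riseᶜ (var 1F)) (var 0F)
        ; q≥2       = q≥2
        ; q-mono    = q-mono
        ; start     = start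
        ; start≥    = start≥
        ; start≤q   = start≤q
        ; block     = λ i t t<q → constant (start i) t (+-mono-≤-< (start≤q i) t<q)
        ; block-end = λ i → +-monoˡ-≤ (q (start i)) (start≤q i)
        ; jump      = jump
        }

-- Effective search for an output string that is produced on a big set.

module Search where

  open import Axiom.ExcludedMiddle using (ExcludedMiddle)
  open import Data.Bool.Base using (Bool; true; false; _∨_)
  open import Data.Bool.Properties using (∨-zeroʳ; T-≡)
  open import Data.Fin.Patterns using (0F; 1F; 2F; 3F; 4F)
  open import Data.List.Base using (List; []; _∷_; length)
  open import Data.Nat.Base hiding (parity)
  open import Data.Nat.Properties
  open import Data.Product.Base using (∃-syntax; _×_; _,_; proj₂)
  open import Data.Sum.Base using (_⊎_; inj₁; inj₂)
  open import Data.Vec.Base using ([]; _∷_; lookup)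
  open import Function.Bundles using (Equivalence)
  open import Level using (0ℓ)
  open import Relation.Binary.PropositionalEquality
  open import Relation.Nullary.Decidable.Core using (yes; no)
  open import Relation.Nullary.Negation using (contradiction)
  open import Relation.Unary using (Pred; _⊆_; _∪_)
  open import Defs using (bit; Code)
  open Computability
  open Arithmetic
  open Simulation
  open Bushy

  isPos : ℕ → Bool
  isPos zero    = false
  isPos (suc _) = true

  bit-isPos : ∀ {n} → n ≤ 1 → bit (isPos n) ≡ n
  bit-isPos {0} _ = refl
  bit-isPos {1} _ = refl
  bit-isPos {suc (suc _)} (s≤s ())

  isPos-pos : ∀ {n} → isPos n ≡ true → 0 < n
  isPos-pos {suc n} _ = z<s

  -- Finite trees of strings, given as sets of codes: every member is in A or has k children.
  record Tree (q : ℕ → ℕ) (k : ℕ) (A : Pred (List ℕ) 0ℓ) (Root : Pred (List ℕ) 0ℓ) : Set where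
    field
      member : ℕ → Bool
      bound  : ℕ
      below  : ∀ {c} → member c ≡ true → c < bound
      roots  : ∀ {τ} → Root τ → member (enc τ) ≡ true
      closed : ∀ {c} → member c ≡ true →
        ∃[ τ ] c ≡ enc τ × (A τ ⊎ k ≤ ∑ (q (length τ)) (λ i → bit (member (enc (i ∷ τ)))))

  module _ {q : ℕ → ℕ} {k : ℕ} {A : Pred (List ℕ) 0ℓ} where

    private
      bit-∨ˡ : ∀ a b → bit a ≤ bit (a ∨ b)
      bit-∨ˡ false b = z≤n
      bit-∨ˡ true  b = ≤-refl

      bit-∨ʳ : ∀ a b → bit b ≤ bit (a ∨ b)
      bit-∨ʳ false b     = ≤-refl
      bit-∨ʳ true  false = z≤n
      bit-∨ʳ true  true  = ≤-refl

      empty : ∀ {Root} → (∀ {τ} → Root τ → 1 ≡ 0) → Tree q k A Root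
      empty none = record
        { member = λ _ → false ; bound = 0 ; below = λ () ; closed = λ ()
        ; roots = λ r → contradiction (none r) λ () }

      join : ∀ {P Q Root} → Root ⊆ (P ∪ Q) → Tree q k A P → Tree q k A Q → Tree q k A Root
      join {P} {Q} {Root} cover s t = record
        { member = m
        ; bound  = S.bound ⊔ T.bound
        ; below  = below
        ; roots  = λ r → root (cover r)
        ; closed = closed
        }
        where
        module S = Tree s
        module T = Tree t
        m : ℕ → Bool
        m c = S.member c ∨ T.member c
        below : ∀ {c} → m c ≡ true → c < S.bound ⊔ T.bound
        below {c} eq with S.member c in eq′
        ... | true  = ≤-trans (S.below eq′) (m≤m⊔n _ _)
        ... | false = ≤-trans (T.below eq) (m≤n⊔m S.bound _)
        root : ∀ {τ} → P τ ⊎ Q τ → m (enc τ) ≡ true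
        root (inj₁ p) rewrite S.roots p = refl
        root (inj₂ p) rewrite T.roots p = ∨-zeroʳ _
        closed : ∀ {c} → m c ≡ true → _
        closed {c} eq with S.member c in eq′
        ... | true with S.closed eq′
        ...   | τ , c≡ , inj₁ a = τ , c≡ , inj₁ a
        ...   | τ , c≡ , inj₂ p = τ , c≡ , inj₂ (≤-trans p
                  (∑-mono (q (length τ)) λ i _ → bit-∨ˡ (S.member (enc (i ∷ τ))) _))
        closed {c} eq | false with T.closed eq
        ...   | τ , c≡ , inj₁ a = τ , c≡ , inj₁ a
        ...   | τ , c≡ , inj₂ p = τ , c≡ , inj₂ (≤-trans p
                  (∑-mono (q (length τ)) λ i _ → bit-∨ʳ (S.member (enc (i ∷ τ))) _))

      add : ∀ {Root τ} → Tree q k A Root →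
        (∀ (t : Tree q k A Root) → let open Tree t in
          A τ ⊎ k ≤ ∑ (q (length τ)) (λ i → bit (member (enc (i ∷ τ))))) → Tree q k A (_≡ τ)
      add {Root} {τ} t good = record
        { member = m
        ; bound  = suc (enc τ) ⊔ T.bound
        ; below  = below
        ; roots  = λ { refl → root }
        ; closed = closed
        }
        where
        module T = Tree t
        m : ℕ → Bool
        m c = (c ≡ᵇ enc τ) ∨ T.member c
        same : ∀ {c} → (c ≡ᵇ enc τ) ≡ true → c ≡ enc τ
        same {c} eq = ≡ᵇ⇒≡ c (enc τ) (Equivalence.from T-≡ eq)
        below : ∀ {c} → m c ≡ true → c < suc (enc τ) ⊔ T.bound
        below {c} eq with c ≡ᵇ enc τ in eq′
        ... | true  = ≤-trans (s≤s (≤-reflexive (same eq′))) (m≤m⊔n (suc (enc τ)) T.bound)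
        ... | false = ≤-trans (T.below eq) (m≤n⊔m (suc (enc τ)) _)
        root : m (enc τ) ≡ true
        root = cong (_∨ T.member (enc τ)) (Equivalence.to T-≡ (≡⇒≡ᵇ (enc τ) (enc τ) refl))
        closed : ∀ {c} → m c ≡ true → _
        closed {c} eq with c ≡ᵇ enc τ in eq′
        ... | true with good t
        ...   | inj₁ a = τ , same eq′ , inj₁ a
        ...   | inj₂ p = τ , same eq′ , inj₂ (≤-trans p
                  (∑-mono (q (length τ)) λ i _ → bit-∨ʳ (enc (i ∷ τ) ≡ᵇ enc τ) _))
        closed {c} eq | false with T.closed eq
        ...   | ρ , c≡ , inj₁ a = ρ , c≡ , inj₁ a
        ...   | ρ , c≡ , inj₂ p = ρ , c≡ , inj₂ (≤-trans p
                  (∑-mono (q (length ρ)) λ i _ → bit-∨ʳ (enc (i ∷ ρ) ≡ᵇ enc τ) _))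

    -- This turns a derivation of bigness into a finite set of codes, which a search can find and
    -- check: join the trees of the selected children and add the node.
    Big⇒Tree : ∀ {τ} → Big q k A τ → Tree q k A (_≡ τ)
    Big⇒Tree (leaf a) = add {Root = λ _ → 1 ≡ 0} (empty λ r → r) λ _ → inj₁ a
    Big⇒Tree {τ} (node S p f) = add (forest (q (length τ)) ≤-refl) λ t → inj₂
      (≤-trans p (∑-mono (q (length τ)) λ i i<q → chosen t i i<q))
      where
      Roots : ℕ → Pred (List ℕ) 0ℓ
      Roots n ρ = ∃[ i ] i < n × S i ≡ true × ρ ≡ i ∷ τ
      forest : ∀ n → n ≤ q (length τ) → Tree q k A (Roots n)
      forest zero    _ = empty λ ()
      forest (suc n) n<q with S n in Sn
      ... | true  = join cover (Big⇒Tree (f n n<q Sn)) (forest n (<⇒≤ n<q))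
        where
        cover : Roots (suc n) ⊆ ((_≡ n ∷ τ) ∪ Roots n)
        cover (i , i<1+n , Si , eq) with m≤n⇒m<n∨m≡n (s≤s⁻¹ i<1+n)
        ... | inj₁ i<n  = inj₂ (i , i<n , Si , eq)
        ... | inj₂ refl = inj₁ eq
      -- Nothing is added here; the union of the forest with itself serves to restate its roots.
      ... | false = join cover (forest n (<⇒≤ n<q)) (forest n (<⇒≤ n<q))
        where
        cover : Roots (suc n) ⊆ (Roots n ∪ Roots n)
        cover (i , i<1+n , Si , eq) with m≤n⇒m<n∨m≡n (s≤s⁻¹ i<1+n)
        ... | inj₁ i<n  = inj₁ (i , i<n , Si , eq)
        ... | inj₂ refl = contradiction (trans (sym Si) Sn) λ ()
      chosen : (t : Tree q k A (Roots (q (length τ)))) → ∀ i → i < q (length τ) →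
        bit (S i) ≤ bit (Tree.member t (enc (i ∷ τ)))
      chosen t i i<q with S i in Si
      ... | false = z≤n
      ... | true  = ≤-reflexive (cong bit (sym (Tree.roots t (i , i<q , Si , refl))))

  module _ (e : Code 1 1) where

    -- 0 where the computation is undefined, and otherwise 1 + the output read as a bit.
    out : ℕ → ℕ → ℕ
    out c i = sg (sim e c (i ∷ [])) + sg (pred (sim e c (i ∷ [])))

    Outputs : ℕ → Bool → Pred (List ℕ) 0ℓ
    Outputs i b τ = out (enc τ) i ≡ suc (bit b)

    Converges : ℕ → Pred (List ℕ) 0ℓ
    Converges m τ = ∀ i → i < m → ∃[ b ] Outputs i b τ

    OutputsString : ℕ → ℕ → Pred (List ℕ) 0ℓ
    OutputsString m Y τ = ∀ i → i < m → out (enc τ) i ≡ suc (bitAt Y i)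

  module _ (q : ℕ → ℕ) (qᶜ : Rec {1} (λ xs → q (lookup xs 0F)))
           (R : ℕ → ℕ) (Rᶜ : Rec {1} (λ xs → R (lookup xs 0F)))
           (e : Code 1 1) where

    private
      match : ℕ → ℕ → ℕ → ℕ
      match j Y c = all (R j) (λ i → isEq (out e c i) (suc (bitAt Y i)))

      -- A disjunction of truth values written as a sum: c is not in W, or c outputs Y, or at least
      -- j children of c are in W.
      member-ok : ℕ → ℕ → ℕ → ℕ → ℕ
      member-ok j Y W c = (1 ∸ bitAt W c) + (match j Y c + (1 ∸ (j ∸ ∑ (q (len c)) (λ i → bitAt W (child c i)))))

      -- The number j has two roles: it is the code of the root and the required branching.
      valid : ℕ → ℕ → ℕ → ℕ
      valid j Y W = bitAt W j * all W (λ c → member-ok j Y W c)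

      attempt : ℕ → ℕ → ℕ
      attempt j W = latch (λ Y → guard (valid j Y W) (suc Y)) (2^ (R j))

      validᶜ : Rec {3} (λ xs → valid (lookup xs 0F) (lookup xs 1F) (lookup xs 2F))
      validᶜ = bitAtᶜ (var 2F) (var 0F) *ᶜ
        allᶜ (var 2F)
          ((const 1 ∸ᶜ bitAtᶜ (var 3F) (var 0F)) +ᶜ
           (allᶜ (ap₁ R Rᶜ (var 1F))
              (isEqᶜ (sgᶜ simᵢ +ᶜ sgᶜ (predᶜ simᵢ)) (sucᶜ (bitAtᶜ (var 3F) (var 0F)))) +ᶜ
            (const 1 ∸ᶜ (var 1F ∸ᶜ ∑ᶜ (ap₁ q qᶜ (lenᶜ (var 0F))) (bitAtᶜ (var 4F) (childᶜ (var 1F) (var 0F)))))))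
        where
        open import Data.Vec.Relation.Unary.All using ([]; _∷_)
        simᵢ : Rec {5} (λ xs → sim e (lookup xs 1F) (lookup xs 0F ∷ []))
        simᵢ = compᶜ (simᶜ e) (var 1F ∷ var 0F ∷ [])

    abstract

      -- By stage s bigness has been verified for the output string with number Y if the value is suc Y.
      θ : ℕ → ℕ → ℕ
      θ j s = latch (attempt j) s

      θᶜ : Rec {2} (λ xs → θ (lookup xs 0F) (lookup xs 1F))
      θᶜ = latchᶜ (var 1F) (latchᶜ (2^ᶜ (ap₁ R Rᶜ (var 1F)))
             (guardᶜ (compᶜ validᶜ (var 2F ∷ var 0F ∷ var 1F ∷ [])) (sucᶜ (var 0F))))
        where open import Data.Vec.Relation.Unary.All using ([]; _∷_)

    private
      match⇒ : ∀ {j Y τ} → 0 < match j Y (enc τ) → OutputsString e (R j) Y τ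
      match⇒ {j} {Y} {τ} p i i<R =
        isEq⇒≡ (pos-all (R j) {λ i → isEq (out e (enc τ) i) (suc (bitAt Y i))} p i i<R)

      ⇒match : ∀ {j Y τ} → OutputsString e (R j) Y τ → 0 < match j Y (enc τ)
      ⇒match {j} {Y} h = all-pos (R j) λ i i<R →
        subst (λ a → 0 < isEq a (suc (bitAt Y i))) (sym (h i i<R)) (≤-reflexive (sym (isEq-refl (suc (bitAt Y i)))))

      three-cases : ∀ a b c {x} → 0 < (1 ∸ a) + (b + (1 ∸ (c ∸ x))) → 0 < a → 0 < b ⊎ c ≤ x
      three-cases (suc a) (suc b) c p _ = inj₁ z<s
      three-cases (suc a) zero c {x} p _ with c ∸ x in eq
      ... | zero  = inj₂ (m∸n≡0⇒m≤n eq)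
      ... | suc d = contradiction p (<⇒≱ (s≤s (≤-reflexive (cong₂ _+_ (0∸n≡0 a) (0∸n≡0 d)))))

    -- Children have larger codes than their parents and members of W are below W, so descending
    -- inside W terminates. The recursion is on the distance d that remains up to W.
    valid-sound : ∀ {σ Y W} → 0 < valid (enc σ) Y W → Big q (enc σ) (OutputsString e (R (enc σ)) Y) σ
    valid-sound {σ} {Y} {W} p = go W (pos-*ˡ p) (m≤n+m W (enc σ))
      where
      j = enc σ
      ok : ∀ c → c < W → 0 < member-ok j Y W c
      ok = pos-all W (pos-*ʳ {bitAt W j} p)
      go : ∀ d {τ} → 0 < bitAt W (enc τ) → W ≤ enc τ + d → Big q j (OutputsString e (R j) Y) τ
      go zero {τ} p W≤ = contradiction (bitAt-< {W} p) (≤⇒≯ (≤-trans W≤ (≤-reflexive (+-identityʳ _))))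
      go (suc d) {τ} p W≤ with three-cases (bitAt W (enc τ)) (match j Y (enc τ)) j (ok (enc τ) (bitAt-< {W} p)) p
      ... | inj₁ m = leaf (match⇒ {j} {Y} m)
      ... | inj₂ j≤ = node (λ i → isPos (bitAt W (enc (i ∷ τ))))
              (≤-trans j≤ (≤-reflexive (trans
                (cong (λ ℓ → ∑ (q ℓ) (λ i → bitAt W (enc (i ∷ τ)))) (len-enc τ))
                (∑-cong (q (length τ)) λ i _ → sym (bit-isPos (parity≤1 (iter half (enc (i ∷ τ)) W)))))))
              (λ i _ Si → go d (isPos-pos Si) (≤-trans W≤
                (≤-trans (≤-reflexive (+-suc (enc τ) d)) (+-monoˡ-≤ d (child-> (enc τ) i)))))

    abstract

      θ-sound : ∀ {σ s Y} → θ (enc σ) s ≡ suc Y → Big q (enc σ) (OutputsString e (R (enc σ)) Y) σ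
      θ-sound {σ} {s} eq with latch-first s eq
      ... | W , _ , eq₁ , _ with latch-first (2^ (R (enc σ))) eq₁
      ...   | Y , _ , eq₂ , _ with valid (enc σ) Y W in eq₃ | eq₂
      ...     | suc _ | refl = valid-sound {σ} {Y} {W} (subst (0 <_) (sym eq₃) z<s)

      -- Deciding the output bits one by one leaves a single string Y on a j-big set, and a tree
      -- witnessing this is coded by some W. The search thus succeeds by stage W + 1, though
      -- possibly earlier and with another string.
      θ-complete : ExcludedMiddle 0ℓ → ∀ {σ} → Big q (2^ (R (enc σ)) * enc σ) (Converges e (R (enc σ))) σ →
        ∃[ Y ] ∃[ s ] θ (enc σ) s ≡ suc Y
      θ-complete em {σ} big with Big-decide em (R (enc σ)) (Outputs e) (λ c → c) big
      ... | f , big′ = finish (latch-some {n = suc W} ≤-refl (subst (0 <_) (sym (proj₂ found)) z<s))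
        where
        j Y W : ℕ
        j = enc σ
        Y = fromBits f (R j)
        big″ : Big q j (OutputsString e (R j) Y) σ
        big″ = Big-mono ≤-refl
          (λ (_ , h) i i<R → trans (h i i<R) (cong suc (sym (bitAt-fromBits f i<R)))) big′
        open Tree (Big⇒Tree big″)
        W = fromBits member bound
        bits : ∀ c → bitAt W c ≡ bit (member c)
        bits c with c <? bound
        ... | yes c<b = bitAt-fromBits member c<b
        ... | no c≮b with member c in eq
        ...   | true  = contradiction (below eq) c≮b
        ...   | false = bitAt-fromBits-≥ member (≮⇒≥ c≮b)
        ok : ∀ c → 0 < member-ok j Y W c
        ok c with member c in eq
        ... | false = ≤-trans (≤-reflexive (cong (1 ∸_) (sym (trans (bits c) (cong bit eq))))) (m≤m+n _ _)
        ... | true with closed eq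
        ...   | τ , refl , inj₁ a = ≤-trans (≤-trans (⇒match {j} {Y} {τ} a) (m≤m+n _ _)) (m≤n+m _ (1 ∸ bitAt W c))
        ...   | τ , refl , inj₂ j≤ = ≤-trans (≤-trans (≤-reflexive (cong (1 ∸_) (sym (m≤n⇒m∸n≡0 (≤-trans j≤
                  (≤-reflexive (trans (∑-cong (q (length τ)) λ i _ → sym (bits (enc (i ∷ τ))))
                    (cong (λ ℓ → ∑ (q ℓ) (λ i → bitAt W (child c i))) (sym (len-enc τ))))))))))
                  (m≤n+m _ (match j Y c))) (m≤n+m _ (1 ∸ bitAt W c))
        valid-W : 0 < valid j Y W
        valid-W = *-pos (≤-reflexive (sym (trans (bits j) (cong bit (roots refl))))) (all-pos W λ c _ → ok c)
        guard-pos : ∀ {v x} → 0 < v → 0 < guard v (suc x)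
        guard-pos {suc v} _ = z<s
        found : ∃[ v ] attempt j W ≡ suc v
        found = latch-some (fromBits-bound f (R j)) (guard-pos valid-W)
        finish : ∃[ v ] latch (attempt j) (suc W) ≡ suc v → ∃[ Y ] ∃[ s ] θ j s ≡ suc Y
        finish (v , eq) = v , suc W , eq

      θ-mono : ∀ {j s t Y} → s ≤ t → θ j s ≡ suc Y → θ j t ≡ suc Y
      θ-mono s≤t = latch-mono s≤t

-- Semimeasures given by enumerated dyadic weights.

module Dyadic where

  open import Axiom.ExcludedMiddle using (ExcludedMiddle)
  open import Data.Bool.Base using (true; false)
  open import Data.Fin.Patterns using (0F; 1F; 2F; 3F)
  import Data.Integer.Base as ℤ
  import Data.Integer.Solver as ℤSolver
  open import Data.List.Base using ([]; _∷ʳ_)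
  open import Data.Nat.Base as ℕ using (ℕ; zero; suc; z≤n; s≤s; z<s)
  import Data.Nat.Properties as ℕP
  open import Data.Product.Base using (∃-syntax; _,_)
  open import Data.Rational.Base
  open import Data.Rational.Properties
  import Data.Rational.Unnormalised.Base as ℚᵘ
  import Data.Rational.Unnormalised.Properties as ℚᵘP
  open import Data.Sum.Base using (inj₁; inj₂)
  open import Data.Vec.Base using ([]; _∷_; lookup)
  open import Data.Vec.Relation.Unary.All using ([]; _∷_)
  open import Level using (0ℓ)
  open import Relation.Binary.PropositionalEquality
  open import Relation.Nullary.Decidable.Core using (yes; no; does)
  open import Relation.Nullary.Negation using (contradiction)
  import Defs
  open import Defs using (2^-_; 0≤2^-; halves; interchange; ℝ; mkℝ; Str; ⌜_⌝; bit; Semimeasure; LeftRE;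
    Computableℚ)
  open Computability
  open Simulation using (uniform-<)

  times : ℕ → ℚ → ℚ
  times zero    x = 0ℚ
  times (suc k) x = x + times k x

  times-+ : ∀ k l x → times (k ℕ.+ l) x ≡ times k x + times l x
  times-+ zero    l x = sym (+-identityˡ (times l x))
  times-+ (suc k) l x = trans (cong (x +_) (times-+ k l x)) (sym (+-assoc x (times k x) (times l x)))

  times-1 : ∀ x → times 1 x ≡ x
  times-1 = +-identityʳ

  times-nonneg : ∀ k {x} → 0ℚ ≤ x → 0ℚ ≤ times k x
  times-nonneg zero    p = ≤-refl
  times-nonneg (suc k) p = +-mono-≤ p (times-nonneg k p)

  times-monoˡ : ∀ {k l x} → 0ℚ ≤ x → k ℕ.≤ l → times k x ≤ times l x
  times-monoˡ {l = l} p z≤n       = times-nonneg l p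
  times-monoˡ {x = x} p (s≤s k≤l) = +-monoʳ-≤ x (times-monoˡ p k≤l)

  times-double : ∀ k {x y} → x + x ≡ y → times (k ℕ.+ k) x ≡ times k y
  times-double k {x} {y} eq = trans (times-+ k k x) (sym (trans (cong (times k) (sym eq)) (dist k)))
    where
    dist : ∀ k → times k (x + x) ≡ times k x + times k x
    dist zero    = refl
    dist (suc k) = trans (cong ((x + x) +_) (dist k)) (interchange x x (times k x) (times k x))

  x≤x+y : ∀ {x y} → 0ℚ ≤ y → x ≤ x + y
  x≤x+y {x} p = ≤-trans (≤-reflexive (sym (+-identityʳ x))) (+-monoʳ-≤ x p)

  private
    /-+ : ∀ i j d → (i / suc d) + (j / suc d) ≡ (i ℤ.+ j) / suc d
    /-+ i j d = toℚᵘ-injective (begin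
      toℚᵘ (i / suc d + j / suc d)              ≈⟨ toℚᵘ-homo-+ (i / suc d) (j / suc d) ⟩
      toℚᵘ (i / suc d) ℚᵘ.+ toℚᵘ (j / suc d)    ≈⟨ ℚᵘP.+-cong (toℚᵘ-fromℚᵘ (ℚᵘ.mkℚᵘ i d)) (toℚᵘ-fromℚᵘ (ℚᵘ.mkℚᵘ j d)) ⟩
      ℚᵘ.mkℚᵘ i d ℚᵘ.+ ℚᵘ.mkℚᵘ j d              ≈⟨ ℚᵘ.*≡* (solve 3 (λ i j d → (i :* d :+ j :* d) :* d := (i :+ j) :* (d :* d)) refl i j (ℤ.+ suc d)) ⟩
      ℚᵘ.mkℚᵘ (i ℤ.+ j) d                       ≈⟨ toℚᵘ-fromℚᵘ (ℚᵘ.mkℚᵘ (i ℤ.+ j) d) ⟨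
      toℚᵘ ((i ℤ.+ j) / suc d)                  ∎)
      where
      open ℚᵘP.≃-Reasoning
      open ℤSolver.+-*-Solver

    half-/ : ∀ i d → (i / suc (d ℕ.+ suc d)) + (i / suc (d ℕ.+ suc d)) ≡ i / suc d
    half-/ i d = trans (/-+ i i (d ℕ.+ suc d)) (fromℚᵘ-cong {ℚᵘ.mkℚᵘ (i ℤ.+ i) (d ℕ.+ suc d)} {ℚᵘ.mkℚᵘ i d}
      (ℚᵘ.*≡* (solve 2 (λ i d → (i :+ i) :* d := i :* (d :+ d)) refl i (ℤ.+ suc d))))
      where
      open ℤSolver.+-*-Solver

    double-injective : ∀ {x y} → x + x ≡ y + y → x ≡ y
    double-injective {x} {y} eq = trans (halve x) (trans (cong (½ *_) eq) (sym (halve y)))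
      where
      halve : ∀ x → x ≡ ½ * (x + x)
      halve x = trans (sym (*-identityˡ x)) (trans (*-distribʳ-+ x ½ ½) (sym (*-distribˡ-+ ½ x x)))

    2^≡ : ∀ n → suc (2^ n ℕ.∸ 1) ≡ 2^ n
    2^≡ zero    = refl
    2^≡ (suc n) = trans (cong (λ m → suc (m ℕ.+ m ℕ.∸ 1)) (sym (2^≡ n))) (cong₂ ℕ._+_ (2^≡ n) (2^≡ n))

    unit-/ : ∀ n → ℤ.+ 1 / suc (2^ n ℕ.∸ 1) ≡ 2^- n
    unit-/ zero    = refl
    unit-/ (suc n) = double-injective (trans (cong (λ d → u d + u d) eq)
      (trans (half-/ (ℤ.+ 1) (2^ n ℕ.∸ 1)) (trans (unit-/ n) (sym (halves n)))))
      where
      u : ℕ → ℚ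
      u d = ℤ.+ 1 / suc d
      eq : 2^ (suc n) ℕ.∸ 1 ≡ (2^ n ℕ.∸ 1) ℕ.+ suc (2^ n ℕ.∸ 1)
      eq = trans (cong (λ m → m ℕ.+ m ℕ.∸ 1) (sym (2^≡ n))) refl

  -- The denominator 2^n is written as a successor, the form in which `Computableℚ` presents
  -- rationals.
  times-/ : ∀ k n → ℤ.+ k / suc (2^ n ℕ.∸ 1) ≡ times k (2^- n)
  times-/ zero    n = 0/n≡0 (suc (2^ n ℕ.∸ 1))
  times-/ (suc k) n = trans (sym (/-+ (ℤ.+ 1) (ℤ.+ k) (2^ n ℕ.∸ 1))) (cong₂ _+_ (unit-/ n) (times-/ k n))

  -- Partial sums of Σ h(j) 2^-(j+1)

  S : (ℕ → ℕ) → ℕ → ℚ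
  S h zero    = 0ℚ
  S h (suc n) = S h n + times (h n) (2^- suc n)

  S-cong-≤ : ∀ {g h} n → (∀ j → j ℕ.< n → g j ℕ.≤ h j) → S g n ≤ S h n
  S-cong-≤ zero    p = ≤-refl
  S-cong-≤ (suc n) p = +-mono-≤ (S-cong-≤ n λ j j<n → p j (ℕP.m<n⇒m<1+n j<n))
    (times-monoˡ (0≤2^- (suc n)) (p n ℕP.≤-refl))

  S-mono : ∀ {h m n} → m ℕ.≤ n → S h m ≤ S h n
  S-mono {h} {m} m≤n with ℕP.≤⇒≤′ m≤n
  ... | ℕ.≤′-refl = ≤-refl
  ... | ℕ.≤′-step {n} m≤′n =
        ≤-trans (S-mono (ℕP.≤′⇒≤ m≤′n)) (x≤x+y (times-nonneg (h n) (0≤2^- (suc n))))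

  S-nonneg : ∀ {h} n → 0ℚ ≤ S h n
  S-nonneg n = S-mono {n = n} z≤n

  S-+ : ∀ g h n → S (λ j → g j ℕ.+ h j) n ≡ S g n + S h n
  S-+ g h zero    = refl
  S-+ g h (suc n) = trans (cong₂ _+_ (S-+ g h n) (times-+ (g n) (h n) (2^- suc n)))
    (interchange (S g n) (S h n) (times (g n) (2^- suc n)) (times (h n) (2^- suc n)))

  S-term : ∀ {h j n} → 1 ℕ.≤ h j → j ℕ.< n → 2^- suc j ≤ S h n
  S-term {h} {j} 1≤h j<n = ≤-trans
    (≤-trans (≤-reflexive (sym (times-1 (2^- suc j)))) (times-monoˡ (0≤2^- (suc j)) 1≤h))
    (≤-trans (≤-trans (≤-reflexive (sym (+-identityˡ _))) (+-monoˡ-≤ _ (S-nonneg j))) (S-mono j<n))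

  S-ones : ∀ {h} → (∀ j → h j ≡ 1) → ∀ n → S h n + 2^- n ≡ 1ℚ
  S-ones     h≡1 zero    = refl
  S-ones {h} h≡1 (suc n) = trans (+-assoc (S h n) _ _)
    (trans (cong (S h n +_) (trans (cong (_+ 2^- suc n) (trans (cong (λ k → times k (2^- suc n)) (h≡1 n))
      (times-1 (2^- suc n)))) (halves n))) (S-ones h≡1 n))

  module _ {h : ℕ → ℕ} (h≤1 : ∀ j → h j ℕ.≤ 1) where

    private
      -- The right side adds weight 1 at every index from m on, and replacing such a 1 by the true
      -- weight can only lower the bound. So the partial sums themselves converge at the rate that
      -- `ℝ` prescribes.
      S-tail : ∀ {m n} → m ℕ.≤ n → S h n + 2^- n ≤ S h m + 2^- m
      S-tail {m} m≤n with ℕP.≤⇒≤′ m≤n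
      ... | ℕ.≤′-refl = ≤-refl
      ... | ℕ.≤′-step {n} m≤′n = ≤-trans (≤-trans (≤-reflexive (+-assoc (S h n) _ _)) (+-monoʳ-≤ (S h n)
            (≤-trans (+-monoˡ-≤ (2^- suc n) (≤-trans (times-monoˡ (0≤2^- (suc n)) (h≤1 n)) (≤-reflexive (times-1 (2^- suc n)))))
              (≤-reflexive (halves n))))) (S-tail (ℕP.≤′⇒≤ m≤′n))

    S-near : ∀ m n → S h n ≤ S h m + 2^- m
    S-near m n with ℕP.≤-total m n
    ... | inj₁ m≤n = ≤-trans (x≤x+y (0≤2^- n)) (S-tail m≤n)
    ... | inj₂ n≤m = ≤-trans (S-mono n≤m) (x≤x+y (0≤2^- m))

    S≤1 : ∀ n → S h n ≤ 1ℚ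
    S≤1 = S-near 0

    ∑2^- : ℝ
    ∑2^- = mkℝ (S h) λ m n → near (S h m) (S h n) (S-near n m) (S-near m n) (0≤2^- m) (0≤2^- n)
      where
      sub : ∀ x y {a} → x ≤ y + a → x - y ≤ a
      sub x y {a} p = ≤-trans (+-monoˡ-≤ (- y) p) (≤-reflexive
        (trans (cong (_- y) (+-comm y a)) (trans (+-assoc a y (- y))
          (trans (cong (a +_) (+-inverseʳ y)) (+-identityʳ a)))))
      flip-sub : ∀ x y → - (x - y) ≡ y - x
      flip-sub x y = trans (neg-distrib-+ x (- y)) (trans (cong (- x +_) (neg-involutive y)) (+-comm (- x) y))
        where
        neg-involutive : ∀ y → - (- y) ≡ y
        neg-involutive y = solve 1 (λ y → :- (:- y) := y) refl y
          where
          open import Data.Rational.Solver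
          open +-*-Solver
      near : ∀ x y {a b} → x ≤ y + b → y ≤ x + a → 0ℚ ≤ a → 0ℚ ≤ b → ∣ x - y ∣ ≤ a + b
      near x y {a} {b} p q 0≤a 0≤b with ∣p∣≡p∨∣p∣≡-p (x - y)
      ... | inj₁ eq = ≤-trans (≤-reflexive eq) (≤-trans (sub x y p)
                        (≤-trans (x≤x+y 0≤a) (≤-reflexive (+-comm b a))))
      ... | inj₂ eq = ≤-trans (≤-reflexive (trans eq (flip-sub x y))) (≤-trans (sub y x q) (x≤x+y 0≤b))

  module _ (em : ExcludedMiddle 0ℓ) (hit : ℕ → ℕ → ℕ → ℕ)
           (hitᶜ : Rec {3} (λ xs → hit (lookup xs 0F) (lookup xs 1F) (lookup xs 2F)))
           (hit≤1 : ∀ i j s → hit i j s ℕ.≤ 1)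
           (hit-mono : ∀ i j {s t} → s ℕ.≤ t → hit i j s ℕ.≤ hit i j t) where

    Hit : ℕ → ℕ → Set
    Hit i j = ∃[ s ] 0 ℕ.< hit i j s

    -- The truth value of an existential statement, hence not computable in general; `hit`
    -- approximates it from below in stages.
    weight : ℕ → ℕ → ℕ
    weight i j = bit (does (em {Hit i j}))

    weight≤1 : ∀ i j → weight i j ℕ.≤ 1
    weight≤1 i j with em {Hit i j}
    ... | yes _ = ℕP.≤-refl
    ... | no _  = z≤n

    Hit⇒weight : ∀ {i j} → Hit i j → weight i j ≡ 1
    Hit⇒weight {i} {j} h with em {Hit i j}
    ... | yes _ = refl
    ... | no ¬h = contradiction h ¬h

    hit≤weight : ∀ i j s → hit i j s ℕ.≤ weight i j
    hit≤weight i j s with em {Hit i j} | hit≤1 i j s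
    ... | yes _ | le = le
    ... | no ¬h | le with hit i j s in eq
    ...   | zero  = z≤n
    ...   | suc _ = contradiction (s , subst (0 ℕ.<_) (sym eq) z<s) ¬h

    limit : Str → ℝ
    limit σ = ∑2^- (weight≤1 ⌜ σ ⌝)

    -- Superadditivity holds index by index. The first hypothesis gives the empty string every
    -- weight 2^-(j+1), so its value is exactly 1.
    limit-semimeasure : (∀ j → Hit 0 j) →
      (∀ σ j → weight ⌜ σ ∷ʳ false ⌝ j ℕ.+ weight ⌜ σ ∷ʳ true ⌝ j ℕ.≤ weight ⌜ σ ⌝ j) →
      Semimeasure limit
    limit-semimeasure root disjoint = record
      { nonneg = λ σ n → ≤-trans (S-nonneg n) (x≤x+y (slack n))
      ; ≤one   = λ σ n → ≤-trans (S≤1 (weight≤1 ⌜ σ ⌝) n) (x≤x+y (slack n))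
      ; root   = (λ n → ≤-trans (S≤1 (weight≤1 0) n) (x≤x+y (slack n))) ,
                 (λ n → ≤-trans (≤-reflexive (sym (S-ones (λ j → Hit⇒weight (root j)) n)))
                          (+-monoʳ-≤ (S (weight 0) n) (x≤x+y (0≤2^- n))))
      ; superadditive = λ σ n →
          ≤-trans (≤-reflexive (sym (S-+ (weight ⌜ σ ∷ʳ false ⌝) (weight ⌜ σ ∷ʳ true ⌝) (suc n))))
            (≤-trans (S-cong-≤ (suc n) λ j _ → disjoint σ j)
              (≤-trans (S-near (weight≤1 ⌜ σ ⌝) n (suc n)) (+-monoʳ-≤ (S (weight ⌜ σ ⌝) n) (x≤x+y (0≤2^- n)))))
      }
      where
      slack : ∀ n → 0ℚ ≤ 2^- n + 2^- n
      slack n = +-mono-≤ (0≤2^- n) (0≤2^- n)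

    private
      -- Horner's scheme for the binary fraction whose digits are the hits at stage s; the
      -- denominator is 2^s.
      numerator : ℕ → ℕ → ℕ
      numerator i s = natrec 0 (λ j a → a ℕ.+ a ℕ.+ hit i j s) s

      approx : ℕ → ℕ → ℚ
      approx i s = S (λ j → hit i j s) s

      approx-≡ : ∀ i s n → ℤ.+ natrec 0 (λ j a → a ℕ.+ a ℕ.+ hit i j s) n / suc (2^ n ℕ.∸ 1) ≡ S (λ j → hit i j s) n
      approx-≡ i s zero    = refl
      approx-≡ i s (suc n) = trans (times-/ (a ℕ.+ a ℕ.+ hit i n s) (suc n))
        (trans (times-+ (a ℕ.+ a) (hit i n s) (2^- suc n)) (cong (_+ times (hit i n s) (2^- suc n))
          (trans (times-double a (halves n)) (trans (sym (times-/ a n)) (approx-≡ i s n)))))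
        where
        a = natrec 0 (λ j a → a ℕ.+ a ℕ.+ hit i j s) n

      approx-computable : Computableℚ approx
      approx-computable = numerator , (λ _ _ → 0) , (λ _ s → 2^ s ℕ.∸ 1) ,
        (code num , λ i s → computes num (i ∷ s ∷ [])) ,
        (code {2} (const 0) , λ i s → computes (const 0) (i ∷ s ∷ [])) ,
        (code den , λ i s → computes den (i ∷ s ∷ [])) ,
        λ i s → sym (approx-≡ i s s)
        where
        num : Rec {2} (λ xs → numerator (lookup xs 0F) (lookup xs 1F))
        num = natrecᶜ (const 0) ((var 1F +ᶜ var 1F) +ᶜ compᶜ hitᶜ (var 2F ∷ var 0F ∷ var 3F ∷ [])) (var 1F)
        den : Rec {2} (λ xs → 2^ (lookup xs 1F) ℕ.∸ 1)
        den = 2^ᶜ (var 1F) ∸ᶜ const 1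

    limit-leftRE : LeftRE limit
    limit-leftRE = record
      { approx      = approx
      ; computable  = approx-computable
      ; increasing  = λ i s → ≤-trans (S-cong-≤ s λ j _ → hit-mono i j (ℕP.n≤1+n s))
                                (S-mono (ℕP.n≤1+n s))
      ; below       = λ σ s n → ≤-trans (S-cong-≤ s λ j _ → hit≤weight ⌜ σ ⌝ j s)
                        (≤-trans (S-near (weight≤1 ⌜ σ ⌝) n s) (+-monoʳ-≤ (S (weight ⌜ σ ⌝) n) (x≤x+y (0≤2^- n))))
      ; convergence = convergence
      }
      where
      -- Indices from k on weigh at most 2^-k together, and the finitely many hits below k have all
      -- occurred by a common stage.
      convergence : ∀ σ k → ∃[ s ] limit σ Defs.≤ Defs.fromℚ (approx ⌜ σ ⌝ s + 2^- k)
      convergence σ k with uniform-< {λ j s → weight i j ℕ.≤ hit i j s} k decided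
        where
        i = ⌜ σ ⌝
        decided : ∀ j → j ℕ.< k → ∃[ ℓ ] ∀ s → ℓ ℕ.≤ s → weight i j ℕ.≤ hit i j s
        decided j _ with em {Hit i j}
        ... | yes (t , 0<hit) = t , λ s t≤s → ℕP.≤-trans 0<hit (hit-mono i j t≤s)
        ... | no _            = 0 , λ _ _ → z≤n
      ... | ℓ , p = ℓ ℕ.⊔ k , λ n → ≤-trans (S-near (weight≤1 ⌜ σ ⌝) k n)
        (≤-trans (+-monoˡ-≤ (2^- k) (≤-trans (S-cong-≤ k λ j j<k → p j j<k (ℓ ℕ.⊔ k) (ℕP.m≤m⊔n ℓ k))
          (S-mono (ℕP.m≤n⊔m ℓ k)))) (x≤x+y (+-mono-≤ (0≤2^- n) (0≤2^- n))))

-- Inequalities between reals up to vanishing errors.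

module RealBounds where

  import Data.Integer.Base as ℤ
  import Data.Integer.Properties as ℤP
  open import Data.List.Base using ([]; _∷_; map)
  open import Data.List.Membership.Propositional using (_∈_)
  open import Data.List.Relation.Unary.Any using (here; there)
  open import Data.Nat.Base as ℕ using (ℕ; zero; suc; z≤n; s≤s)
  import Data.Nat.Properties as ℕP
  open import Data.Product.Base using (∃-syntax; _×_; _,_; proj₂)
  open import Data.Rational.Base
  open import Data.Rational.Properties
  import Data.Rational.Solver as ℚSolver
  import Data.Rational.Unnormalised.Base as ℚᵘ
  import Data.Rational.Unnormalised.Properties as ℚᵘP
  open import Data.Sum.Base using (inj₁; inj₂)
  open import Function.Base using (_∘_)
  open import Relation.Binary.PropositionalEquality
  open import Relation.Nullary.Negation using (¬_)
  import Defs
  open Defs using (2^-_; 0≤2^-; halves; interchange; ℝ; seq; regular; fromℚ; fromℕ; 0ℝ; _·_; UniformlyComputable; Computable₂)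
  open Dyadic using (times; times-+; times-1; times-monoˡ; times-/; x≤x+y)

  0<2^- : ∀ n → 0ℚ < 2^- n
  0<2^- zero    = positive⁻¹ 1ℚ
  0<2^- (suc n) = subst (_< ½ * (2^- n)) (*-zeroʳ ½) (*-monoʳ-<-pos ½ (0<2^- n))

  2^-step : ∀ n → 2^- suc n ≤ 2^- n
  2^-step n = ≤-trans (x≤x+y (0≤2^- (suc n))) (≤-reflexive (halves n))

  2^-antitone : ∀ {m n} → m ℕ.≤ n → 2^- n ≤ 2^- m
  2^-antitone m≤n with ℕP.≤⇒≤′ m≤n
  ... | ℕ.≤′-refl          = ≤-refl
  ... | ℕ.≤′-step {n} m≤′n = ≤-trans (2^-step n) (2^-antitone (ℕP.≤′⇒≤ m≤′n))

  times-monoʳ : ∀ k {x y} → x ≤ y → times k x ≤ times k y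
  times-monoʳ zero    p = ≤-refl
  times-monoʳ (suc k) p = +-mono-≤ p (times-monoʳ k p)

  times-cancel-≤ : ∀ k l {x} → 0ℚ < x → times k x ≤ times l x → k ℕ.≤ l
  times-cancel-≤ k l {x} 0<x p = ℕP.≮⇒≥ λ l<k → <-irrefl refl (<-≤-trans (strict 0<x l<k) p)
    where
    strict : ∀ {l k x} → 0ℚ < x → l ℕ.< k → times l x < times k x
    strict {l} {x = x} 0<x l<k = <-≤-trans
      (≤-<-trans (≤-reflexive (sym (+-identityˡ (times l x)))) (+-monoˡ-< (times l x) 0<x))
      (times-monoˡ (<⇒≤ 0<x) l<k)

  -- This is k ≤ 2^k, scaled.
  times-2^- : ∀ k u → times k (2^- (k ℕ.+ u)) ≤ 2^- u
  times-2^- zero    u = 0≤2^- u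
  times-2^- (suc k) u = ≤-trans
    (+-mono-≤ (2^-antitone {suc u} (s≤s (ℕP.m≤n+m u k))) (doubled k (times-2^- k u)))
    (≤-reflexive (halves u))
    where
    halve : ∀ k x → times k (½ * x) ≡ ½ * times k x
    halve zero    x = sym (*-zeroʳ ½)
    halve (suc k) x = trans (cong (½ * x +_) (halve k x)) (sym (*-distribˡ-+ ½ x (times k x)))
    doubled : ∀ k {x y} → times k x ≤ y → times k (½ * x) ≤ ½ * y
    doubled k {x} p = ≤-trans (≤-reflexive (halve k x)) (*-monoˡ-≤-nonNeg ½ p)

  -- Upper bounds by rationals up to an error that tends to zero
  Below : ℝ → ℚ → Set
  Below x a = ∃[ κ ] ∀ n → seq x n ≤ a + times κ (2^- n)

  ≤⇒Below : ∀ {x a} → x Defs.≤ fromℚ a → Below x a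
  ≤⇒Below {x} {a} p = 2 , λ n → ≤-trans (p n)
    (≤-reflexive (cong (λ y → a + ((2^- n) + y)) (sym (times-1 (2^- n)))))

  private
    open ℚSolver.+-*-Solver using (solve; _:+_; _:-_; _:=_; :-_)

    drop-nonneg : ∀ {x y a b} → x + y ≤ a → 0ℚ ≤ y + b → x ≤ a + b
    drop-nonneg {x} {y} {a} {b} p q = ≤-trans
      (≤-trans (x≤x+y q) (≤-reflexive (sym (+-assoc x y b)))) (+-monoˡ-≤ b p)

    near : ∀ x m n → seq x m ≤ seq x n + (2^- m + 2^- n)
    near x m n = ≤-trans (≤-reflexive (lem (seq x m) (seq x n)))
      (+-monoʳ-≤ (seq x n) (≤-trans (p≤∣p∣ (seq x m - seq x n)) (regular x m n)))
      where
      lem : ∀ a b → a ≡ b + (a - b)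
      lem = solve 2 (λ a b → a := b :+ (a :- b)) refl
      p≤∣p∣ : ∀ p → p ≤ ∣ p ∣
      p≤∣p∣ p with ≤-total 0ℚ p
      ... | inj₁ 0≤p = ≤-reflexive (sym (0≤p⇒∣p∣≡p 0≤p))
      ... | inj₂ p≤0 = ≤-trans p≤0 (0≤∣p∣ p)

    -- Real addition reads its summands at the next index, so bounds on them arrive shifted by one.
    -- Regularity shifts them back at the cost of two more units of error.
    below-shift : ∀ x {a κ} → (∀ n → seq x (suc n) ≤ a + times κ (2^- n)) → Below x a
    below-shift x {a} {κ} h = κ ℕ.+ 2 , λ n → ≤-trans (near x n (suc n))
      (≤-trans (+-mono-≤ (h n) (+-monoʳ-≤ (2^- n) (≤-trans (2^-step n) (≤-reflexive (sym (times-1 (2^- n)))))))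
        (≤-reflexive (trans (+-assoc a _ _) (cong (a +_) (sym (times-+ κ 2 (2^- n)))))))

  summandˡ : ∀ {x y a} → 0ℝ Defs.≤ y → Below (x Defs.+ y) a → Below x a
  summandˡ {x} {y} {a} 0≤y (κ , h) = below-shift x {a} {κ ℕ.+ 1} λ n →
    ≤-trans (drop-nonneg (h n) (≤-trans (0≤y (suc n)) (+-monoʳ-≤ (seq y (suc n)) (≤-reflexive (halves n)))))
      (≤-reflexive (trans (+-assoc a _ _) (cong (a +_)
        (trans (cong (times κ (2^- n) +_) (sym (times-1 (2^- n)))) (sym (times-+ κ 1 (2^- n)))))))

  summandʳ : ∀ {x y a} → 0ℝ Defs.≤ x → Below (x Defs.+ y) a → Below y a
  summandʳ {x} {y} {a} 0≤x (κ , h) = summandˡ {y} {x} {a} 0≤x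
    (κ , λ n → ≤-trans (≤-reflexive (+-comm (seq y (suc n)) (seq x (suc n)))) (h n))

  +-nonneg : ∀ {x y} → 0ℝ Defs.≤ x → 0ℝ Defs.≤ y → 0ℝ Defs.≤ x Defs.+ y
  +-nonneg {x} {y} p q n = ≤-trans (+-mono-≤ (p (suc n)) (q (suc n))) (≤-reflexive
    (trans (interchange (seq x (suc n)) _ (seq y (suc n)) _)
      (cong ((seq x (suc n) + seq y (suc n)) +_) (cong₂ _+_ (halves n) (halves n)))))

  module _ {A : Set} (f : A → ℝ) (f≥0 : ∀ σ → 0ℝ Defs.≤ f σ) where

    sum-nonneg : ∀ L → 0ℝ Defs.≤ Defs.sum (map f L)
    sum-nonneg []      n = x≤x+y (+-mono-≤ (0≤2^- n) (0≤2^- n))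
    sum-nonneg (σ ∷ L) = +-nonneg {f σ} {Defs.sum (map f L)} (f≥0 σ) (sum-nonneg L)

    member-below : ∀ {L σ a} → σ ∈ L → Below (Defs.sum (map f L)) a → Below (f σ) a
    member-below {σ ∷ L} {a = a} (here refl) b = summandˡ {f σ} {Defs.sum (map f L)} {a} (sum-nonneg L) b
    member-below {τ ∷ L} {a = a} (there σ∈L) b =
      member-below {a = a} σ∈L (summandʳ {f τ} {Defs.sum (map f L)} {a} (f≥0 τ) b)

  ·-below : ∀ c {x a} → Below x a → Below (c · x) (times c a)
  ·-below zero    b       = 0 , λ n → ≤-refl
  ·-below (suc c) {x} {a} (κ , h) with ·-below c {x} {a} (κ , h)
  ... | κ′ , h′ = κ ℕ.+ κ′ , λ n → ≤-trans (+-mono-≤ (h (suc n)) (h′ (suc n)))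
    (≤-trans (≤-reflexive (interchange a _ (times c a) _)) (+-monoʳ-≤ (a + times c a)
      (≤-trans (≤-reflexive (sym (times-+ κ κ′ (2^- suc n)))) (times-monoʳ (κ ℕ.+ κ′) (2^-step n)))))

  -- A weight of 2^-(j+1) exceeds c 2^-2j as soon as j ≥ c + 3.
  weight-exceeds : ∀ {x y c j} → c ℕ.+ 3 ℕ.≤ j → (∀ n → j ℕ.< n → 2^- suc j ≤ seq y n) →
    y Defs.≤ c · x → ¬ Below x (2^- (j ℕ.+ j))
  weight-exceeds {x} {y} {c} {j} c≤j heavy y≤cx b with ·-below c {x} {2^- (j ℕ.+ j)} b
  ... | κ , h = <-irrefl refl (<-≤-trans positive-gap (≤-trans (heavy n j<n)
      (≤-trans (y≤cx n) (≤-trans (+-monoˡ-≤ _ (h n)) le))))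
    where
    -- At this index the accumulated error (κ + 2) 2^-n is at most 2^-(3+j), as is c 2^-2j. Together
    -- they stay within 2^-(2+j), half of the weight.
    n = (κ ℕ.+ 2) ℕ.+ (3 ℕ.+ j)
    j<n : j ℕ.< n
    j<n = ℕP.≤-trans (ℕP.m≤n+m (suc j) 2) (ℕP.m≤n+m _ (κ ℕ.+ 2))
    small : times c (2^- (j ℕ.+ j)) ≤ 2^- (3 ℕ.+ j)
    small = ≤-trans (times-monoʳ c (2^-antitone {c ℕ.+ (3 ℕ.+ j)}
              (ℕP.≤-trans (ℕP.≤-reflexive (sym (ℕP.+-assoc c 3 j))) (ℕP.+-monoˡ-≤ j c≤j))))
              (times-2^- c (3 ℕ.+ j))
    le : times c (2^- (j ℕ.+ j)) + times κ (2^- n) + (2^- n + 2^- n) ≤ 2^- (2 ℕ.+ j)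
    le = ≤-trans (≤-reflexive (trans (+-assoc (times c (2^- (j ℕ.+ j))) (times κ (2^- n)) _) (cong (times c (2^- (j ℕ.+ j)) +_)
           (trans (cong (λ z → times κ (2^- n) + (2^- n + z)) (sym (times-1 (2^- n)))) (sym (times-+ κ 2 (2^- n)))))))
         (≤-trans (+-mono-≤ small (times-2^- (κ ℕ.+ 2) (3 ℕ.+ j))) (≤-reflexive (halves (2 ℕ.+ j))))
    positive-gap : 2^- (2 ℕ.+ j) < 2^- suc j
    positive-gap = <-≤-trans (≤-<-trans (≤-reflexive (sym (+-identityˡ _))) (+-monoˡ-< (2^- (2 ℕ.+ j)) (0<2^- (2 ℕ.+ j))))
      (≤-reflexive (halves (suc j)))

  nat : ∀ k → ℤ.+ k / 1 ≡ times k 1ℚ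
  nat k = times-/ k 0

  nat-cancel-≤ : ∀ {k l} → ℤ.+ k / 1 ≤ ℤ.+ l / 1 → k ℕ.≤ l
  nat-cancel-≤ {k} {l} p = times-cancel-≤ k l (positive⁻¹ 1ℚ) (subst₂ _≤_ (nat k) (nat l) p)

  nat-mono-≤ : ∀ {k l} → k ℕ.≤ l → ℤ.+ k / 1 ≤ ℤ.+ l / 1
  nat-mono-≤ {k} {l} k≤l = subst₂ _≤_ (sym (nat k)) (sym (nat l)) (times-monoˡ (<⇒≤ (positive⁻¹ 1ℚ)) k≤l)

  ⊖/-≤ : ∀ a b d → (a ℤ.⊖ b) / suc d ≤ ℤ.+ a / 1
  ⊖/-≤ a b d = toℚᵘ-cancel-≤ (begin
    toℚᵘ ((a ℤ.⊖ b) / suc d)   ≃⟨ toℚᵘ-fromℚᵘ (ℚᵘ.mkℚᵘ (a ℤ.⊖ b) d) ⟩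
    ℚᵘ.mkℚᵘ (a ℤ.⊖ b) d        ≤⟨ ℚᵘ.*≤* le ⟩
    ℚᵘ.mkℚᵘ (ℤ.+ a) 0          ≃⟨ toℚᵘ-fromℚᵘ (ℚᵘ.mkℚᵘ (ℤ.+ a) 0) ⟨
    toℚᵘ (ℤ.+ a / 1)           ∎)
    where
    open ℚᵘP.≤-Reasoning
    le : (a ℤ.⊖ b) ℤ.* ℤ.+ 1 ℤ.≤ ℤ.+ a ℤ.* ℤ.+ suc d
    le = ℤP.≤-trans (ℤP.≤-reflexive (ℤP.*-identityʳ (a ℤ.⊖ b)))
      (ℤP.≤-trans (ℤP.m⊖n≤m a b) (ℤP.≤-trans (ℤ.+≤+ (ℕP.m≤m*n a (suc d))) (ℤP.≤-reflexive (ℤP.pos-* a (suc d)))))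

  -- The values of `r` are given only through rational approximations (a - b)/(d + 1), each at most
  -- a. The constant 3 is the precision 2^-0 plus the slack 2 · 2^-0 of the order at index 0.
  computable-bound : ∀ {r} → UniformlyComputable (fromℕ ∘ r) →
    ∃[ a ] Computable₂ a × (∀ i → r i ℕ.≤ 3 ℕ.+ a i 0)
  computable-bound {r} (f , (a , b , d , ca , _ , _ , f≡) , approx) = a , ca , λ i →
    nat-cancel-≤ (≤-trans (proj₂ (approx i 0) 0) (≤-trans
      (+-monoˡ-≤ (1ℚ + 1ℚ) (+-monoˡ-≤ 1ℚ (≤-trans (≤-reflexive (f≡ i 0)) (⊖/-≤ (a i 0) (b i 0) (d i 0)))))
      (≤-reflexive (trans (cong (λ z → z + 1ℚ + (1ℚ + 1ℚ)) (nat (a i 0)))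
        (trans (solve 2 (λ x y → x :+ y :+ (y :+ y) := y :+ (y :+ (y :+ x))) refl (times (a i 0) 1ℚ) 1ℚ)
          (sym (nat (3 ℕ.+ a i 0))))))))

-- The semimeasure of predicted outputs, and its conflict with depth.

module Prediction where

  open import Axiom.ExcludedMiddle using (ExcludedMiddle)
  open import Data.Bool.Base using (true; false)
  open import Data.Fin.Patterns using (0F; 1F; 2F; 3F; 4F)
  open import Data.List.Base using ([]; _∷_; _∷ʳ_; length; map; applyUpTo)
  open import Data.List.Properties using (applyUpTo-∷ʳ; length-applyUpTo; length-++; ∷ʳ-injective)
  open import Data.Nat.Base hiding (parity)
  open import Data.Nat.Properties
  open import Data.Nat.Solver using (module +-*-Solver)
  open import Data.Product.Base using (∃-syntax; _×_; _,_; proj₁; proj₂)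
  import Data.Rational.Base as ℚ
  open import Data.Sum.Base using (_⊎_; inj₁; inj₂)
  open import Data.Vec.Base using (lookup; []; _∷_)
  open import Data.Vec.Relation.Unary.All using ([]; _∷_)
  open import Function.Base using (_∘_)
  open import Function.Bundles using (Equivalence)
  open import Level using (0ℓ)
  open import Relation.Binary.PropositionalEquality
  open import Relation.Nullary.Decidable.Core using (yes; no)
  open import Relation.Nullary.Negation using (¬_; contradiction)
  open import Relation.Unary using (Pred)
  open import Defs using (2^-_; ℝ; seq; Str; ⌜_⌝; bit; Code; Cantor; _↾ˢ_; Deep; OrderFunction; Semimeasure;
    UniversalLeftRESemimeasure)
  open Computability
  open Arithmetic
  open Simulation using (guard; guardᶜ; predᶜ)
  open Bushy
  open Search
  open Dyadic
  open RealBounds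

  -- Codes of binary strings

  ⌜∷⌝ : ∀ b σ → ⌜ b ∷ σ ⌝ ≡ suc (bitCons b ⌜ σ ⌝)
  ⌜∷⌝ false σ = cong (λ m → suc (⌜ σ ⌝ + m)) (+-identityʳ ⌜ σ ⌝)
  ⌜∷⌝ true  σ = cong (λ m → suc (suc (⌜ σ ⌝ + m))) (+-identityʳ ⌜ σ ⌝)

  ⌜⌝-injective : ∀ {σ τ} → ⌜ σ ⌝ ≡ ⌜ τ ⌝ → σ ≡ τ
  ⌜⌝-injective {[]}    {[]}    eq = refl
  ⌜⌝-injective {[]}    {b ∷ τ} eq = contradiction (trans eq (⌜∷⌝ b τ)) λ ()
  ⌜⌝-injective {b ∷ σ} {[]}    eq = contradiction (trans (sym (⌜∷⌝ b σ)) eq) λ ()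
  ⌜⌝-injective {b ∷ σ} {c ∷ τ} eq = cong₂ _∷_
    (bit-injective (trans (sym (parity-bitCons b ⌜ σ ⌝)) (trans (cong parity eq′) (parity-bitCons c ⌜ τ ⌝))))
    (⌜⌝-injective (trans (sym (half-bitCons b ⌜ σ ⌝)) (trans (cong half eq′) (half-bitCons c ⌜ τ ⌝))))
    where
    eq′ : bitCons b ⌜ σ ⌝ ≡ bitCons c ⌜ τ ⌝
    eq′ = suc-injective (trans (sym (⌜∷⌝ b σ)) (trans eq (⌜∷⌝ c τ)))
    bit-injective : ∀ {b c} → bit b ≡ bit c → b ≡ c
    bit-injective {false} {false} _ = refl
    bit-injective {true}  {true}  _ = refl

  -- The coding is bijective base 2 with digits 1 and 2, least significant first, so an appended
  -- symbol becomes the leading digit.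
  ⌜∷ʳ⌝ : ∀ σ b → ⌜ σ ∷ʳ b ⌝ ≡ 2^ (length σ) * suc (bit b) + ⌜ σ ⌝
  ⌜∷ʳ⌝ []      false = refl
  ⌜∷ʳ⌝ []      true  = refl
  ⌜∷ʳ⌝ (c ∷ σ) b     = trans (⌜∷⌝ c (σ ∷ʳ b)) (trans (cong (suc ∘ bitCons c) (⌜∷ʳ⌝ σ b))
    (trans (arith (2^ (length σ)) (bit b) (bit c) ⌜ σ ⌝) (cong (2^ (suc (length σ)) * suc (bit b) +_) (sym (⌜∷⌝ c σ)))))
    where
    arith : ∀ p b c s → suc (c + ((p * suc b + s) + (p * suc b + s))) ≡ (p + p) * suc b + suc (c + (s + s))
    arith = solve 4 (λ p b c s →
      con 1 :+ (c :+ ((p :* (con 1 :+ b) :+ s) :+ (p :* (con 1 :+ b) :+ s)))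
        := (p :+ p) :* (con 1 :+ b) :+ (con 1 :+ (c :+ (s :+ s)))) refl
      where open +-*-Solver

  ⌜applyUpTo⌝ : ∀ f m → ⌜ applyUpTo f m ⌝ ≡ ∑ m (λ t → 2^ t * suc (bit (f t)))
  ⌜applyUpTo⌝ f zero    = refl
  ⌜applyUpTo⌝ f (suc m) = trans (cong ⌜_⌝ (sym (applyUpTo-∷ʳ f m)))
    (trans (⌜∷ʳ⌝ (applyUpTo f m) (f m)) (cong₂ (λ ℓ c → 2^ ℓ * suc (bit (f m)) + c)
      (length-applyUpTo f m) (⌜applyUpTo⌝ f m)))

  digits : ℕ → ℕ → Str
  digits m Y = applyUpTo (λ t → isPos (bitAt Y t)) m

  private
    digitsCode : ℕ → ℕ → ℕ
    digitsCode m Y = ∑ m (λ t → 2^ t * suc (bitAt Y t))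

    digitsCode≡ : ∀ m Y → digitsCode m Y ≡ ⌜ digits m Y ⌝
    digitsCode≡ m Y = trans
      (∑-cong m λ t _ → cong (λ b → 2^ t * suc b) (sym (bit-isPos (parity≤1 (iter half t Y)))))
      (sym (⌜applyUpTo⌝ _ m))

    sg≤1 : ∀ n → sg n ≤ 1
    sg≤1 zero    = z≤n
    sg≤1 (suc n) = ≤-refl

    sg-pos : ∀ {n} → 0 < n → 0 < sg n
    sg-pos {suc n} _ = z<s

    pos-sg : ∀ {n} → 0 < sg n → 0 < n
    pos-sg {suc n} _ = z<s

    sg-mono : ∀ {m n} → (0 < m → 0 < n) → sg m ≤ sg n
    sg-mono {zero}          h = z≤n
    sg-mono {suc m} {zero}  h = contradiction (h z<s) λ ()
    sg-mono {suc m} {suc n} h = ≤-refl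

  module _ (q : ℕ → ℕ) (qᶜ : Rec {1} (λ xs → q (lookup xs 0F)))
           (R : ℕ → ℕ) (Rᶜ : Rec {1} (λ xs → R (lookup xs 0F)))
           (e : Code 1 1) where

    private
      θₑ : ℕ → ℕ → ℕ
      θₑ = θ q qᶜ R Rᶜ e

    -- Index j puts its weight on the prefixes of the predicted string up to length `R j`, and on
    -- nothing longer.
    Prefix : ℕ → ℕ → ℕ → Set
    Prefix i j s = ∃[ Y ] ∃[ m ] θₑ j s ≡ suc Y × m ≤ R j × ⌜ digits m Y ⌝ ≡ i

    Prefix-mono : ∀ {i j s t} → s ≤ t → Prefix i j s → Prefix i j t
    Prefix-mono s≤t (Y , m , eqθ , rest) = Y , m , θ-mono q qᶜ R Rᶜ e s≤t eqθ , rest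

    abstract

      private
        test : ℕ → ℕ → ℕ → ℕ
        -- Code 0 is the empty string. It is hit at every index, also where no prediction is ever
        -- made, so that the semimeasure has value 1 at the root.
        test i j s = isEq i 0 + guard (θₑ j s) (∑ (suc (R j)) (λ m → isEq (digitsCode m (pred (θₑ j s))) i))

      hit : ℕ → ℕ → ℕ → ℕ
      hit i j s = sg (test i j s)

      hitᶜ : Rec {3} (λ xs → hit (lookup xs 0F) (lookup xs 1F) (lookup xs 2F))
      hitᶜ = sgᶜ (isEqᶜ (var 0F) (const 0) +ᶜ guardᶜ θᵢ (∑ᶜ (sucᶜ (ap₁ R Rᶜ (var 1F)))
          (isEqᶜ (∑ᶜ (var 0F) (2^ᶜ (var 0F) *ᶜ sucᶜ (bitAtᶜ (predᶜ (compᶜ (θᶜ q qᶜ R Rᶜ e) (var 3F ∷ var 4F ∷ []))) (var 0F))))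
            (var 1F))))
        where
        θᵢ : Rec {3} (λ xs → θₑ (lookup xs 1F) (lookup xs 2F))
        θᵢ = compᶜ (θᶜ q qᶜ R Rᶜ e) (var 1F ∷ var 2F ∷ [])

      hit⇒ : ∀ i j s → 0 < hit i j s → i ≡ 0 ⊎ Prefix i j s
      hit⇒ i j s p with cases (isEq i 0) (θₑ j s) (pos-sg {test i j s} p)
        where
        cases : ∀ a w → 0 < a + guard w (∑ (suc (R j)) (λ m → isEq (digitsCode m (pred w)) i)) →
          0 < a ⊎ ∃[ Y ] ∃[ m ] w ≡ suc Y × m ≤ R j × ⌜ digits m Y ⌝ ≡ i
        cases (suc a) w       p = inj₁ z<s
        cases zero    (suc Y) p with pos-∑ (suc (R j)) p
        ... | m , s≤s m≤R , found = inj₂ (Y , m , refl , m≤R , trans (sym (digitsCode≡ m Y)) (isEq⇒≡ found))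
      ... | inj₁ p′     = inj₁ (isEq⇒≡ p′)
      ... | inj₂ prefix = inj₂ prefix

      ⇒hit : ∀ i j s → i ≡ 0 ⊎ Prefix i j s → 0 < hit i j s
      ⇒hit i j s (inj₁ refl) = z<s
      ⇒hit i j s (inj₂ (Y , m , eqθ , m≤R , eq)) = sg-pos (≤-trans
        (≤-trans (≤-reflexive (sym (trans (cong (λ c → isEq c i) (trans (digitsCode≡ m Y) eq)) (isEq-refl i))))
          (term≤∑ (λ m → isEq (digitsCode m Y) i) (s≤s m≤R)))
        (≤-trans (≤-reflexive (cong (λ w → guard w (∑ (suc (R j)) (λ m → isEq (digitsCode m (pred w)) i))) (sym eqθ)))
          (m≤n+m _ (isEq i 0))))

      hit≤1 : ∀ i j s → hit i j s ≤ 1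
      hit≤1 i j s = sg≤1 (test i j s)

      hit-mono : ∀ i j {s t} → s ≤ t → hit i j s ≤ hit i j t
      hit-mono i j {s} {t} s≤t = sg-mono {test i j s} {test i j t} λ p → pos-sg {test i j t} (mono (hit⇒ i j s (sg-pos p)))
        where
        mono : i ≡ 0 ⊎ Prefix i j s → 0 < hit i j t
        mono (inj₁ i≡0) = ⇒hit i j t (inj₁ i≡0)
        mono (inj₂ p)   = ⇒hit i j t (inj₂ (Prefix-mono s≤t p))

    module _ (em : ExcludedMiddle 0ℓ) where

      private
        wt : ℕ → ℕ → ℕ
        wt = weight em hit hitᶜ hit≤1 hit-mono

      predicted : Str → ℝ
      predicted = limit em hit hitᶜ hit≤1 hit-mono

      private
        Hitₑ : ℕ → ℕ → Set
        Hitₑ i j = ∃[ s ] 0 < hit i j s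

        prefix-snoc : ∀ {σ b j s} → 0 < hit ⌜ σ ∷ʳ b ⌝ j s →
          ∃[ Y ] θₑ j s ≡ suc Y × length σ < R j × σ ∷ʳ b ≡ digits (suc (length σ)) Y
        prefix-snoc {σ} {b} {j} {s} p with hit⇒ ⌜ σ ∷ʳ b ⌝ j s p
        ... | inj₁ eq = contradiction (⌜⌝-injective {σ ∷ʳ b} {[]} eq) (snoc≢[] σ)
          where
          snoc≢[] : ∀ σ → σ ∷ʳ b ≢ []
          snoc≢[] []      ()
          snoc≢[] (x ∷ σ) ()
        ... | inj₂ (Y , m , eqθ , m≤R , eq) = Y , eqθ ,
                ≤-trans (≤-reflexive (sym m≡)) m≤R , trans (sym digits≡) (cong (λ k → digits k Y) m≡)
          where
          digits≡ : digits m Y ≡ σ ∷ʳ b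
          digits≡ = ⌜⌝-injective eq
          m≡ : m ≡ suc (length σ)
          m≡ = trans (sym (length-applyUpTo _ m)) (trans (cong length digits≡)
            (trans (length-++ σ) (+-comm (length σ) 1)))

        parent : ∀ σ b {j} → Hitₑ ⌜ σ ∷ʳ b ⌝ j → Hitₑ ⌜ σ ⌝ j
        parent σ b {j} (s , p) with prefix-snoc {σ} {b} {j} {s} p
        ... | Y , eqθ , ℓ<R , eq = s , ⇒hit ⌜ σ ⌝ j s (inj₂ (Y , length σ , eqθ , <⇒≤ ℓ<R ,
                cong ⌜_⌝ (sym (proj₁ (∷ʳ-injective σ _ (trans eq (sym (applyUpTo-∷ʳ _ (length σ)))))))))

        -- A prediction never changes once made. Comparing both stages at their maximum shows that
        -- they predict the same string, which has only one digit after σ.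
        exclusive : ∀ σ {j} → Hitₑ ⌜ σ ∷ʳ false ⌝ j → ¬ Hitₑ ⌜ σ ∷ʳ true ⌝ j
        exclusive σ {j} (s , p) (t , p′) with prefix-snoc {σ} {false} {j} {s} p | prefix-snoc {σ} {true} {j} {t} p′
        ... | Y , eqθ , _ , eq | Y′ , eqθ′ , _ , eq′ with trans
              (sym (θ-mono q qᶜ R Rᶜ e (m≤m⊔n s t) eqθ)) (θ-mono q qᶜ R Rᶜ e (m≤n⊔m s t) eqθ′)
        ...   | refl = contradiction (proj₂ (∷ʳ-injective σ σ (trans eq (sym eq′)))) λ ()

        disjoint : ∀ σ j → wt ⌜ σ ∷ʳ false ⌝ j + wt ⌜ σ ∷ʳ true ⌝ j ≤ wt ⌜ σ ⌝ j
        disjoint σ j with em {Hitₑ ⌜ σ ∷ʳ false ⌝ j} | em {Hitₑ ⌜ σ ∷ʳ true ⌝ j} | em {Hitₑ ⌜ σ ⌝ j}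
        ... | yes f | yes t | _     = contradiction t (exclusive σ f)
        ... | yes f | no _  | yes _ = ≤-refl
        ... | yes f | no _  | no ¬h = contradiction (parent σ false f) ¬h
        ... | no _  | yes t | yes _ = ≤-refl
        ... | no _  | yes t | no ¬h = contradiction (parent σ true t) ¬h
        ... | no _  | no _  | _     = z≤n

      predicted-heavy : ∀ {j s Y m} → θₑ j s ≡ suc Y → m ≤ R j →
        ∀ n → j < n → 2^- suc j ℚ.≤ seq (predicted (digits m Y)) n
      predicted-heavy {j} {s} {Y} {m} eqθ m≤R n j<n = S-term {wt ⌜ digits m Y ⌝} {j}
        (≤-reflexive (sym (Hit⇒weight em hit hitᶜ hit≤1 hit-mono
          (s , ⇒hit ⌜ digits m Y ⌝ j s (inj₂ (Y , m , eqθ , m≤R , refl)))))) j<n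

      dominated : ∀ {M} → UniversalLeftRESemimeasure M → ∃[ c ] ∀ σ → predicted σ Defs.≤ c Defs.· M σ
      dominated U = UniversalLeftRESemimeasure.universal U predicted
        (limit-semimeasure em hit hitᶜ hit≤1 hit-mono (λ j → 0 , ⇒hit 0 j 0 (inj₁ refl)) disjoint)
        (limit-leftRE em hit hitᶜ hit≤1 hit-mono)

  module _ (em : ExcludedMiddle 0ℓ) {M : Str → ℝ} (U : UniversalLeftRESemimeasure M)
           {P : Pred Cantor 0ℓ} (deep : Deep M P) where

    private
      r : ℕ → ℕ
      r = proj₁ deep
      bound = computable-bound {r} (OrderFunction.computable (proj₁ (proj₂ deep)))

      r₂ : ℕ → ℕ
      r₂ j = r (j + j)

      a₂ᶜ : Rec {2} (λ xs → proj₁ bound (lookup xs 0F) (lookup xs 1F))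
      a₂ᶜ = rec (proj₁ (proj₁ (proj₂ bound))) λ { (x ∷ y ∷ []) → proj₂ (proj₁ (proj₂ bound)) x y }

    opaque

      -- At length r(2j) the bound 2^-2j given by depth is far below the weight 2^-(j+1) of index j.
      depth : ℕ → ℕ
      depth j = 3 + proj₁ bound (j + j) 0

      depthᶜ : Rec {1} (λ xs → depth (lookup xs 0F))
      depthᶜ = const 3 +ᶜ ap₂ (proj₁ bound) a₂ᶜ (var 0F +ᶜ var 0F) (const 0)

      depth-bound : ∀ j → r₂ j ≤ depth j
      depth-bound j = proj₂ (proj₂ bound) (j + j)

    opaque

      -- The witness m is r(2j). Since `depth` only bounds r(2j) from above, the predicted string
      -- may be longer, but its prefixes carry the same weight of index j. If the prefix of length m
      -- extended to a member of `P`, its measure would be at most 2^-2j, contradicting domination.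
      -- The threshold c + 3 depends on `e` through the domination constant.
      forced-string : ∀ {q} → Rec {1} (λ xs → q (lookup xs 0F)) → ∀ e → ∃[ J ] ∀ {σ} → J ≤ enc σ →
        Big q (2^ (depth (enc σ)) * enc σ) (Converges e (depth (enc σ))) σ →
        ∃[ Y ] Big q (enc σ) (OutputsString e (depth (enc σ)) Y) σ ×
          ∃[ m ] m ≤ depth (enc σ) × ¬ (P ↾ˢ m) (digits m Y)
      forced-string {q} qᶜ e with dominated q qᶜ depth depthᶜ e em U
      ... | c , dom = c + 3 , λ {σ} J≤j big →
        let j = enc σ
            Y , s , eqθ = θ-complete q qᶜ depth depthᶜ e em {σ} big
            m≤ = depth-bound j
            L , (_ , enum) , sum≤ = proj₂ (proj₂ deep) (j + j)
            y = digits (r₂ j) Y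
        in Y , θ-sound q qᶜ depth depthᶜ e {σ} {s} eqθ , r₂ j , m≤ , λ y∈P →
             weight-exceeds {M y} {predicted q qᶜ depth depthᶜ e em y} J≤j
               (predicted-heavy q qᶜ depth depthᶜ e em {j} {s} {Y} {r₂ j} eqθ m≤) (dom y)
               (member-below M (Semimeasure.nonneg (UniversalLeftRESemimeasure.semimeasure U)) {a = 2^- (j + j)}
                 (Equivalence.from (enum y) y∈P) (≤⇒Below {Defs.sum (map M L)} {2^- (j + j)} sum≤))

-- A numbering of the oracle codes.

module Enumeration where

  open import Data.Fin.Base using (zero; suc; toℕ; fromℕ<)
  open import Data.Fin.Properties using (toℕ<n; fromℕ<-toℕ)
  open import Data.Nat.Base
  open import Data.Nat.Properties
  open import Data.Product.Base using (∃-syntax; _,_)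
  open import Data.Vec.Base using (Vec; []; _∷_)
  open import Relation.Binary.PropositionalEquality
  open import Relation.Nullary.Decidable.Core using (yes; no)
  open import Relation.Nullary.Negation using (contradiction)
  open import Defs using (Code; zero; succ; proj; oracle; comp; prec; μ)
  open Arithmetic using (child; pop; top; pop-child; top-child)

  private
    index  : ∀ {n} → Code 1 n → ℕ
    indexs : ∀ {m n} → Vec (Code 1 n) m → ℕ
    index zero              = child 0 0
    index succ              = child 0 1
    index (proj i)          = child (toℕ i) 2
    index (oracle _)        = child 0 3
    -- The intermediate arity m is stored because it cannot be recovered from the arity of the
    -- composition.
    index (comp {m} f gs)   = child (child (child m (index f)) (indexs gs)) 4
    index (prec f g)        = child (child (index f) (index g)) 5
    index (μ f)             = child (index f) 6
    indexs []               = 0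
    indexs (g ∷ gs)         = child (index g) (indexs gs)

    height  : ∀ {n} → Code 1 n → ℕ
    heights : ∀ {m n} → Vec (Code 1 n) m → ℕ
    height (comp f gs) = suc (height f ⊔ heights gs)
    height (prec f g)  = suc (height f ⊔ height g)
    height (μ f)       = suc (height f)
    height _           = 1
    heights []         = 0
    heights (g ∷ gs)   = height g ⊔ heights gs

    projection : ∀ n → ℕ → Code 1 n
    projection n i with i <? n
    ... | yes i<n = proj (fromℕ< i<n)
    ... | no _    = μ (proj zero)

    decode  : ℕ → (tag : ℕ) → ∀ n → (payload : ℕ) → Code 1 n
    decodes : ℕ → ∀ m n → ℕ → Vec (Code 1 n) m
    decode (suc f) 0 0       p = zero
    decode (suc f) 1 1       p = succ
    decode (suc f) 2 n       p = projection n p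
    decode (suc f) 3 1       p = oracle zero
    decode (suc f) 4 n       p =
      comp (decode f (top (top (pop p))) m (pop (top (pop p)))) (decodes f m n (top p))
      where m = pop (pop p)
    decode (suc f) 5 (suc n) p = prec (decode f (top (pop p)) n (pop (pop p)))
                                      (decode f (top (top p)) (2 + n) (pop (top p)))
    decode (suc f) 6 n       p = μ (decode f (top p) (suc n) (pop p))
    -- Malformed numbers and exhausted fuel give an arbitrary code of the right arity.
    decode _       _ n       _ = μ (proj zero)
    decodes f zero    n c = []
    decodes f (suc m) n c = decode f (top (pop c)) n (pop (pop c)) ∷ decodes f m n (top c)

    decode-at : ∀ f t n p → decode f (top (child p t)) n (pop (child p t)) ≡ decode f t n p
    decode-at f t n p = cong₂ (λ t → decode f t n) (top-child p t) (pop-child p t)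

    decode-index : ∀ {n} (e : Code 1 n) {f} → height e ≤ f → decode f (top (index e)) n (pop (index e)) ≡ e
    decodes-index : ∀ {m n} (gs : Vec (Code 1 n) m) {f} → heights gs ≤ f → decodes f m n (indexs gs) ≡ gs
    decode-index zero          {suc f} (s≤s _) = decode-at (suc f) 0 0 0
    decode-index succ          {suc f} (s≤s _) = decode-at (suc f) 1 1 0
    decode-index {n} (proj i)  {suc f} (s≤s _) = trans (decode-at (suc f) 2 n (toℕ i)) found
      where
      found : projection n (toℕ i) ≡ proj i
      found with toℕ i <? n
      ... | yes i<n = cong proj (fromℕ<-toℕ i i<n)
      ... | no i≮n  = contradiction (toℕ<n i) i≮n
    decode-index (oracle zero) {suc f} (s≤s _) = decode-at (suc f) 3 1 0
    decode-index {n} (comp {m} e gs) {suc f} (s≤s h) = trans (decode-at (suc f) 4 n (child (child m (index e)) (indexs gs))) (trans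
      (cong₂ (λ a b → comp (decode f (top (top a)) (pop a) (pop (top a))) (decodes f (pop a) n b))
        (pop-child (child m (index e)) (indexs gs)) (top-child (child m (index e)) (indexs gs)))
      (trans
        (cong₂ (λ k c → comp (decode f (top c) k (pop c)) (decodes f k n (indexs gs)))
          (pop-child m (index e)) (top-child m (index e)))
        (cong₂ comp (decode-index e (≤-trans (m≤m⊔n (height e) _) h))
                    (decodes-index gs (≤-trans (m≤n⊔m (height e) _) h)))))
    decode-index {suc n} (prec e g) {suc f} (s≤s h) = trans (decode-at (suc f) 5 (suc n) (child (index e) (index g))) (trans
      (cong₂ (λ a b → prec (decode f (top a) n (pop a)) (decode f (top b) (2 + n) (pop b)))
        (pop-child (index e) (index g)) (top-child (index e) (index g)))
      (cong₂ prec (decode-index e (≤-trans (m≤m⊔n (height e) _) h))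
                  (decode-index g (≤-trans (m≤n⊔m (height e) _) h))))
    decode-index {n} (μ e) {suc f} (s≤s h) = trans (decode-at (suc f) 6 n (index e)) (cong μ (decode-index e h))
    decodes-index []       h = refl
    decodes-index {suc m} {n} (g ∷ gs) {f} h = trans
      (cong₂ (λ a b → decode f (top a) n (pop a) ∷ decodes f m n b)
        (pop-child (index g) (indexs gs)) (top-child (index g) (indexs gs)))
      (cong₂ _∷_ (decode-index g (≤-trans (m≤m⊔n (height g) _) h))
                 (decodes-index gs (≤-trans (m≤n⊔m (height g) _) h)))

  -- The number carries its own fuel as outermost entry, to be matched with the height of the code.
  enumerate : ℕ → Code 1 1
  enumerate c = decode (top c) (top (pop c)) 1 (pop (pop c))

  enumerate-surjective : ∀ e → ∃[ c ] enumerate c ≡ e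
  enumerate-surjective e = child (index e) (height e) , trans
    (cong₂ (λ f c → decode f (top c) 1 (pop c)) (top-child (index e) (height e)) (pop-child (index e) (height e)))
    (decode-index e ≤-refl)

-- Forcing conditions and the generic sequence.

module Forcing where

  open import Axiom.ExcludedMiddle using (ExcludedMiddle)
  open import Data.Bool.Base using (true; false)
  open import Data.Empty using (⊥)
  open import Data.Fin.Patterns using (0F)
  open import Data.List.Base using (List; []; _∷_; length; applyUpTo)
  open import Data.Nat.Base hiding (parity)
  open import Data.Nat.Properties
  open import Data.Product.Base using (Σ-syntax; ∃-syntax; _×_; _,_; proj₁; proj₂)
  open import Data.Sum.Base using (_⊎_; inj₁; inj₂)
  open import Data.Vec.Base using (lookup; []; _∷_)
  open import Level using (0ℓ)
  open import Relation.Binary.PropositionalEquality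
  open import Relation.Nullary.Decidable.Core using (Dec; yes; no)
  open import Relation.Nullary.Negation using (¬_)
  open import Relation.Unary using (Pred; _⊆_; _∪_)
  open import Defs using (ℝ; Str; bit; Code; _⊢_[_]↓_; PartialRecursive; _⟨_⟩↓_; Baire; Cantor; _≤T_; asBaire; _↾ˢ_;
    Deep; UniversalLeftRESemimeasure)
  open Computability
  open Arithmetic
  open Simulation
  open Bushy
  open Growth
  open Search
  open Prediction
  open Enumeration

  entry-Extends : ∀ {q σ τ} → Extends q σ τ → ∀ {n} → n < length σ → entry (enc τ) n ≡ entry (enc σ) n
  entry-Extends here                   n<ℓ = refl
  entry-Extends (snoc {τ} {i} i<q ext) n<ℓ =
    trans (entry-init i τ (≤-trans n<ℓ (Extends-length ext))) (entry-Extends ext n<ℓ)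

  entry-< : ∀ {q τ} → Extends q [] τ → ∀ {n} → n < length τ → entry (enc τ) n < q n
  entry-< {q} (snoc {τ} {i} i<q ext) {n} (s≤s n≤ℓ) with m≤n⇒m<n∨m≡n n≤ℓ
  ... | inj₁ n<ℓ  = ≤-trans (s≤s (≤-reflexive (entry-init i τ n<ℓ))) (entry-< ext n<ℓ)
  ... | inj₂ refl = ≤-trans (s≤s (≤-reflexive (entry-last i τ))) i<q

  entry-Hits : ∀ {R : ℕ → ℕ → Set} τ {n} → n < length τ → R n (entry (enc τ) n) → Hits R τ
  entry-Hits {R} (i ∷ τ) {n} (s≤s n≤ℓ) r with m≤n⇒m<n∨m≡n n≤ℓ
  ... | inj₁ n<ℓ  = inj₂ (entry-Hits τ n<ℓ (subst (R n) (entry-init i τ n<ℓ) r))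
  ... | inj₂ refl = inj₁ (subst (R n) (entry-last i τ) r)

  module _ (em : ExcludedMiddle 0ℓ) {M : Str → ℝ} (U : UniversalLeftRESemimeasure M)
           {P : Pred Cantor 0ℓ} (deep : Deep M P) (ψ : PartialRecursive) where

    private
      R : ℕ → ℕ
      R = depth em U deep

      Rᶜ : Rec {1} (λ xs → R (lookup xs 0F))
      Rᶜ = depthᶜ em U deep

      -- The first summand is the bigness allotted to the set added at a string with code j; the
      -- second bounds what has accumulated before.
      demand : ℕ → ℕ
      demand j = 2^ (R j) * j + j

    opaque

      stairs : Staircase demand
      stairs = staircase (2^ᶜ Rᶜ *ᶜ var 0F +ᶜ var 0F)

    open Staircase stairs

    -- `room` says that beyond the stem every string has at least `size` children, so the stem can
    -- be prolonged to any length while the excluded set remains small.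
    record Condition : Set₁ where
      no-eta-equality
      field
        stem     : List ℕ
        excluded : Pred (List ℕ) 0ℓ
        size     : ℕ
        bounded  : Extends q [] stem
        small    : ¬ Big q size excluded stem
        room     : ∀ n → length stem ≤ n → size ≤ q n

    open Condition

    record _≺_ (c d : Condition) : Set where
      field
        extends : Extends q (stem c) (stem d)
        longer  : length (stem c) < length (stem d)
        shrinks : excluded c ⊆ excluded d

    open _≺_

    -- On the left no later stem may converge on the first k arguments, so `e` is not total on the
    -- generic. On the right the stem already fixes an output with a prefix that has no extension in
    -- `P`.
    Forces : Code 1 1 → Condition → Set
    Forces e c = ∃[ k ] ((Converges e k ⊆ excluded c) ⊎
      (∃[ Y ] OutputsString e k Y (stem c) × ∃[ m ] m ≤ k × ¬ (P ↾ˢ m) (digits m Y)))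

    private
      threshold : Code 1 1 → ℕ
      threshold e = proj₁ (forced-string em U deep {q} qᶜ e)

      force-above : ∀ e c i {ρ} → threshold e ≤ enc ρ → size c ≤ enc ρ → Extends q (stem c) ρ →
        length (stem c) < length ρ → length ρ ≡ start (suc i) → ¬ Big q (size c) (excluded c) ρ →
        Dec (Big q (2^ (R (enc ρ)) * enc ρ) (Converges e (R (enc ρ))) ρ) →
        Σ[ d ∈ Condition ] c ≺ d × Forces e d
      force-above e c i {ρ} t≤ size≤ ext longer′ length≡ ρ-small (no not-big) = record
          { stem     = ρ
          ; excluded = excluded c ∪ Converges e (R (enc ρ))
          ; size     = size c + 2^ (R (enc ρ)) * enc ρ
          ; bounded  = ρ-bounded
          ; small    = λ big → split (Big-∪ em {size c} {2^ (R (enc ρ)) * enc ρ} big)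
          ; room     = λ n ρ≤n → ≤-trans (≤-trans (+-monoˡ-≤ (2^ (R (enc ρ)) * enc ρ) size≤)
                         (≤-reflexive (+-comm (enc ρ) (2^ (R (enc ρ)) * enc ρ)))) (jump i ρ-bounded length≡ ρ≤n)
          } ,
          record { extends = ext ; longer = longer′ ; shrinks = inj₁ } , R (enc ρ) , inj₁ inj₂
        where
        ρ-bounded : Extends q [] ρ
        ρ-bounded = Extends-trans (bounded c) ext
        split : ¬ (Big q (size c) (excluded c) ρ ⊎ Big q (2^ (R (enc ρ)) * enc ρ) (Converges e (R (enc ρ))) ρ)
        split (inj₁ b) = ρ-small b
        split (inj₂ b) = not-big b
      force-above e c i {ρ} t≤ size≤ ext longer′ length≡ ρ-small (yes big) =
        let Y , big′ , m , m≤ , y∉P = proj₂ (forced-string em U deep {q} qᶜ e) {ρ} t≤ big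
            τ , ext′ , output , τ-small = Big-avoid em {enc ρ} {size c} size≤ big′ ρ-small
        in record
             { stem     = τ
             ; excluded = excluded c
             ; size     = size c
             ; bounded  = Extends-trans (bounded c) (Extends-trans ext ext′)
             ; small    = τ-small
             ; room     = λ n τ≤n → room c n (≤-trans (Extends-length ext) (≤-trans (Extends-length ext′) τ≤n))
             } ,
           record { extends = Extends-trans ext ext′ ; longer = ≤-trans longer′ (Extends-length ext′)
                  ; shrinks = λ x → x } , R (enc ρ) , inj₂ (Y , output , m , m≤ , y∉P)

      stretch : ∀ c {n} → length (stem c) ≤ n →
        ∃[ ρ ] Extends q (stem c) ρ × length ρ ≡ n × ¬ Big q (size c) (excluded c) ρ
      stretch c ℓ≤n =
        let d , eq = m≤n⇒∃[o]m+o≡n ℓ≤n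
            ρ , ext , ρ≡ , ρ-small = small-extend em {size c} d (room c) (small c)
        in ρ , ext , trans ρ≡ (trans (+-comm d (length (stem c))) eq) , ρ-small

      force-from : ∀ e c t → threshold e ≡ t → Σ[ d ∈ Condition ] c ≺ d × Forces e d
      force-from e c t t≡ =
        let ρ , ext , length≡ , ρ-small = stretch c {start (suc ℓ)} (≤-trans (≤-trans a≤ℓ (n≤1+n ℓ)) (start≥ (suc ℓ)))
            ℓ<ρ = ≤-trans (start≥ (suc ℓ)) (≤-reflexive (sym length≡))
            ℓ≤code = ≤-trans (<⇒≤ ℓ<ρ) (length≤enc ρ)
        in force-above e c ℓ {ρ} (≤-trans (≤-reflexive t≡) (≤-trans t≤ℓ ℓ≤code)) (≤-trans size≤ℓ ℓ≤code) ext
             (≤-trans (s≤s a≤ℓ) ℓ<ρ) length≡ ρ-small em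
        where
        -- This dominates stem length, threshold and size at once. The chosen ρ is longer than ℓ,
        -- and its code is at least its length, so all these bounds pass to j.
        ℓ : ℕ
        ℓ = length (stem c) + t + size c
        a≤ℓ : length (stem c) ≤ ℓ
        a≤ℓ = ≤-trans (m≤m+n (length (stem c)) t) (m≤m+n _ (size c))
        t≤ℓ : t ≤ ℓ
        t≤ℓ = ≤-trans (m≤n+m t (length (stem c))) (m≤m+n _ (size c))
        size≤ℓ : size c ≤ ℓ
        size≤ℓ = m≤n+m (size c) _

    abstract

      force : ∀ e c → Σ[ d ∈ Condition ] c ≺ d × Forces e d
      force e c = force-from e c (threshold e) refl

    Value : ℕ → ℕ → Set
    Value n y = ψ ⟨ n ⟩↓ y

    start-condition : Condition
    start-condition = record
      { stem = [] ; excluded = Hits Value ; size = 2 ; bounded = here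
      ; small = Hits-small em ↓-deterministic λ ()
      ; room = λ n _ → q≥2 n }

    cond : ℕ → Condition
    cond zero    = start-condition
    cond (suc n) = proj₁ (force (enumerate n) (cond n))

    cond-≺ : ∀ n → cond n ≺ cond (suc n)
    cond-≺ n = proj₁ (proj₂ (force (enumerate n) (cond n)))

    private
      cond-extends′ : ∀ {m n} → m ≤′ n → Extends q (stem (cond m)) (stem (cond n))
      cond-extends′ ≤′-refl             = here
      cond-extends′ (≤′-step {n} m≤n) = Extends-trans (cond-extends′ m≤n) (extends (cond-≺ n))

      cond-shrinks′ : ∀ {m n} → m ≤′ n → excluded (cond m) ⊆ excluded (cond n)
      cond-shrinks′ ≤′-refl           x = x
      cond-shrinks′ (≤′-step {n} m≤n) x = shrinks (cond-≺ n) (cond-shrinks′ m≤n x)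

    cond-extends : ∀ {m n} → m ≤ n → Extends q (stem (cond m)) (stem (cond n))
    cond-extends m≤n = cond-extends′ (≤⇒≤′ m≤n)

    cond-shrinks : ∀ {m n} → m ≤ n → excluded (cond m) ⊆ excluded (cond n)
    cond-shrinks m≤n = cond-shrinks′ (≤⇒≤′ m≤n)

    cond-length : ∀ n → n ≤ length (stem (cond n))
    cond-length zero    = z≤n
    cond-length (suc n) = ≤-trans (s≤s (cond-length n)) (longer (cond-≺ n))

    not-excluded : ∀ n → ¬ excluded (cond n) (stem (cond n))
    not-excluded n x = small (cond n) (leaf x)

    -- By `cond-length` the stem after n + 1 steps has an n-th entry, and later stems preserve it.
    generic : Baire
    generic n = entry (enc (stem (cond (suc n)))) n

    generic-agrees : ∀ m → Agrees {1} (λ _ → generic) (enc (stem (cond m)))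
    generic-agrees m _ n n<len = either (≤-total m (suc n))
      where
      either : m ≤ suc n ⊎ suc n ≤ m → generic n ≡ entry (enc (stem (cond m))) n
      either (inj₁ m≤1+n) = entry-Extends (cond-extends m≤1+n) (≤-trans n<len (≤-reflexive (len-enc (stem (cond m)))))
      either (inj₂ 1+n≤m) = sym (entry-Extends (cond-extends 1+n≤m) (cond-length (suc n)))

    generic-< : ∀ n → generic n < q n
    generic-< n = entry-< (bounded (cond (suc n))) (cond-length (suc n))

    generic-avoids : ¬ (∃[ n ] ψ ⟨ n ⟩↓ generic n)
    generic-avoids (n , hit) = not-excluded (suc n)
      (cond-shrinks {0} {suc n} z≤n (entry-Hits {Value} (stem (cond (suc n))) (cond-length (suc n)) hit))

    private
      bit-isPos-injective : ∀ {m b} → m ≡ bit b → isPos m ≡ b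
      bit-isPos-injective {b = false} refl = refl
      bit-isPos-injective {b = true}  refl = refl

      applyUpTo-cong : ∀ {f g : Cantor} m → (∀ i → i < m → f i ≡ g i) → applyUpTo f m ≡ applyUpTo g m
      applyUpTo-cong zero    h = refl
      applyUpTo-cong (suc m) h = cong₂ _∷_ (h 0 z<s) (applyUpTo-cong m λ i i<m → h (suc i) (s≤s i<m))

      long : ∀ ℓ → ∃[ c ] Agrees {1} (λ _ → generic) c × ℓ ≤ len c
      long ℓ = enc (stem (cond ℓ)) , generic-agrees ℓ ,
        ≤-trans (cond-length ℓ) (≤-reflexive (sym (len-enc (stem (cond ℓ)))))

      cap : ∀ b → sg (suc (bit b)) + sg (pred (suc (bit b))) ≡ suc (bit b)
      cap false = refl
      cap true  = refl

      -- Outputs are read as bits by collapsing positive values to 1; nothing is lost when the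
      -- actual value is a bit.
      output-bit : ∀ v {b} → sg v + sg (pred v) ≡ suc b → ∃[ y ] v ≡ suc y × (∀ c → y ≡ bit c → b ≡ bit c)
      output-bit (suc y) {b} eq = y , refl , λ { c refl → suc-injective (trans (sym eq) (cap c)) }

      converged : ∀ {e : Code 1 1} {Z : Baire} → (∀ i → (λ _ → generic) ⊢ e [ i ∷ [] ]↓ Z i) → ∀ b k →
        ∃[ m ] k ≤ m × (∀ i → i < b → sim e (enc (stem (cond m))) (i ∷ []) ≡ suc (Z i))
      converged {e} {Z} computesZ b k = ℓ ⊔ k , m≤n⊔m ℓ k , λ i i<b →
        proj₂ eventually i i<b (len c) (≤-trans (≤-trans (m≤m⊔n ℓ k) (cond-length (ℓ ⊔ k)))
          (≤-reflexive (sym (len-enc (stem (cond (ℓ ⊔ k))))))) c (generic-agrees (ℓ ⊔ k)) refl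
        where
        eventually : ∃[ ℓ ] ∀ i → i < b → ∀ n → ℓ ≤ n → ∀ c → Agrees {1} (λ _ → generic) c → len c ≡ n →
          sim e c (i ∷ []) ≡ suc (Z i)
        eventually = uniform-< b (λ i _ → sim-complete (computesZ i))
        ℓ c : ℕ
        ℓ = proj₁ eventually
        c = enc (stem (cond (ℓ ⊔ k)))

      -- In the first case, convergence of `e` on the first b arguments uses finitely much of the
      -- generic, so some later stem lies in its own excluded set. In the second, soundness of the
      -- simulation makes the forced digits an initial segment of Y, which is in `P`.
      refute : ∀ k {e : Code 1 1} {Z : Baire} {Y : Cantor} → Forces e (cond k) → (∀ i → (λ _ → generic) ⊢ e [ i ∷ [] ]↓ Z i) →
        P Y → (∀ i → Z i ≡ bit (Y i)) → ⊥
      refute k {e} {Z} {Y} (b , inj₁ diverges) computesZ Y∈P Z≡Y =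
        let m , k≤m , values = converged {e} {Z} computesZ b k
        in not-excluded m (cond-shrinks {k} {m} k≤m (diverges λ i i<b → Y i ,
             trans (cong (λ v → sg v + sg (pred v)) (trans (values i i<b) (cong suc (Z≡Y i)))) (cap (Y i))))
      refute k {e} {Z} {Y} (b , inj₂ (Y′ , outputs , m , m≤b , ∉P)) computesZ Y∈P Z≡Y =
        ∉P (Y , Y∈P , applyUpTo-cong m same)
        where
        same : ∀ i → i < m → isPos (bitAt Y′ i) ≡ Y i
        same i i<m =
          let y , eq , value = output-bit (sim e (enc (stem (cond k))) (i ∷ [])) (outputs i (≤-trans i<m m≤b))
          in bit-isPos-injective (value (Y i) (trans
               (↓-unique long {e} (sim-sound (generic-agrees k) e eq) (computesZ i)) (Z≡Y i)))

    generic-weak : ∀ Z → asBaire P Z → ¬ (Z ≤T generic)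
    generic-weak Z (Y , Y∈P , Z≡Y) (e , computesZ) =
      let k , eq = enumerate-surjective e
      in refute (suc k) {e} {Z} (subst (λ e → Forces e (cond (suc k))) eq (proj₂ (proj₂ (force (enumerate k) (cond k)))))
           computesZ Y∈P Z≡Y

-- The staircase as a slow-growing order function.

module SlowGrowth where

  open import Data.Fin.Patterns using (0F)
  import Data.Integer.Base as ℤ
  open import Data.List.Base using (applyUpTo)
  open import Data.Nat.Base as ℕ using (ℕ; zero; suc; z≤n; s≤s)
  import Data.Nat.Properties as ℕP
  open import Data.Product.Base using (∃-syntax; _,_)
  open import Data.Rational.Base
  open import Data.Rational.Properties
  open import Data.Vec.Base using ([]; _∷_; lookup)
  open import Function.Base using (_∘_)
  open import Relation.Binary.PropositionalEquality
  open import Relation.Nullary.Decidable using (from-yes)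
  import Defs
  open Defs using (2^-_; 0≤2^-; ℝ; seq; fromℕ; 1ℝ; recip; 1/⟨1⊔_⟩; Computable₂; OrderFunction; SlowGrowing; UniformlyComputable)
  open Computability using (Rec; code; computes; ap₁; var; const)
  open Growth
  open Dyadic
  open RealBounds

  private
    nat-+ : ∀ k l → ℤ.+ (k ℕ.+ l) / 1 ≡ ℤ.+ k / 1 + ℤ.+ l / 1
    nat-+ k l = trans (nat (k ℕ.+ l)) (trans (times-+ k l 1ℚ) (cong₂ _+_ (sym (nat k)) (sym (nat l))))

    nat-bound : ∀ p → ∃[ k ] p ≤ ℤ.+ k / 1
    nat-bound p with ↥ p in eq
    ... | ℤ.+ a      = a , ≤-trans (≤-reflexive (trans (sym (↥p/↧p≡p p)) (cong (λ n → n / ↧ₙ p) eq))) (⊖/-≤ a 0 (ℚ.denominator-1 p))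
    ... | ℤ.-[1+ a ] = 0 , ≤-trans (≤-reflexive (trans (sym (↥p/↧p≡p p)) (cong (λ n → n / ↧ₙ p) eq))) (⊖/-≤ 0 (suc a) (ℚ.denominator-1 p))

  fromℕ-< : ∀ {k l} → k ℕ.< l → fromℕ k Defs.< fromℕ l
  -- At index 2 the slack is 1/4 + 1/4, less than the gap 1 between distinct integers; at indices 0
  -- and 1 it is not.
  fromℕ-< {k} {l} k<l = 2 , (begin-strict
    ℤ.+ k / 1 + (2^- 2 + 2^- 2)  <⟨ +-monoʳ-< (ℤ.+ k / 1) (from-yes ((2^- 2 + 2^- 2) <? 1ℚ)) ⟩
    ℤ.+ k / 1 + 1ℚ               ≡⟨ +-comm (ℤ.+ k / 1) 1ℚ ⟩
    1ℚ + ℤ.+ k / 1               ≡⟨ nat-+ 1 k ⟨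
    ℤ.+ suc k / 1                ≤⟨ nat-mono-≤ k<l ⟩
    ℤ.+ l / 1                    ∎)
    where open ≤-Reasoning

  -- At index 0 the slack in the strict order of reals is 1 + 1.
  exceeded : ∀ (B : ℝ) → ∃[ k ] seq B 0 + (1ℚ + 1ℚ) < ℤ.+ k / 1
  exceeded B with nat-bound (seq B 0)
  ... | k , p = 3 ℕ.+ k , (begin-strict
    seq B 0 + (1ℚ + 1ℚ)         <⟨ +-monoʳ-< (seq B 0) (from-yes ((1ℚ + 1ℚ) <? ℤ.+ 3 / 1)) ⟩
    seq B 0 + ℤ.+ 3 / 1         ≤⟨ +-monoˡ-≤ (ℤ.+ 3 / 1) p ⟩
    ℤ.+ k / 1 + ℤ.+ 3 / 1       ≡⟨ +-comm (ℤ.+ k / 1) (ℤ.+ 3 / 1) ⟩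
    ℤ.+ 3 / 1 + ℤ.+ k / 1       ≡⟨ nat-+ 3 k ⟨
    ℤ.+ (3 ℕ.+ k) / 1           ∎)
    where open ≤-Reasoning

  -- Sums over initial segments, in the order in which lists are summed
  private
    Sum : (ℕ → ℚ) → ℕ → ℚ
    Sum g zero    = 0ℚ
    Sum g (suc n) = g 0 + Sum (g ∘ suc) n

    Sum-split : ∀ g m n → Sum g (m ℕ.+ n) ≡ Sum g m + Sum (λ t → g (m ℕ.+ t)) n
    Sum-split g zero    n = sym (+-identityˡ _)
    Sum-split g (suc m) n = trans (cong (g 0 +_) (Sum-split (g ∘ suc) m n)) (sym (+-assoc (g 0) _ _))

    Sum-nonneg : ∀ {g} n → (∀ t → 0ℚ ≤ g t) → 0ℚ ≤ Sum g n
    Sum-nonneg zero    p = ≤-refl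
    Sum-nonneg (suc n) p = +-mono-≤ (p 0) (Sum-nonneg n (p ∘ suc))

    Sum-const : ∀ {g x} n → (∀ t → t ℕ.< n → g t ≡ x) → Sum g n ≡ times n x
    Sum-const zero    p = refl
    Sum-const (suc n) p = cong₂ _+_ (p 0 (s≤s z≤n)) (Sum-const n λ t t<n → p (suc t) (s≤s t<n))

    times-* : ∀ k x → times k x ≡ times k 1ℚ * x
    times-* zero    x = sym (*-zeroˡ x)
    times-* (suc k) x = trans (cong₂ _+_ (sym (*-identityˡ x)) (times-* k x))
      (sym (*-distribʳ-+ x 1ℚ (times k 1ℚ)))

    inverse : ℕ → ℚ
    inverse k = 1/⟨1⊔ ℤ.+ k / 1 ⟩

    1⊔-positive : ∀ p → Positive (1ℚ ⊔ p)
    1⊔-positive p = positive (<-≤-trans (positive⁻¹ 1ℚ) (p≤p⊔q 1ℚ p))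

    inverse-nonneg : ∀ k → 0ℚ ≤ inverse k
    inverse-nonneg k = <⇒≤ (positive⁻¹ (inverse k) {{1/pos⇒pos (1ℚ ⊔ (ℤ.+ k / 1)) {{1⊔-positive (ℤ.+ k / 1)}}}})

    times-inverse : ∀ k → 1 ℕ.≤ k → times k (inverse k) ≡ 1ℚ
    times-inverse k 1≤k = trans (times-* k (inverse k)) (trans
      (cong (_* inverse k) (trans (sym (nat k)) (sym (p≤q⇒p⊔q≡q (nat-mono-≤ 1≤k)))))
      (*-inverseʳ (1ℚ ⊔ (ℤ.+ k / 1)) {{pos⇒nonZero (1ℚ ⊔ (ℤ.+ k / 1)) {{1⊔-positive (ℤ.+ k / 1)}}}}))

  module _ {demand : ℕ → ℕ} (stairs : Staircase demand) where

    open Staircase stairs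

    qℝ : ℕ → ℝ
    qℝ = fromℕ ∘ q

    qℝ>1 : ∀ n → 1ℝ Defs.< qℝ n
    qℝ>1 n = fromℕ-< {1} (q≥2 n)

    q-uniformlyComputable : UniformlyComputable qℝ
    q-uniformlyComputable = (λ i _ → ℤ.+ q i / 1) ,
      ((λ i _ → q i) , (λ _ _ → 0) , (λ _ _ → 0) , first , zeros , zeros , λ _ _ → refl) ,
      λ i k →
        (λ n → ≤-trans (≤-trans (+-monoʳ-≤ (ℤ.+ q i / 1) (neg-antimono-≤ (0≤2^- k)))
                 (≤-reflexive (+-identityʳ (ℤ.+ q i / 1)))) (x≤x+y (+-mono-≤ (0≤2^- n) (0≤2^- n)))) ,
        (λ n → ≤-trans (x≤x+y (0≤2^- k)) (x≤x+y (+-mono-≤ (0≤2^- n) (0≤2^- n))))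
      where
      first : Computable₂ (λ i _ → q i)
      first = code cq , λ i k → computes cq (i ∷ k ∷ [])
        where
        cq : Rec {2} (λ xs → q (lookup xs 0F))
        cq = ap₁ q qᶜ (var 0F)
      zeros : Computable₂ (λ _ _ → 0)
      zeros = code {2} (const 0) , λ i k → computes {2} (const 0) (i ∷ k ∷ [])

    q-orderFunction : OrderFunction qℝ
    q-orderFunction = record
      { computable    = q-uniformlyComputable
      ; nondecreasing = λ m≤n k → ≤-trans (nat-mono-≤ (q-mono m≤n)) (x≤x+y (+-mono-≤ (0≤2^- k) (0≤2^- k)))
      ; unbounded     = λ B → let k , p = exceeded B in
          start k , 0 , <-≤-trans p (nat-mono-≤ (ℕP.≤-trans (start≥ k) (start≤q k)))
      }

    private
      -- Real addition raises the index of approximation, but all the sequences involved are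
      -- constant, so the sum agrees with the rational one at every index.
      partial : ∀ (f : ℕ → ℕ) (g : ∀ n → 1ℝ Defs.< fromℕ (f n)) N m →
        seq (Defs.sum (applyUpTo (λ n → recip (fromℕ (f n)) (g n)) N)) m ≡ Sum (inverse ∘ f) N
      partial f g zero    m = refl
      partial f g (suc N) m = cong (inverse (f 0) +_) (partial (f ∘ suc) (g ∘ suc) N (suc m))

      w : ℕ → ℚ
      w n = inverse (q n)

      -- The first K places of a block with value K contribute K terms 1/K; the remaining terms up
      -- to the next start are nonnegative.
      one-per-block : ∀ i → ℤ.+ i / 1 ≤ Sum w (start i)
      one-per-block zero    = Sum-nonneg (start 0) λ t → inverse-nonneg (q t)
      one-per-block (suc i) with ℕP.m≤n⇒∃[o]m+o≡n (block-end i)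
      ... | rest , eq = begin
        ℤ.+ suc i / 1                                   ≡⟨ nat-+ 1 i ⟩
        1ℚ + ℤ.+ i / 1                                  ≡⟨ +-comm 1ℚ (ℤ.+ i / 1) ⟩
        ℤ.+ i / 1 + 1ℚ                                  ≤⟨ +-monoˡ-≤ 1ℚ (one-per-block i) ⟩
        Sum w (start i) + 1ℚ                            ≡⟨ cong (Sum w (start i) +_) (times-inverse K (ℕP.<⇒≤ (q≥2 (start i)))) ⟨
        Sum w (start i) + times K (inverse K)           ≡⟨ cong (Sum w (start i) +_) (Sum-const K λ t t<K → cong inverse (block i t t<K)) ⟨
        Sum w (start i) + Sum (λ t → w (start i ℕ.+ t)) K  ≡⟨ Sum-split w (start i) K ⟨
        Sum w (start i ℕ.+ K)                           ≤⟨ x≤x+y (Sum-nonneg rest λ t → inverse-nonneg (q (start i ℕ.+ K ℕ.+ t))) ⟩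
        Sum w (start i ℕ.+ K) + Sum (λ t → w (start i ℕ.+ K ℕ.+ t)) rest  ≡⟨ Sum-split w (start i ℕ.+ K) rest ⟨
        Sum w (start i ℕ.+ K ℕ.+ rest)                  ≡⟨ cong (Sum w) eq ⟩
        Sum w (start (suc i))                           ∎
        where
        open ≤-Reasoning hiding (start)
        K : ℕ
        K = q (start i)

    q-slowGrowing : SlowGrowing qℝ qℝ>1
    q-slowGrowing B = let k , p = exceeded B in
      start k , 0 , <-≤-trans p (≤-trans (one-per-block k) (≤-reflexive (sym (partial q qℝ>1 (start k) 0))))

-- No deep class has the weak degree of `LUAslow`.

open import Defs
open import Axiom.ExcludedMiddle using (ExcludedMiddle)
open import Data.Product.Base using (Σ-syntax; ∃; _×_; _,_)
open import Level using (0ℓ)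
open import Relation.Nullary.Negation using (¬_)
open import Relation.Unary using (Pred)
open Forcing using (stairs; generic; generic-<; generic-avoids; generic-weak)
open SlowGrowth using (fromℕ-<; qℝ; qℝ>1; q-orderFunction; q-slowGrowing)

mainTheorem7 : ExcludedMiddle 0ℓ → (M : Str → ℝ) → UniversalLeftRESemimeasure M →
    ¬ (Σ[ P ∈ Pred Cantor 0ℓ ] Π⁰₁ P × ∃ P × Deep M P × asBaire P ≡w LUAslow)
mainTheorem7 em M U (P , _ , (Y , Y∈P) , deep , P≤LUA , LUA≤P) =
  -- Nonemptiness of LUAslow provides a linearly universal function.
  let _ , (_ , _ , _ , _ , _ , ψ , universal , _) , _ = LUA≤P (λ n → bit (Y n)) (Y , Y∈P , λ _ → refl)
      X = generic em U deep ψ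
      s = stairs em U deep ψ
      Z , Z∈P , Z≤X = P≤LUA X (qℝ s , qℝ>1 s , q-orderFunction s , q-slowGrowing s ,
        (λ n → fromℕ-< (generic-< em U deep ψ n)) , ψ , universal , generic-avoids em U deep ψ)
  in generic-weak em U deep ψ Z Z∈P Z≤X
  where open import Relation.Binary.PropositionalEquality using (refl)
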